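{- For any coprime positive integers $m,n$ and any integer $k\ge1$, $$q^{(km-1)(kn-1)/2+(k-1)/2}\;Q^s_{km,kn}\;=\;q^{(km-1)kn}\,\frac{[k]_q}{[km]_q}\,D_{km,kn}$$ as operators on $\Lambda$.
   Context: Let $\Lambda$ be the ring of symmetric functions in the infinite alphabet $X=x_1+x_2+\cdots$ with coefficients in $\mathbb{Q}(q)$. Plethystic notation: for a formal expression $E$, $p_k[E]$ is obtained from $E$ by replacing every variable (including $q$ and an auxiliary variable $z$) by its $k$-th power; for $F\in\Lambda$, $F[E]$ is obtained by writing $F$ as a polynomial in the power sums and substituting $p_k\mapsto p_k[E]$. Set $\Omega[E]=\exp(\sum_{k\ge1}p_k[E]/k)$, so $\Omega[-zX]=\sum_{r\ge0}(-z)^re_r[X]$. For an integer $u$ put $[u]_q=(1-q^u)/(1-q)$; set $t=1/q$, $[u]_t=(1-q^{ -u})/(1-q^{ -1})$, $M=(1-t)(1-q)$. For integers $u,v$ let $D_{u,v}F[X]=F[X+M[u]_q/z]\,\Omega[-z[u]_tX]\big|_{z^v}$ (coefficient of $z^v$ in the expansion in $z$). Operators $Q^s_{m,n}$ (the specialization at $t=1/q$ of the operators $Q_{m,n}$ of Burban–Schiffmann) are defined as follows, with $[A,B]=AB-BA$. For coprime positive integers $m,n$: if $m=1$, $Q^s_{1,n}=D_{1,n}$ (also $Q^s_{1,0}=D_{1,0}$); if $m\ge2$, let $(a,b)$ be the unique integer pair with $1\le a\le m-1$ and $na-mb=1$, and set $Q^s_{m,n}=\frac1M[Q^s_{m-a,n-b},Q^s_{a,b}]$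 (both $(a,b)$ and $(m-a,n-b)$ are coprime pairs with first entry $\ge1$ and second entry $\ge0$). For $k\ge2$ and coprime positive $m,n$, set $Q^s_{km,kn}=\frac1M[Q^s_{km-a,kn-b},Q^s_{a,b}]$, where $(a,b)$ is any integer pair with $1\le a\le km-1$ and $na-mb=1$ (a lattice point of the $km\times kn$ rectangle strictly below and closest to the diagonal); the resulting operator is independent of this choice. -}

module Defs where

-- Symmetric functions over Q(q), plethystic operators D_{u,v} and the
-- Burban--Schiffmann operators Q^s_{m,n} (specialised at t = 1/q).

open import Data.Nat as ℕ using (ℕ; zero; suc; _∸_; _≡ᵇ_)
open import Data.Bool using (Bool; true; false; if_then_else_)
open import Data.Integer using (ℤ; +_)
open import Data.Rational as Q using (ℚ; 0ℚ; 1ℚ)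
open import Data.List as L using (List; []; _∷_; map; concatMap; replicate; _++_; filter; foldr; upTo; take)
open import Data.Product using (_×_; _,_; proj₁; proj₂)
open import Data.Maybe using (Maybe; just; nothing)
open import Relation.Binary.PropositionalEquality using (_≡_)
import Data.List.Properties as LP
open import Relation.Nullary.Decidable using (⌊_⌋)

-- ℚ[q] : polynomials as coefficient lists (constant term first)

Poly : Set
Poly = List ℚ

_+P_ : Poly → Poly → Poly
[] +P r = r
(a ∷ p) +P [] = a ∷ p
(a ∷ p) +P (b ∷ r) = (a Q.+ b) ∷ (p +P r)

scaleP : ℚ → Poly → Poly
scaleP c = map (c Q.*_)

_*P_ : Poly → Poly → Poly
[] *P r = []
(a ∷ p) *P r = scaleP a r +P (0ℚ ∷ (p *P r))

coeffP : Poly → ℕ → ℚ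
coeffP [] i = 0ℚ
coeffP (a ∷ p) zero = a
coeffP (a ∷ p) (suc i) = coeffP p i

_≈P_ : Poly → Poly → Set
p ≈P r = ∀ i → coeffP p i ≡ coeffP r i

qmon : ℕ → Poly
qmon k = replicate k 0ℚ ++ (1ℚ ∷ [])

-- ℚ(q) : fractions num/den of polynomials.  (Only fractions with nonzero
-- denominators are ever formed below.)

record Frac : Set where
  constructor _//_
  field
    num : Poly
    den : Poly
open Frac public

_≈F_ : Frac → Frac → Set
x ≈F y = (num x *P den y) ≈P (num y *P den x)

_+F_ : Frac → Frac → Frac
x +F y = ((num x *P den y) +P (num y *P den x)) // (den x *P den y)

_*F_ : Frac → Frac → Frac
x *F y = (num x *P num y) // (den x *P den y)

fromℚ : ℚ → Frac
fromℚ c = (c ∷ []) // (1ℚ ∷ [])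

fromℕF : ℕ → Frac
fromℕF n = fromℚ ((+ n) Q./ 1)

0F 1F -1F : Frac
0F = fromℚ 0ℚ
1F = fromℚ 1ℚ
-1F = fromℚ (Q.- 1ℚ)

-F_ : Frac → Frac
-F x = -1F *F x

_-F_ : Frac → Frac → Frac
x -F y = x +F (-F y)

invF : Frac → Frac
invF x = den x // num x

divF : Frac → Frac → Frac
divF x y = x *F invF y

qpow : ℕ → Frac
qpow k = qmon k // (1ℚ ∷ [])

qinv : ℕ → Frac
qinv k = invF (qpow k)

sumF : List Frac → Frac
sumF = foldr _+F_ 0F

-- [u]_{q^k} = (1 - q^{ku})/(1 - q^k)   (p_k applied to [u]_q)
bq : ℕ → ℕ → Frac
bq k u = divF (1F -F qpow (k ℕ.* u)) (1F -F qpow k)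

-- [u]_{t^k} with t = 1/q : (1 - q^{-ku})/(1 - q^{-k})
bt : ℕ → ℕ → Frac
bt k u = divF (1F -F qinv (k ℕ.* u)) (1F -F qinv k)

-- p_k[M] = (1 - t^k)(1 - q^k),   M = (1-t)(1-q)
Mk : ℕ → Frac
Mk k = (1F -F qinv k) *F (1F -F qpow k)

M : Frac
M = Mk 1

-- Λ = Q(q)[p_1, p_2, ...] : finite lists of terms  c · p_1^{e_1} p_2^{e_2} ⋯
-- a monomial is an exponent vector (e_1, e_2, ...) (trailing zeros irrelevant)

Mon : Set
Mon = List ℕ

addMon : Mon → Mon → Mon
addMon [] ν = ν
addMon (a ∷ μ) [] = a ∷ μ
addMon (a ∷ μ) (b ∷ ν) = (a ℕ.+ b) ∷ addMon μ ν

strip : Mon → Mon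
strip [] = []
strip (x ∷ xs) with strip xs
... | [] = if x ≡ᵇ 0 then [] else (x ∷ [])
... | y ∷ ys = x ∷ y ∷ ys

Λ : Set
Λ = List (Frac × Mon)

0Λ : Λ
0Λ = []

_+Λ_ : Λ → Λ → Λ
F +Λ G = F ++ G

scaleΛ : Frac → Λ → Λ
scaleΛ c = map (λ t → (c *F proj₁ t) , proj₂ t)

_-Λ_ : Λ → Λ → Λ
F -Λ G = F +Λ scaleΛ -1F G

_*Λ_ : Λ → Λ → Λ
F *Λ G = concatMap (λ s → map (λ t → (proj₁ s *F proj₁ t) , addMon (proj₂ s) (proj₂ t)) G) F

constΛ : Frac → Λ
constΛ c = (c , []) ∷ []

pΛ : ℕ → Λ
pΛ k = (1F , (replicate (k ∸ 1) 0 ++ (1 ∷ []))) ∷ []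

coeffΛ : Λ → Mon → Frac
coeffΛ F μ = sumF (map proj₁ (filter (λ t → LP.≡-dec ℕ._≟_ (strip (proj₂ t)) (strip μ)) F))

_≈Λ_ : Λ → Λ → Set
F ≈Λ G = ∀ μ → coeffΛ F μ ≈F coeffΛ G μ

Op : Set
Op = Λ → Λ

_≈Op_ : Op → Op → Set
A ≈Op B = ∀ F → A F ≈Λ B F

_•_ : Frac → Op → Op
(c • A) F = scaleΛ c (A F)

⟦_,_⟧ : Op → Op → Op
⟦ A , B ⟧ F = A (B F) -Λ B (A F)

-- Series / Laurent polynomials in one variable with coefficients in Λ
-- (list index j = coefficient of w^j)

addL : List Λ → List Λ → List Λ
addL [] G = G
addL (f ∷ F) [] = f ∷ F
addL (f ∷ F) (g ∷ G) = (f +Λ g) ∷ addL F G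

mulL : List Λ → List Λ → List Λ
mulL [] G = []
mulL (f ∷ F) G = addL (map (f *Λ_) G) (0Λ ∷ mulL F G)

powL : List Λ → ℕ → List Λ
powL S zero = constΛ 1F ∷ []
powL S (suc j) = mulL S (powL S j)

lookupL : List Λ → ℕ → Λ
lookupL [] j = 0Λ
lookupL (f ∷ F) zero = f
lookupL (f ∷ F) (suc j) = lookupL F j

-- F[X + M[u]_q / z] as a polynomial in w = 1/z :
-- substitute p_i ↦ p_i + p_i[M[u]_q] w^i,  p_i[M[u]_q] = p_i[M] · [u]_{q^i}
substVar : ℕ → ℕ → List Λ
substVar u i = pΛ i ∷ (replicate (i ∸ 1) 0Λ ++ (constΛ (Mk i *F bq i u) ∷ []))

substMon : ℕ → ℕ → Mon → List Λ
substMon u i [] = constΛ 1F ∷ []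
substMon u i (e ∷ μ) = mulL (powL (substVar u i) e) (substMon u (suc i) μ)

shiftPlus : ℕ → Λ → List Λ
shiftPlus u [] = []
shiftPlus u ((c , μ) ∷ F) = addL (map (scaleΛ c) (substMon u 1 μ)) (shiftPlus u F)

-- coefficient of z^r in Ω[-z [u]_t X] = exp( Σ_k p_k[-z[u]_t X] / k ),
-- p_k[-z[u]_t X] = - z^k [u]_{t^k} p_k ; exp computed as Σ_j S^j / j!
omegaSeries : ℕ → ℕ → List Λ
omegaSeries u N = 0Λ ∷ map (λ k → scaleΛ (divF (-F bt (suc k) u) (fromℕF (suc k))) (pΛ (suc k))) (upTo N)

fact : ℕ → ℕ
fact zero = 1
fact (suc n) = suc n ℕ.* fact n

omegaCoeff : ℕ → ℕ → Λ
omegaCoeff u r = foldr _+Λ_ 0Λ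
  (map (λ j → scaleΛ (invF (fromℕF (fact j))) (lookupL (powL (omegaSeries u r) j) r)) (upTo (suc r)))

sumΛ : List Λ → Λ
sumΛ = foldr _+Λ_ 0Λ

-- D_{u,v} F = [ F[X + M[u]_q/z] Ω[-z[u]_t X] ]_{z^v}
--          = Σ_j [w^j] F[X + M[u]_q/z] · [z^{v+j}] Ω[-z[u]_t X]
D : ℕ → ℕ → Op
D u v F = sumΛ (map (λ j → lookupL S j *Λ omegaCoeff u (v ℕ.+ j)) (upTo (L.length S)))
  where S = shiftPlus u F

-- smallest a ∈ [1, k m - 1] with n a ≡ 1 (mod m), together with
-- b = (n a - 1)/m, so that n a - m b = 1
findA : (m n : ℕ) → .{{ℕ.NonZero m}} → List ℕ → Maybe (ℕ × ℕ)
findA m n [] = nothing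
findA m n (a ∷ as) =
  if ((n ℕ.* a) ℕ.% m) ≡ᵇ (1 ℕ.% m)
  then just (a , ((n ℕ.* a ∸ 1) ℕ./ m))
  else findA m n as

choose : ℕ → ℕ → ℕ → ℕ × ℕ
choose k zero n = (0 , 0)
choose k (suc m) n with findA (suc m) n (map suc (upTo (k ℕ.* suc m ∸ 1)))
... | just ab = ab
... | nothing = (0 , 0)

-- coprime pairs (m, n), with fuel ≥ m
Qf : ℕ → ℕ → ℕ → Op
Qf f (suc zero) n = D 1 n
Qf zero m n = D m n   -- unreachable for m ≥ 1 with fuel ≥ m
Qf (suc f) m n with choose 1 m n
... | (a , b) = invF M • ⟦ Qf f (m ∸ a) (n ∸ b) , Qf f a b ⟧

-- Q^s_{m,n} for coprime m ≥ 1, n ≥ 0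
Qs : ℕ → ℕ → Op
Qs m n = Qf m m n

-- Q^s_{km,kn} for coprime m, n ≥ 1 and k ≥ 1
QsK : ℕ → ℕ → ℕ → Op
QsK (suc zero) m n = Qs m n
QsK k m n with choose k m n
... | (a , b) = invF M • ⟦ Qs (k ℕ.* m ∸ a) (k ℕ.* n ∸ b) , Qs a b ⟧

-- exponent (km-1)(kn-1)/2 + (k-1)/2  (an integer; computed as ⌊ … /2⌋ of the doubled value)
expL : ℕ → ℕ → ℕ → ℕ
expL k m n = ℕ.⌊ (k ℕ.* m ∸ 1) ℕ.* (k ℕ.* n ∸ 1) ℕ.+ (k ∸ 1) /2⌋

expR : ℕ → ℕ → ℕ → ℕ
expR k m n = (k ℕ.* m ∸ 1) ℕ.* (k ℕ.* n)

{-# OPTIONS --safe #-}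

-- Everything rests on the commutator formula
--   [D_{u,v}, D_{u′,v′}] = α (q^{uv′} - q^{u′v}) D_{u+u′,v+v′},  α = (1 - q^{-u})(1 - q^{-u′}) / (1 - q^{-u-u′}).
-- Since D_{u,v} p_k = p_k D_{u,v} + p_k[M[u]_q] D_{u,v+k}, multiplication by p_k transforms both sides
-- in the same way, so it is enough to apply them to 1.  Newton's recurrence for the coefficients of
-- Ω[-z[u′]_t X] shows that D_{u,v} acts on these coefficients through the kernel
--   (1 - w)(1 - xyw) / ((1 - xw)(1 - yw)) = 1 + α (1/(1 - xw) - 1/(1 - yw)),  x = q^u, y = q^{-u′},
-- and the two geometric series recombine D_{u,·} 1 and D_{u′,·} 1 into D_{u+u′,·} 1.
-- For the lattice point chosen in the definition of Q the scalar q^{uv′} - q^{u′v} is q^{uv′}(1 - q^k),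
-- whence by induction every Q is the asserted multiple of D.

module Submission where

open import Defs
open import Data.Nat using (ℕ; _≤_)
open import Data.Nat.Coprimality using (Coprime; coprime-Bézout)

open import Level using (0ℓ)
open import Algebra.Bundles using (CommutativeRing; RawRing)
import Algebra.Consequences.Setoid as Consequences
import Algebra.Definitions as Definitions
import Algebra.Properties.CommutativeSemiring.Exp as CommutativeExp
import Algebra.Properties.Ring as RingProperties
import Algebra.Properties.Semiring.Exp as Exp
import Algebra.Properties.Semiring.Mult.TCOptimised as Mult
import Algebra.Solver.Ring as RingSolver
open import Algebra.Solver.Ring.AlmostCommutativeRing using (fromCommutativeRing; _-Raw-AlmostCommutative⟶_)
open import Data.Bool.Base using (true; false; T)
open import Data.Integer.Base as ℤ using (ℤ; +_; -[1+_])
import Data.Integer.Properties as ℤₚ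
open import Data.List.Base as List using (List; []; _∷_; map; _++_; length; upTo; applyUpTo; replicate)
import Data.List.Properties as Listₚ
open import Data.List.Membership.Propositional using (_∈_)
open import Data.List.Membership.Propositional.Properties using (∈-map⁺; ∈-map⁻; ∈-++⁺ˡ; ∈-++⁺ʳ; ∈-++⁻; ∈-applyUpTo⁺; ∈-applyUpTo⁻)
open import Data.List.Relation.Unary.Any using (here; there)
open import Data.Maybe.Base using (Maybe; just; nothing)
open import Data.Nat.Base as ℕ using (zero; suc; _<_; z≤n; s≤s)
open import Data.Nat.DivMod using (m≡m%n+[m/n]*n; [m+kn]%n≡m%n; m%n<n; n%1≡0; m*n/n≡m; m<n⇒m%n≡m)
open import Data.Nat.Divisibility using (_∣_; _∣0; ∣-refl; ∣n⇒∣m*n; ∣m+n∣m⇒∣n; ∣1⇒≡1)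
open import Data.Nat.GCD using (module Bézout)
import Data.Nat.Properties as ℕₚ
open import Data.Nat.Tactic.RingSolver using (solve-∀)
open import Data.Product using (_×_; _,_; proj₁; proj₂; ∃; ∃₂)
open import Data.Rational.Base as ℚ using (ℚ; 0ℚ; 1ℚ; toℚᵘ)
import Data.Rational.Properties as ℚₚ
import Data.Rational.Unnormalised.Base as ℚᵘ
import Data.Rational.Unnormalised.Properties as ℚᵘₚ
open import Data.Sum.Base using (_⊎_; inj₁; inj₂)
open import Data.Unit.Base using (tt)
open import Function.Base using (_∘_)
open import Relation.Binary.Bundles using (Setoid)
open import Relation.Binary.PropositionalEquality as ≡ using (_≡_; cong; cong₂; subst; module ≡-Reasoning)
import Relation.Binary.Reasoning.Setoid as SetoidReasoning
open import Relation.Binary.Structures using (IsEquivalence)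
open import Relation.Nullary using (Dec; yes; no; ¬_; contradiction)

-- The kernel is an operator product. Summed over v, D_u(z) applied to Ω[-w[u′]_t X] gives Ω[-z[u]_t
-- X] Ω[-w[u′]_t X] times Ω[-(w/z) M[u]_q [u′]_t]. At t = 1/q the last argument collapses to M[u]_q
-- [u′]_t = (1 - q^u)(1 - q^(-u′)), four monomials, hence two linear factors above and two below. In
-- the opposite order the same rational function is expanded in z/w; the two expansions at each
-- simple pole together make a two-sided geometric series, and this leaves one coefficient of a
-- single D. `Λ` consists of lists with arbitrary formal fractions as coefficients, zero
-- denominators included, and `≈Op` ranges over all of them. Since `≈F` is not transitive there, the
-- identity is first proved in a ring over a genuine field, where such coefficients count as 0; a
-- separate degree argument shows that both sides have zero denominators at the same monomials.

module Solver (R : CommutativeRing 0ℓ 0ℓ) where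
  open CommutativeRing R
  open Mult semiring public using (×1-homo-*) renaming (_×_ to _·_; ×-homo-+ to ·-homo-+; 1+× to 1+·)
  open RingProperties ring using (-‿distribˡ-*; -‿distribʳ-*; -‿involutive; -0#≈0#; -‿anti-homo-+)
  open SetoidReasoning setoid

  -- The canonical map from ℤ. Equality of integer coefficients is decidable, so the solver can
  -- cancel terms in rings whose own equality is not.
  ⟪_⟫ : ℤ → Carrier
  ⟪ + n ⟫      = n · 1#
  ⟪ -[1+ n ] ⟫ = - (suc n · 1#)

  neg-homo : ∀ i → ⟪ ℤ.- i ⟫ ≈ - ⟪ i ⟫
  neg-homo (+ zero)  = sym -0#≈0#
  neg-homo (+ suc n) = refl
  neg-homo -[1+ n ]  = sym (-‿involutive _)

  private
    cancel : ∀ x y z → x - y ≈ (z + x) - (z + y)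
    cancel x y z = sym (begin
      (z + x) + - (z + y) ≈⟨ +-congˡ (trans (-‿anti-homo-+ z y) (+-comm _ _)) ⟩
      (z + x) + (- z + - y) ≈⟨ +-congʳ (+-comm z x) ⟩
      (x + z) + (- z + - y) ≈⟨ +-assoc x z _ ⟩
      x + (z + (- z + - y)) ≈⟨ +-congˡ (sym (+-assoc z _ _)) ⟩
      x + ((z + - z) + - y) ≈⟨ +-congˡ (+-congʳ (-‿inverseʳ z)) ⟩
      x + (0# + - y) ≈⟨ +-congˡ (+-identityˡ _) ⟩
      x + - y ∎)

    ⊖-homo : ∀ m n → ⟪ m ℤ.⊖ n ⟫ ≈ (m · 1#) - (n · 1#)
    ⊖-homo m zero = sym (trans (+-congˡ -0#≈0#) (+-identityʳ _))
    ⊖-homo zero (suc n) = sym (+-identityˡ _)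
    ⊖-homo (suc m) (suc n) = begin
      ⟪ suc m ℤ.⊖ suc n ⟫ ≈⟨ reflexive (cong ⟪_⟫ (ℤₚ.[1+m]⊖[1+n]≡m⊖n m n)) ⟩
      ⟪ m ℤ.⊖ n ⟫ ≈⟨ ⊖-homo m n ⟩
      (m · 1#) - (n · 1#) ≈⟨ cancel _ _ 1# ⟩
      (1# + m · 1#) - (1# + n · 1#) ≈⟨ +-cong (sym (1+· m 1#)) (-‿cong (sym (1+· n 1#))) ⟩
      (suc m · 1#) - (suc n · 1#) ∎

  add-homo : ∀ i j → ⟪ i ℤ.+ j ⟫ ≈ ⟪ i ⟫ + ⟪ j ⟫
  add-homo (+ m) (+ n) = ·-homo-+ 1# m n
  add-homo (+ m) -[1+ n ] = ⊖-homo m (suc n)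
  add-homo -[1+ m ] (+ n) = trans (⊖-homo n (suc m)) (+-comm _ _)
  add-homo -[1+ m ] -[1+ n ] = begin
    - (suc (suc (m ℕ.+ n)) · 1#) ≈⟨ -‿cong (reflexive (cong (λ k → suc k · 1#) (≡.sym (ℕₚ.+-suc m n)))) ⟩
    - ((suc m ℕ.+ suc n) · 1#) ≈⟨ -‿cong (·-homo-+ 1# (suc m) (suc n)) ⟩
    - (suc m · 1# + suc n · 1#) ≈⟨ trans (-‿anti-homo-+ _ _) (+-comm _ _) ⟩
    - (suc m · 1#) + - (suc n · 1#) ∎

  mul-homo : ∀ i j → ⟪ i ℤ.* j ⟫ ≈ ⟪ i ⟫ * ⟪ j ⟫
  mul-homo (+ m) (+ n) = trans (reflexive (cong ⟪_⟫ (≡.sym (ℤₚ.pos-* m n)))) (×1-homo-* m n)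
  mul-homo (+ m) -[1+ n ] = begin
    ⟪ + m ℤ.* -[1+ n ] ⟫ ≈⟨ reflexive (cong ⟪_⟫ (≡.sym (ℤₚ.neg-distribʳ-* (+ m) (+ suc n)))) ⟩
    ⟪ ℤ.- (+ m ℤ.* + suc n) ⟫ ≈⟨ neg-homo (+ m ℤ.* + suc n) ⟩
    - ⟪ + m ℤ.* + suc n ⟫ ≈⟨ -‿cong (mul-homo (+ m) (+ suc n)) ⟩
    - (m · 1# * (suc n · 1#)) ≈⟨ -‿distribʳ-* _ _ ⟩
    m · 1# * - (suc n · 1#) ∎
  mul-homo -[1+ m ] (+ n) = begin
    ⟪ -[1+ m ] ℤ.* + n ⟫ ≈⟨ reflexive (cong ⟪_⟫ (≡.sym (ℤₚ.neg-distribˡ-* (+ suc m) (+ n)))) ⟩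
    ⟪ ℤ.- (+ suc m ℤ.* + n) ⟫ ≈⟨ neg-homo (+ suc m ℤ.* + n) ⟩
    - ⟪ + suc m ℤ.* + n ⟫ ≈⟨ -‿cong (mul-homo (+ suc m) (+ n)) ⟩
    - (suc m · 1# * (n · 1#)) ≈⟨ -‿distribˡ-* _ _ ⟩
    - (suc m · 1#) * (n · 1#) ∎
  mul-homo -[1+ m ] -[1+ n ] = begin
    (suc m ℕ.* suc n) · 1# ≈⟨ ×1-homo-* (suc m) (suc n) ⟩
    suc m · 1# * (suc n · 1#) ≈⟨ sym (-‿involutive _) ⟩
    - - (suc m · 1# * (suc n · 1#)) ≈⟨ -‿cong (-‿distribˡ-* _ _) ⟩
    - (- (suc m · 1#) * (suc n · 1#)) ≈⟨ -‿distribʳ-* _ _ ⟩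
    - (suc m · 1#) * - (suc n · 1#) ∎

  private
    ℤ-coefficients : RawRing 0ℓ 0ℓ
    ℤ-coefficients = record { Carrier = ℤ ; _≈_ = _≡_ ; _+_ = ℤ._+_ ; _*_ = ℤ._*_ ; -_ = ℤ.-_ ; 0# = + 0 ; 1# = + 1 }

    morphism : ℤ-coefficients -Raw-AlmostCommutative⟶ fromCommutativeRing R
    morphism = record
      { ⟦_⟧ = ⟪_⟫ ; +-homo = add-homo ; *-homo = mul-homo ; -‿homo = neg-homo
      ; 0-homo = refl ; 1-homo = refl }

    equal? : ∀ i j → Maybe (⟪ i ⟫ ≈ ⟪ j ⟫)
    equal? i j with i ℤₚ.≟ j
    ... | yes i≡j = just (reflexive (cong ⟪_⟫ i≡j))
    ... | no _ = nothing

  open RingSolver ℤ-coefficients (fromCommutativeRing R) morphism equal? public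
    using (solve; con; _:+_; _:*_; _:-_; :-_; _:=_)

  +-interchange : ∀ a b c d → (a + b) + (c + d) ≈ (a + c) + (b + d)
  +-interchange = solve 4 (λ a b c d → (a :+ b) :+ (c :+ d) := (a :+ c) :+ (b :+ d)) refl

module _ {Carrier : Set} {_≈_ : Carrier → Carrier → Set} {_+_ _*_ : Carrier → Carrier → Carrier}
         { -_ : Carrier → Carrier} {0# 1# : Carrier} (≈-isEquivalence : IsEquivalence _≈_) where
  private
    S : Setoid 0ℓ 0ℓ
    S = record { isEquivalence = ≈-isEquivalence }
  open Definitions _≈_
  open Consequences S

  makeCommutativeRing : Congruent₂ _+_ → Associative _+_ → Commutative _+_ → LeftIdentity 0# _+_ →
    Congruent₁ -_ → LeftInverse 0# -_ _+_ →
    Congruent₂ _*_ → Associative _*_ → Commutative _*_ → LeftIdentity 1# _*_ → _*_ DistributesOverʳ _+_ →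
    CommutativeRing 0ℓ 0ℓ
  makeCommutativeRing +-cong +-assoc +-comm +-idˡ neg-cong +-invˡ *-cong *-assoc *-comm *-idˡ distribʳ = record
    { isCommutativeRing = record
      { isRing = record
        { +-isAbelianGroup = record
          { isGroup = record
            { isMonoid = record
              { isSemigroup = record
                { isMagma = record { isEquivalence = ≈-isEquivalence ; ∙-cong = +-cong }
                ; assoc = +-assoc }
              ; identity = comm∧idˡ⇒id +-comm +-idˡ }
            ; inverse = comm∧invˡ⇒inv +-comm +-invˡ
            ; ⁻¹-cong = neg-cong }
          ; comm = +-comm }
        ; *-cong = *-cong
        ; *-assoc = *-assoc
        ; *-identity = comm∧idˡ⇒id *-comm *-idˡ
        ; distrib = comm∧distrʳ⇒distr +-cong *-comm distribʳ }
      ; *-comm = *-comm } }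

module Powers (R : CommutativeRing 0ℓ 0ℓ) where
  open CommutativeRing R
  open Exp semiring public using (_^_; ^-homo-*; ^-congˡ; ^-assocʳ)
  open CommutativeExp commutativeSemiring public using (^-distrib-*)

  1^ : ∀ n → 1# ^ n ≈ 1#
  1^ zero    = refl
  1^ (suc n) = trans (*-identityˡ _) (1^ n)

  ^-inverse : ∀ {x y} → x * y ≈ 1# → ∀ n → x ^ n * y ^ n ≈ 1#
  ^-inverse {x} {y} xy≈1 n = trans (sym (^-distrib-* x y n)) (trans (^-congˡ n xy≈1) (1^ n))

-- Formal power series as coefficient sequences, with Newton's recurrence

module PowerSeries (R : CommutativeRing 0ℓ 0ℓ) where
  open CommutativeRing R
  open Solver R
  open Powers R
  open SetoidReasoning setoid

  Series : Set
  Series = ℕ → Carrier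

  infix 4 _≋_
  _≋_ : Series → Series → Set
  f ≋ g = ∀ n → f n ≈ g n

  infixl 7 _⊛_
  _⊛_ : Series → Series → Series
  (f ⊛ g) zero    = f 0 * g 0
  (f ⊛ g) (suc n) = f 0 * g (suc n) + (f ∘ suc ⊛ g) n

  δ : Series
  δ zero    = 1#
  δ (suc _) = 0#

  -- The n-th coefficient of a product sees only coefficients up to n. This bounded form is what
  -- strong inductions and truncated series can supply.
  ⊛-cong-≤ : ∀ {f f′ g g′} n → (∀ i → i ≤ n → f i ≈ f′ i) → (∀ i → i ≤ n → g i ≈ g′ i) → (f ⊛ g) n ≈ (f′ ⊛ g′) n
  ⊛-cong-≤ zero p r = *-cong (p 0 z≤n) (r 0 z≤n)
  ⊛-cong-≤ (suc n) p r = +-cong (*-cong (p 0 z≤n) (r (suc n) ℕₚ.≤-refl))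
    (⊛-cong-≤ n (λ i i≤n → p (suc i) (s≤s i≤n)) (λ i i≤n → r i (ℕₚ.m≤n⇒m≤1+n i≤n)))

  ⊛-cong : ∀ {f f′ g g′} → f ≋ f′ → g ≋ g′ → f ⊛ g ≋ f′ ⊛ g′
  ⊛-cong p r n = ⊛-cong-≤ n (λ i _ → p i) (λ i _ → r i)

  -- The recursion defining `⊛` peels off the constant term of the left factor; this peels off that
  -- of the right one, which gives commutativity by induction.
  ⊛-last : ∀ f g n → (f ⊛ g) (suc n) ≈ f (suc n) * g 0 + (f ⊛ g ∘ suc) n
  ⊛-last f g zero = +-comm _ _
  ⊛-last f g (suc n) = begin
    f 0 * g (2 ℕ.+ n) + (f ∘ suc ⊛ g) (suc n) ≈⟨ +-congˡ (⊛-last (f ∘ suc) g n) ⟩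
    f 0 * g (2 ℕ.+ n) + (f (2 ℕ.+ n) * g 0 + (f ∘ suc ⊛ g ∘ suc) n)
      ≈⟨ solve 3 (λ a b c → a :+ (b :+ c) := b :+ (a :+ c)) refl _ _ _ ⟩
    f (2 ℕ.+ n) * g 0 + (f ⊛ g ∘ suc) (suc n) ∎

  ⊛-comm : ∀ f g → f ⊛ g ≋ g ⊛ f
  ⊛-comm f g zero = *-comm _ _
  ⊛-comm f g (suc n) = sym (trans (⊛-last g f n) (+-cong (*-comm _ _) (⊛-comm g (f ∘ suc) n)))

  ⊛-distribʳ : ∀ h f g n → ((λ i → f i + g i) ⊛ h) n ≈ (f ⊛ h) n + (g ⊛ h) n
  ⊛-distribʳ h f g zero = distribʳ _ _ _
  ⊛-distribʳ h f g (suc n) = trans (+-cong (distribʳ _ _ _) (⊛-distribʳ h (f ∘ suc) (g ∘ suc) n)) (+-interchange _ _ _ _)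

  ⊛-scaleˡ : ∀ c f g n → ((λ i → c * f i) ⊛ g) n ≈ c * (f ⊛ g) n
  ⊛-scaleˡ c f g zero = *-assoc _ _ _
  ⊛-scaleˡ c f g (suc n) = trans (+-cong (*-assoc _ _ _) (⊛-scaleˡ c (f ∘ suc) g n)) (sym (distribˡ _ _ _))

  ⊛-zeroˡ : ∀ g n → ((λ _ → 0#) ⊛ g) n ≈ 0#
  ⊛-zeroˡ g zero = zeroˡ _
  ⊛-zeroˡ g (suc n) = trans (+-cong (zeroˡ _) (⊛-zeroˡ g n)) (+-identityˡ 0#)

  ⊛-identityˡ : ∀ g → δ ⊛ g ≋ g
  ⊛-identityˡ g zero = *-identityˡ _
  ⊛-identityˡ g (suc n) = trans (+-cong (*-identityˡ _) (⊛-zeroˡ g n)) (+-identityʳ _)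

  ⊛-assoc : ∀ f g h → (f ⊛ g) ⊛ h ≋ f ⊛ (g ⊛ h)
  ⊛-assoc f g h zero = *-assoc _ _ _
  ⊛-assoc f g h (suc n) = begin
    f 0 * g 0 * h (suc n) + ((λ i → f 0 * g (suc i) + (f ∘ suc ⊛ g) i) ⊛ h) n
      ≈⟨ +-congˡ (⊛-distribʳ h (λ i → f 0 * g (suc i)) (f ∘ suc ⊛ g) n) ⟩
    f 0 * g 0 * h (suc n) + (((λ i → f 0 * g (suc i)) ⊛ h) n + ((f ∘ suc ⊛ g) ⊛ h) n)
      ≈⟨ +-congˡ (+-cong (⊛-scaleˡ (f 0) (g ∘ suc) h n) (⊛-assoc (f ∘ suc) g h n)) ⟩
    f 0 * g 0 * h (suc n) + (f 0 * (g ∘ suc ⊛ h) n + (f ∘ suc ⊛ (g ⊛ h)) n)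
      ≈⟨ solve 5 (λ a b c d e → a :* b :* c :+ (a :* d :+ e) := a :* (b :* c :+ d) :+ e) refl _ _ _ _ _ ⟩
    f 0 * (g ⊛ h) (suc n) + (f ∘ suc ⊛ (g ⊛ h)) n ∎

  seriesRing : CommutativeRing 0ℓ 0ℓ
  seriesRing = makeCommutativeRing
    {_≈_ = _≋_} {_+_ = λ f g n → f n + g n} {_*_ = _⊛_} { -_ = λ f n → - f n} {0# = λ _ → 0#} {1# = δ}
    (record { refl = λ _ → refl ; sym = λ p n → sym (p n) ; trans = λ p r n → trans (p n) (r n) })
    (λ p r n → +-cong (p n) (r n)) (λ f g h n → +-assoc _ _ _) (λ f g n → +-comm _ _) (λ f n → +-identityˡ _)
    (λ p n → -‿cong (p n)) (λ f n → -‿inverseˡ _)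
    ⊛-cong ⊛-assoc ⊛-comm ⊛-identityˡ ⊛-distribʳ

  -- Substituting cz for z is multiplicative.
  ⊛-dilate : ∀ c f g n → ((λ i → c ^ i * f i) ⊛ (λ i → c ^ i * g i)) n ≈ c ^ n * (f ⊛ g) n
  ⊛-dilate c f g zero = solve 2 (λ a b → (con (+ 1) :* a) :* (con (+ 1) :* b) := con (+ 1) :* (a :* b)) refl _ _
  ⊛-dilate c f g (suc n) = begin
    1# * f 0 * (c * c ^ n * g (suc n)) + ((λ i → c * c ^ i * f (suc i)) ⊛ (λ i → c ^ i * g i)) n
      ≈⟨ +-congˡ (⊛-cong (λ i → *-assoc c (c ^ i) (f (suc i))) (λ _ → refl) n) ⟩
    1# * f 0 * (c * c ^ n * g (suc n)) + ((λ i → c * (c ^ i * f (suc i))) ⊛ (λ i → c ^ i * g i)) n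
      ≈⟨ +-congˡ (trans (⊛-scaleˡ c _ _ n) (*-congˡ (⊛-dilate c (f ∘ suc) g n))) ⟩
    1# * f 0 * (c * c ^ n * g (suc n)) + c * (c ^ n * (f ∘ suc ⊛ g) n)
      ≈⟨ solve 5 (λ a b d e h → con (+ 1) :* a :* (b :* d :* e) :+ b :* (d :* h) := b :* d :* (a :* e :+ h)) refl _ _ _ _ _ ⟩
    c * c ^ n * (f 0 * g (suc n) + (f ∘ suc ⊛ g) n) ∎

  -- Splitting a convolution at v counts the v-th term twice.
  ⊛-split : ∀ g h v w → (g ⊛ h) (v ℕ.+ w) + g v * h w ≈ ((λ j → g (v ℕ.+ j)) ⊛ h) w + ((λ j → h (w ℕ.+ j)) ⊛ g) v
  ⊛-split g h zero w = +-congˡ (trans (*-comm _ _) (*-congʳ (reflexive (cong h (≡.sym (ℕₚ.+-identityʳ w))))))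
  ⊛-split g h (suc v) w = begin
    (g 0 * h (suc (v ℕ.+ w)) + (g ∘ suc ⊛ h) (v ℕ.+ w)) + g (suc v) * h w
      ≈⟨ +-assoc _ _ _ ⟩
    g 0 * h (suc (v ℕ.+ w)) + ((g ∘ suc ⊛ h) (v ℕ.+ w) + g (suc v) * h w)
      ≈⟨ +-congˡ (⊛-split (g ∘ suc) h v w) ⟩
    g 0 * h (suc (v ℕ.+ w)) + (((λ j → g (suc v ℕ.+ j)) ⊛ h) w + ((λ j → h (w ℕ.+ j)) ⊛ g ∘ suc) v)
      ≈⟨ +-congʳ (trans (*-comm _ _) (*-congʳ (reflexive (cong h (≡.trans (cong suc (ℕₚ.+-comm v w)) (≡.sym (ℕₚ.+-suc w v))))))) ⟩
    h (w ℕ.+ suc v) * g 0 + (((λ j → g (suc v ℕ.+ j)) ⊛ h) w + ((λ j → h (w ℕ.+ j)) ⊛ g ∘ suc) v)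
      ≈⟨ solve 3 (λ a b c → a :+ (b :+ c) := b :+ (a :+ c)) refl _ _ _ ⟩
    ((λ j → g (suc v ℕ.+ j)) ⊛ h) w + (h (w ℕ.+ suc v) * g 0 + ((λ j → h (w ℕ.+ j)) ⊛ g ∘ suc) v)
      ≈⟨ +-congˡ (sym (⊛-last (λ j → h (w ℕ.+ j)) g v)) ⟩
    ((λ j → g (suc v ℕ.+ j)) ⊛ h) w + ((λ j → h (w ℕ.+ j)) ⊛ g) (suc v) ∎

  -- The Euler operator z d/dz.
  θ : Series → Series
  θ f n = n · 1# * f n

  -- s = z f′/f, that is Newton's recurrence n f_n = Σ_k s_k f_{n-k}.
  LogDer : Series → Series → Set
  LogDer f s = θ f ≋ s ⊛ f

  private module S = CommutativeRing seriesRing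
  open Solver seriesRing using () renaming (solve to solveˢ; con to conˢ; _:+_ to _⊕_; _:*_ to _⊗_; _:-_ to _⊖_; :-_ to ⊝_; _:=_ to _≐_)

  -- Leibniz rule. The i-th coefficient of `f ∘ suc` has weight i + 1 in `f`; the extra 1 is split
  -- off from n + 1 and returned at the end.
  θ-⊛ : ∀ f g → θ (f ⊛ g) ≋ λ n → (θ f ⊛ g) n + (f ⊛ θ g) n
  θ-⊛ f g zero = solve 2 (λ a b → con (+ 0) :* (a :* b) := con (+ 0) :* a :* b :+ a :* (con (+ 0) :* b)) refl _ _
  θ-⊛ f g (suc n) = begin
    suc n · 1# * (f 0 * g (suc n) + (f ∘ suc ⊛ g) n)
      ≈⟨ distribˡ _ _ _ ⟩
    suc n · 1# * (f 0 * g (suc n)) + suc n · 1# * (f ∘ suc ⊛ g) n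
      ≈⟨ +-congˡ (trans (*-congʳ (1+· n 1#)) (distribʳ _ _ _)) ⟩
    suc n · 1# * (f 0 * g (suc n)) + (1# * (f ∘ suc ⊛ g) n + n · 1# * (f ∘ suc ⊛ g) n)
      ≈⟨ +-congˡ (+-congˡ (θ-⊛ (f ∘ suc) g n)) ⟩
    suc n · 1# * (f 0 * g (suc n)) + (1# * (f ∘ suc ⊛ g) n + ((θ (f ∘ suc) ⊛ g) n + (f ∘ suc ⊛ θ g) n))
      ≈⟨ solve 6 (λ N a b c d e → N :* (a :* b) :+ (con (+ 1) :* c :+ (d :+ e))
                 := con (+ 0) :* a :* b :+ (c :+ d) :+ (a :* (N :* b) :+ e)) refl _ _ _ _ _ _ ⟩
    0# * f 0 * g (suc n) + ((f ∘ suc ⊛ g) n + (θ (f ∘ suc) ⊛ g) n) + (f ⊛ θ g) (suc n)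
      ≈⟨ +-congʳ (+-congˡ (trans (sym (⊛-distribʳ g (f ∘ suc) (θ (f ∘ suc)) n))
           (⊛-cong (λ i → sym (trans (*-congʳ (1+· i 1#)) (trans (distribʳ _ _ _) (+-congʳ (*-identityˡ _))))) (λ _ → refl) n))) ⟩
    (θ f ⊛ g) (suc n) + (f ⊛ θ g) (suc n) ∎

  LogDer-⊛ : ∀ {f g s t} → LogDer f s → LogDer g t → LogDer (f ⊛ g) (λ n → s n + t n)
  LogDer-⊛ {f} {g} {s} {t} F G = S.trans (θ-⊛ f g) (S.trans (S.+-cong (⊛-cong F S.refl) (⊛-cong S.refl G))
    (solveˢ 4 (λ s t f g → (s ⊗ f) ⊗ g ⊕ f ⊗ (t ⊗ g) ≐ (s ⊕ t) ⊗ (f ⊗ g)) S.refl s t f g))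

  LogDer-dilate : ∀ c {f s} → LogDer f s → LogDer (λ n → c ^ n * f n) (λ n → c ^ n * s n)
  LogDer-dilate c {f} {s} F n = begin
    n · 1# * (c ^ n * f n) ≈⟨ solve 3 (λ a b d → a :* (b :* d) := b :* (a :* d)) refl _ _ _ ⟩
    c ^ n * (n · 1# * f n) ≈⟨ *-congˡ (F n) ⟩
    c ^ n * (s ⊛ f) n ≈⟨ sym (⊛-dilate c s f n) ⟩
    ((λ i → c ^ i * s i) ⊛ (λ i → c ^ i * f i)) n ∎

  TorsionFree : Set
  TorsionFree = ∀ n {a b} → suc n · 1# * a ≈ suc n · 1# * b → a ≈ b

  -- Since s_0 = 0, the recurrence expresses i + 1 times the coefficient of index i + 1 through
  -- earlier ones; torsion-freeness removes the factor.
  LogDer-unique : TorsionFree → ∀ {f g s} → s 0 ≈ 0# → LogDer f s → LogDer g s → f 0 ≈ g 0 → f ≋ g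
  LogDer-unique tf {f} {g} {s} s₀ F G f₀ n = below n n ℕₚ.≤-refl
    where
    below : ∀ n i → i ≤ n → f i ≈ g i
    below n zero _ = f₀
    below (suc n) (suc i) (s≤s i≤n) = tf i (begin
      suc i · 1# * f (suc i) ≈⟨ F (suc i) ⟩
      s 0 * f (suc i) + (s ∘ suc ⊛ f) i ≈⟨ +-cong (trans (*-congʳ s₀) (trans (zeroˡ _) (sym (zeroˡ _))))
                                                  (⊛-cong-≤ i (λ _ _ → refl) (λ j j≤i → below n j (ℕₚ.≤-trans j≤i i≤n))) ⟩
      0# * g (suc i) + (s ∘ suc ⊛ g) i ≈⟨ +-congʳ (*-congʳ (sym s₀)) ⟩
      s 0 * g (suc i) + (s ∘ suc ⊛ g) i ≈⟨ sym (G (suc i)) ⟩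
      suc i · 1# * g (suc i) ∎)

  LogDer-cong : ∀ {f g s t} → f ≋ g → s ≋ t → LogDer f s → LogDer g t
  LogDer-cong f≋g s≋t F n = trans (*-congˡ (sym (f≋g n))) (trans (F n) (⊛-cong s≋t f≋g n))

  -- Scalars as constant series, so that scalar factors are within reach of the ring solver for
  -- series.
  const : Carrier → Series
  const c n = c * δ n

  const-⊛ : ∀ c g → const c ⊛ g ≋ λ n → c * g n
  const-⊛ c g n = trans (⊛-scaleˡ c δ g n) (*-congˡ (⊛-identityˡ g n))

  -- The variable of the series ring.
  W : Series
  W zero          = 0#
  W (suc zero)    = 1#
  W (suc (suc _)) = 0#

  -- 1/(1 - cW), cW/(1 - cW) and 1 - cW.
  geo powers linear : Carrier → Series
  geo c n = c ^ n
  powers c zero    = 0#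
  powers c (suc n) = c ^ suc n
  linear c = δ S.- const c ⊛ W

  linear-at-suc : ∀ c n → linear c (suc n) ≈ - c * δ n
  linear-at-suc c n = trans (+-congˡ (-‿cong (trans (const-⊛ c W (suc n)) (*-congˡ (W≈δ n)))))
    (solve 2 (λ c d → con (+ 0) :- c :* d := :- c :* d) refl _ _)
    where
    W≈δ : ∀ n → W (suc n) ≈ δ n
    W≈δ zero    = refl
    W≈δ (suc _) = refl

  linear-at-0 : ∀ c → linear c 0 ≈ 1#
  linear-at-0 c = trans (+-congˡ (-‿cong (zeroʳ _))) (solve 0 (con (+ 1) :- con (+ 0) := con (+ 1)) refl)

  linear-⊛-geo : ∀ c → linear c ⊛ geo c ≋ δ
  linear-⊛-geo c zero = trans (*-congʳ (linear-at-0 c)) (*-identityˡ _)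
  linear-⊛-geo c (suc n) = begin
    linear c 0 * c ^ suc n + (linear c ∘ suc ⊛ geo c) n
      ≈⟨ +-cong (*-congʳ (linear-at-0 c)) (trans (⊛-cong (linear-at-suc c) (λ _ → refl) n) (const-⊛ (- c) (geo c) n)) ⟩
    1# * (c * c ^ n) + - c * c ^ n
      ≈⟨ solve 2 (λ a b → con (+ 1) :* (a :* b) :+ (:- a) :* b := con (+ 0)) refl _ _ ⟩
    0# ∎

  geo≋δ+powers : ∀ c n → geo c n ≈ δ n + powers c n
  geo≋δ+powers c zero    = sym (+-identityʳ _)
  geo≋δ+powers c (suc n) = sym (+-identityˡ _)

  -- θ(1 - cW) = -cW = (1 - cW) - 1, and 1 = (1 - cW)(1 + `powers c`).
  LogDer-linear : ∀ c → LogDer (linear c) (λ n → - powers c n)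
  LogDer-linear c = S.trans θ-linear (S.sym (S.trans
    (solveˢ 3 (λ P L one → (⊝ P) ⊗ L ≐ one ⊗ L ⊖ (one ⊕ P) ⊗ L) S.refl (powers c) (linear c) δ)
    (S.+-cong (S.*-identityˡ (linear c)) (S.-‿cong (S.trans (S.*-congʳ (S.sym (geo≋δ+powers c)))
      (S.trans (S.*-comm (geo c) (linear c)) (linear-⊛-geo c)))))))
    where
    θ-linear : θ (linear c) ≋ linear c S.- δ
    θ-linear zero = trans (zeroˡ _) (sym (trans (+-congʳ (linear-at-0 c)) (-‿inverseʳ 1#)))
    θ-linear (suc zero) = solve 1 (λ a → con (+ 1) :* a := a :- con (+ 0)) refl _
    θ-linear (suc (suc n)) = trans (*-congˡ (linear-at-suc c (suc n))) (sym (trans (+-congʳ (linear-at-suc c (suc n)))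
      (solve 2 (λ a b → a :* con (+ 0) :- con (+ 0) := b :* (a :* con (+ 0))) refl _ _)))

  -- For c = 1 the recurrence merely counts: the square of Σ W^n has coefficients n + 1. Dilation
  -- gives general c.
  LogDer-geo : ∀ c → LogDer (geo c) (powers c)
  LogDer-geo c = LogDer-cong {λ n → c ^ n * 1#} {geo c} {λ n → c ^ n * powers1 n} {powers c}
    (λ n → *-identityʳ _) powers-dilate (LogDer-dilate c {λ _ → 1#} {powers1} LogDer-ones)
    where
    powers1 : Series
    powers1 zero    = 0#
    powers1 (suc _) = 1#
    powers-dilate : ∀ n → c ^ n * powers1 n ≈ powers c n
    powers-dilate zero    = zeroʳ _
    powers-dilate (suc n) = *-identityʳ _
    count : ∀ n → ((λ _ → 1#) ⊛ (λ _ → 1#)) n ≈ suc n · 1#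
    count zero    = *-identityˡ _
    count (suc n) = trans (+-cong (*-identityˡ _) (count n)) (sym (1+· (suc n) 1#))
    LogDer-ones : LogDer (λ _ → 1#) powers1
    LogDer-ones zero = refl
    LogDer-ones (suc n) = trans (*-identityʳ _) (sym (trans (+-cong (zeroˡ _) (count n)) (+-identityˡ _)))

  -- α is the residue in the partial fractions. It is specified by a product because x - y need not
  -- be invertible in the ring.
  module Kernel (x y α : Carrier) (α-eq : α * (x - y) ≈ (x - 1#) * (1# - y)) where

    -- (1 - W)(1 - xyW) / ((1 - xW)(1 - yW))
    kernel : Series
    kernel = linear 1# ⊛ linear (x * y) ⊛ (geo x ⊛ geo y)

    kernel-logDer : Series
    kernel-logDer n = - powers 1# n + - powers (x * y) n + (powers x n + powers y n)

    LogDer-kernel : LogDer kernel kernel-logDer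
    LogDer-kernel = LogDer-⊛ (LogDer-⊛ (LogDer-linear 1#) (LogDer-linear (x * y))) (LogDer-⊛ (LogDer-geo x) (LogDer-geo y))

    -- (1 - W)(1 - xyW) differs from (1 - xW)(1 - yW) by (x - 1)(1 - y)W, which `α-eq` turns into
    -- α((1 - yW) - (1 - xW)). Multiplication by both geometric series then separates the poles.
    kernel-partialFractions : kernel ≋ λ n → δ n + α * (x ^ n - y ^ n)
    kernel-partialFractions n = trans (as-series n) (+-congˡ (const-⊛ α _ n))
      where
      κ-+ : ∀ a b → const (a + b) ≋ const a S.+ const b
      κ-+ a b n = distribʳ _ _ _
      κ-* : ∀ a b → const (a * b) ≋ const a ⊛ const b
      κ-* a b n = trans (*-assoc _ _ _) (sym (const-⊛ a (const b) n))
      κ-1 : const 1# ≋ δ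
      κ-1 n = *-identityˡ _
      κ-neg : ∀ a → const (- a) ≋ S.- const a
      κ-neg a n = solve 2 (λ a b → (:- a) :* b := :- (a :* b)) refl _ _
      κ-α : const α ⊛ (const x S.- const y) ≋ (const x S.- δ) ⊛ (δ S.- const y)
      κ-α = S.trans (S.*-congˡ {const α} (S.trans (S.+-congˡ {const x} (S.sym (κ-neg y))) (S.sym (κ-+ x (- y)))))
        (S.trans (S.sym (κ-* α (x - y))) (S.trans (λ n → *-congʳ α-eq) (S.trans (κ-* (x - 1#) (1# - y))
          (S.*-cong (S.trans (κ-+ x (- 1#)) (S.+-congˡ {const x} (S.trans (κ-neg 1#) (S.-‿cong κ-1))))
                    (S.trans (κ-+ 1# (- y)) (S.+-cong κ-1 (κ-neg y)))))))
      numerator : linear 1# ⊛ linear (x * y) ≋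
        (linear x ⊛ linear y) S.+ const α ⊛ (linear y S.- linear x)
      numerator = S.trans (⊛-cong (S.+-congˡ {δ} (S.-‿cong (S.*-congʳ {W} κ-1))) (S.+-congˡ {δ} (S.-‿cong (S.*-congʳ {W} (κ-* x y)))))
        (S.trans (solveˢ 3 (λ X Y w → (conˢ (+ 1) ⊖ conˢ (+ 1) ⊗ w) ⊗ (conˢ (+ 1) ⊖ X ⊗ Y ⊗ w)
             ≐ (conˢ (+ 1) ⊖ X ⊗ w) ⊗ (conˢ (+ 1) ⊖ Y ⊗ w)
                   ⊕ (X ⊖ conˢ (+ 1)) ⊗ (conˢ (+ 1) ⊖ Y) ⊗ w) S.refl (const x) (const y) W)
        (S.trans (S.+-congˡ {linear x ⊛ linear y} (S.*-congʳ {W} (S.sym κ-α)))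
          (solveˢ 4 (λ X Y w A → (conˢ (+ 1) ⊖ X ⊗ w) ⊗ (conˢ (+ 1) ⊖ Y ⊗ w)
                   ⊕ A ⊗ (X ⊖ Y) ⊗ w ≐
                   (conˢ (+ 1) ⊖ X ⊗ w) ⊗ (conˢ (+ 1) ⊖ Y ⊗ w)
                   ⊕ A ⊗ ((conˢ (+ 1) ⊖ Y ⊗ w) ⊖ (conˢ (+ 1) ⊖ X ⊗ w))) S.refl (const x) (const y) W (const α))))
      as-series : kernel ≋ δ S.+ const α ⊛ (geo x S.- geo y)
      as-series = S.trans (S.*-congʳ {geo x ⊛ geo y} numerator)
        (S.trans (solveˢ 5 (λ L M A G H → (L ⊗ M ⊕ A ⊗ (M ⊖ L)) ⊗ (G ⊗ H) ≐
             (L ⊗ G) ⊗ (M ⊗ H) ⊕ A ⊗ ((M ⊗ H) ⊗ G ⊖ (L ⊗ G) ⊗ H)) S.refl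
             (linear x) (linear y) (const α) (geo x) (geo y))
        (S.trans (S.+-cong (S.*-cong (linear-⊛-geo x) (linear-⊛-geo y)) (S.*-congˡ {const α} (S.+-cong
             (S.*-congʳ {geo x} (linear-⊛-geo y)) (S.-‿cong (S.*-congʳ {geo y} (linear-⊛-geo x))))))
        (solveˢ 3 (λ A G H → conˢ (+ 1) ⊗ conˢ (+ 1) ⊕ A ⊗ (conˢ (+ 1) ⊗ G ⊖ conˢ (+ 1) ⊗ H)
             ≐ conˢ (+ 1) ⊕ A ⊗ (G ⊖ H)) S.refl (const α) (geo x) (geo y))))

  infixl 7 _⊛₂_
  -- Σ_k f_k G_{k,n-k}
  _⊛₂_ : Series → (ℕ → Series) → Series
  (f ⊛₂ G) zero    = f 0 * G 0 0
  (f ⊛₂ G) (suc n) = f 0 * G 0 (suc n) + (f ∘ suc ⊛₂ G ∘ suc) n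

  ⊛₂-cong-≤ : ∀ {f f′ G G′} n → (∀ i → f i ≈ f′ i) → (∀ k i → i ≤ n → G k i ≈ G′ k i) → (f ⊛₂ G) n ≈ (f′ ⊛₂ G′) n
  ⊛₂-cong-≤ zero p r = *-cong (p 0) (r 0 0 z≤n)
  ⊛₂-cong-≤ (suc n) p r = +-cong (*-cong (p 0) (r 0 (suc n) ℕₚ.≤-refl))
    (⊛₂-cong-≤ n (p ∘ suc) (λ k i i≤n → r (suc k) i (ℕₚ.m≤n⇒m≤1+n i≤n)))

  ⊛₂-⊛ : ∀ f G h n → ((f ⊛₂ G) ⊛ h) n ≈ (f ⊛₂ (λ k → G k ⊛ h)) n
  ⊛₂-⊛ f G h zero = *-assoc _ _ _
  ⊛₂-⊛ f G h (suc n) = begin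
    f 0 * G 0 0 * h (suc n) + ((λ i → f 0 * G 0 (suc i) + (f ∘ suc ⊛₂ G ∘ suc) i) ⊛ h) n
      ≈⟨ +-congˡ (⊛-distribʳ h (λ i → f 0 * G 0 (suc i)) (f ∘ suc ⊛₂ G ∘ suc) n) ⟩
    f 0 * G 0 0 * h (suc n) + (((λ i → f 0 * G 0 (suc i)) ⊛ h) n + ((f ∘ suc ⊛₂ G ∘ suc) ⊛ h) n)
      ≈⟨ +-congˡ (+-cong (⊛-scaleˡ (f 0) (G 0 ∘ suc) h n) (⊛₂-⊛ (f ∘ suc) (G ∘ suc) h n)) ⟩
    f 0 * G 0 0 * h (suc n) + (f 0 * (G 0 ∘ suc ⊛ h) n + (f ∘ suc ⊛₂ (λ k → G (suc k) ⊛ h)) n)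
      ≈⟨ solve 5 (λ a b c d e → a :* b :* c :+ (a :* d :+ e) := a :* (b :* c :+ d) :+ e) refl _ _ _ _ _ ⟩
    f 0 * (G 0 ⊛ h) (suc n) + (f ∘ suc ⊛₂ (λ k → G (suc k) ⊛ h)) n ∎

  -- A weight depending on the total index k + i is absorbed into the second factor, at the price of
  -- a family indexed by k.
  ⊛-weight : ∀ σ f z n → (σ ⊛ f) n * z n ≈ (σ ⊛₂ (λ k i → f i * z (k ℕ.+ i))) n
  ⊛-weight σ f z zero = *-assoc _ _ _
  ⊛-weight σ f z (suc n) = trans (distribʳ _ _ _) (+-cong (*-assoc _ _ _) (⊛-weight (σ ∘ suc) f (z ∘ suc) n))

  ⊛-scaleʳ : ∀ c f g n → (f ⊛ (λ i → c * g i)) n ≈ c * (f ⊛ g) n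
  ⊛-scaleʳ c f g n = trans (⊛-comm f _ n) (trans (⊛-scaleˡ c g f n) (*-congˡ (⊛-comm g f n)))

  sumTo : ℕ → (ℕ → Carrier) → Carrier
  sumTo zero    f = 0#
  sumTo (suc N) f = f 0 + sumTo N (f ∘ suc)

  sumTo-cong : ∀ N {f g} → (∀ j → f j ≈ g j) → sumTo N f ≈ sumTo N g
  sumTo-cong zero    h = refl
  sumTo-cong (suc N) h = +-cong (h 0) (sumTo-cong N (h ∘ suc))

  sumTo-last : ∀ N f → sumTo (suc N) f ≈ sumTo N f + f N
  sumTo-last zero    f = +-comm _ _
  sumTo-last (suc N) f = trans (+-congˡ (sumTo-last N (f ∘ suc))) (sym (+-assoc _ _ _))

  sumTo-scale : ∀ N c f → c * sumTo N f ≈ sumTo N (λ j → c * f j)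
  sumTo-scale zero    c f = zeroʳ c
  sumTo-scale (suc N) c f = trans (distribˡ _ _ _) (+-congˡ (sumTo-scale N c (f ∘ suc)))

  ⊛-sumTo : ∀ N g (F : ℕ → Series) n → (g ⊛ (λ i → sumTo N (λ j → F j i))) n ≈ sumTo N (λ j → (g ⊛ F j) n)
  ⊛-sumTo zero    g F n = trans (⊛-comm g _ n) (⊛-zeroˡ g n)
  ⊛-sumTo (suc N) g F n = trans (S.distribˡ g (F 0) (λ i → sumTo N (λ j → F (suc j) i)) n) (+-congˡ (⊛-sumTo N g (F ∘ suc) n))

  -- exp(s) = Σ s^j / j! makes sense because s has no constant term: s^j begins in degree j, so
  -- every coefficient is a finite sum. The reciprocals of j! enter only through their recurrence.
  module Exponential (s : Series) (s₀ : s 0 ≈ 0#) (inverseFactorial : ℕ → Carrier)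
    (inverseFactorial-suc : ∀ j → suc j · 1# * inverseFactorial (suc j) ≈ inverseFactorial j) where
    open Exp S.semiring using () renaming (_^_ to _^ˢ_)

    truncation : ℕ → Series
    truncation N n = sumTo N (λ j → inverseFactorial j * (s ^ˢ j) n)

    power-vanishes : ∀ j n → suc n ≤ j → (s ^ˢ j) n ≈ 0#
    power-vanishes (suc j) zero _ = trans (*-congʳ s₀) (zeroˡ _)
    power-vanishes (suc j) (suc n) (s≤s n<j) = trans (+-cong (trans (*-congʳ s₀) (zeroˡ _))
      (trans (⊛-cong-≤ n (λ _ _ → refl) (λ i i≤n → power-vanishes j i (ℕₚ.≤-trans (s≤s i≤n) n<j)))
             (trans (⊛-comm _ (λ _ → 0#) n) (⊛-zeroˡ _ n)))) (+-identityˡ 0#)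

    θ-power : ∀ j → θ (s ^ˢ suc j) ≋ λ n → suc j · 1# * (θ s ⊛ s ^ˢ j) n
    θ-power zero n = begin
      θ (s ⊛ δ) n ≈⟨ *-congˡ (S.*-identityʳ s n) ⟩
      θ s n ≈⟨ sym (trans (*-identityˡ _) (S.*-identityʳ (θ s) n)) ⟩
      1 · 1# * (θ s ⊛ δ) n ∎
    θ-power (suc j) n = begin
      θ (s ⊛ s ^ˢ suc j) n
        ≈⟨ θ-⊛ s (s ^ˢ suc j) n ⟩
      (θ s ⊛ s ^ˢ suc j) n + (s ⊛ θ (s ^ˢ suc j)) n
        ≈⟨ +-congˡ (trans (⊛-cong (λ _ → refl) (θ-power j) n) (⊛-scaleʳ (suc j · 1#) s (θ s ⊛ s ^ˢ j) n)) ⟩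
      (θ s ⊛ s ^ˢ suc j) n + suc j · 1# * (s ⊛ (θ s ⊛ s ^ˢ j)) n
        ≈⟨ +-congˡ (*-congˡ (solveˢ 3 (λ a b c → a ⊗ (b ⊗ c) ≐ b ⊗ (a ⊗ c)) S.refl s (θ s) (s ^ˢ j) n)) ⟩
      (θ s ⊛ s ^ˢ suc j) n + suc j · 1# * (θ s ⊛ s ^ˢ suc j) n
        ≈⟨ sym (trans (*-congʳ (1+· (suc j) 1#)) (trans (distribʳ _ _ _) (+-congʳ (*-identityˡ _)))) ⟩
      suc (suc j) · 1# * (θ s ⊛ s ^ˢ suc j) n ∎

    exp : Series
    exp n = truncation (suc n) n

    exp-sum : ∀ n (F : ℕ → Carrier) → (∀ j → F j ≈ inverseFactorial j * (s ^ˢ j) n) → sumTo (suc n) F ≈ exp n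
    exp-sum n F h = sumTo-cong (suc n) h

    exp-0 : exp 0 ≈ inverseFactorial 0
    exp-0 = trans (+-identityʳ _) (*-identityʳ _)

    truncation-stable : ∀ d n → truncation (d ℕ.+ suc n) n ≈ exp n
    truncation-stable zero    n = refl
    truncation-stable (suc d) n = trans (sumTo-last (d ℕ.+ suc n) (λ j → inverseFactorial j * (s ^ˢ j) n))
      (trans (+-cong (truncation-stable d n) (trans (*-congˡ (power-vanishes _ n (ℕₚ.m≤n+m (suc n) d))) (zeroʳ _))) (+-identityʳ _))

    truncation-≤ : ∀ N n → n ≤ N → truncation (suc N) n ≈ exp n
    truncation-≤ N n n≤N = trans (reflexive (cong (λ M → truncation M n) (≡.sym (ℕₚ.m∸n+n≡m (s≤s n≤N))))) (truncation-stable (N ℕ.∸ n) n)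

    LogDer-exp : LogDer exp (θ s)
    LogDer-exp n = begin
      n · 1# * exp n
        -- One summand more than necessary: the term j = 0 is killed by θ, and the remaining ones,
        -- shifted down, form the truncation to n + 1 terms.
        ≈⟨ *-congˡ (sym (truncation-≤ (suc n) n (ℕₚ.n≤1+n n))) ⟩
      n · 1# * truncation (suc (suc n)) n
        ≈⟨ sumTo-scale (suc (suc n)) (n · 1#) (λ j → inverseFactorial j * (s ^ˢ j) n) ⟩
      n · 1# * (inverseFactorial 0 * δ n) + sumTo (suc n) (λ j → n · 1# * (inverseFactorial (suc j) * (s ^ˢ suc j) n))
        ≈⟨ +-cong (constant-term n) (sumTo-cong (suc n) λ j → trans (solve 3 (λ a b c → a :* (b :* c) := b :* (a :* c)) refl _ _ _)
             (trans (*-congˡ (θ-power j n)) (trans (solve 3 (λ a b c → a :* (b :* c) := (b :* a) :* c) refl _ _ _) (*-congʳ (inverseFactorial-suc j))))) ⟩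
      0# + sumTo (suc n) (λ j → inverseFactorial j * (θ s ⊛ s ^ˢ j) n)
        ≈⟨ trans (+-identityˡ _) (sumTo-cong (suc n) λ j → sym (⊛-scaleʳ (inverseFactorial j) (θ s) (s ^ˢ j) n)) ⟩
      sumTo (suc n) (λ j → (θ s ⊛ (λ i → inverseFactorial j * (s ^ˢ j) i)) n)
        ≈⟨ sym (⊛-sumTo (suc n) (θ s) (λ j i → inverseFactorial j * (s ^ˢ j) i) n) ⟩
      (θ s ⊛ truncation (suc n)) n
        ≈⟨ ⊛-cong-≤ n (λ _ _ → refl) (λ i i≤n → truncation-≤ n i i≤n) ⟩
      (θ s ⊛ exp) n ∎
      where
      constant-term : ∀ n → n · 1# * (inverseFactorial 0 * δ n) ≈ 0#
      constant-term zero    = zeroˡ _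
      constant-term (suc n) = trans (*-congˡ (zeroʳ _)) (zeroʳ _)

-- Vertex operators over an abstract ring

module VertexOperators (R : CommutativeRing 0ℓ 0ℓ) (torsionFree : PowerSeries.TorsionFree R)
                       -- `Scalar` singles out the elements over which the operators are linear; the
                       -- ring itself will be Λ, over which they are not.
                       (p : ℕ → CommutativeRing.Carrier R) (Scalar : CommutativeRing.Carrier R → Set) where
  open CommutativeRing R
  open Solver R
  open PowerSeries R
  open Powers R
  open SetoidReasoning setoid

  -- The logarithmic derivative of Ω[-z[u]_t X] when b k = p_{k+1}[[u]_t].
  newton : (ℕ → Carrier) → Series
  newton b zero    = 0#
  newton b (suc k) = - (b k * p (suc k))

  -- Axiomatises F ↦ D_{u,v} F: ω v = D_{u,v} 1, a k = p_{k+1}[M[u]_q], b k = p_{k+1}[[u]_t].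
  record VertexOperator : Set where
    field
      op        : ℕ → Carrier → Carrier
      a b       : ℕ → Carrier
      ω         : Series
      op-cong   : ∀ v {F G} → F ≈ G → op v F ≈ op v G
      op-+      : ∀ v F G → op v (F + G) ≈ op v F + op v G
      op-scalar : ∀ v {c} → Scalar c → ∀ F → op v (c * F) ≈ c * op v F
      op-p      : ∀ v k F → op v (p (suc k) * F) ≈ p (suc k) * op v F + a k * op (v ℕ.+ suc k) F
      op-1      : ∀ v → op v 1# ≈ ω v
      a-scalar  : ∀ k → Scalar (a k)
      b-scalar  : ∀ k → Scalar (b k)
      ω-LogDer  : LogDer ω (newton b)
      ω-0       : ω 0 ≈ 1#

    op-0 : ∀ v → op v 0# ≈ 0#
    op-0 v = begin
      op v 0# ≈⟨ solve 1 (λ X → X := (X :+ X) :- X) refl _ ⟩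
      op v 0# + op v 0# - op v 0# ≈⟨ +-congʳ (trans (sym (op-+ v 0# 0#)) (op-cong v (+-identityʳ 0#))) ⟩
      op v 0# - op v 0# ≈⟨ -‿inverseʳ _ ⟩
      0# ∎

    op-neg : ∀ v F → op v (- F) ≈ - op v F
    op-neg v F = begin
      op v (- F) ≈⟨ solve 2 (λ X Y → X := (X :+ Y) :- Y) refl _ _ ⟩
      op v (- F) + op v F - op v F ≈⟨ +-congʳ (trans (sym (op-+ v (- F) F)) (trans (op-cong v (-‿inverseˡ F)) (op-0 v))) ⟩
      0# - op v F ≈⟨ +-identityˡ _ ⟩
      - op v F ∎

    op-· : ∀ v n F → op v (n · 1# * F) ≈ n · 1# * op v F
    op-· v zero F = trans (op-cong v (zeroˡ F)) (trans (op-0 v) (sym (zeroˡ _)))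
    op-· v (suc n) F = begin
      op v (suc n · 1# * F) ≈⟨ op-cong v (trans (*-congʳ (1+· n 1#)) (trans (distribʳ _ _ _) (+-congʳ (*-identityˡ F)))) ⟩
      op v (F + n · 1# * F) ≈⟨ trans (op-+ v _ _) (+-congˡ (op-· v n F)) ⟩
      op v F + n · 1# * op v F ≈⟨ sym (trans (*-congʳ (1+· n 1#)) (trans (distribʳ _ _ _) (+-congʳ (*-identityˡ _)))) ⟩
      suc n · 1# * op v F ∎

    op-newton : ∀ v {c} → Scalar c → ∀ k F →
      op v (- (c * p (suc k)) * F) ≈ - (c * p (suc k)) * op v F + - (c * a k) * op (v ℕ.+ suc k) F
    op-newton v {c} sc k F = begin
      op v (- (c * p (suc k)) * F)
        ≈⟨ op-cong v (solve 3 (λ c p F → :- (c :* p) :* F := :- (c :* (p :* F))) refl _ _ _) ⟩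
      op v (- (c * (p (suc k) * F)))
        ≈⟨ trans (op-neg v _) (-‿cong (trans (op-scalar v sc _) (*-congˡ (op-p v k F)))) ⟩
      - (c * (p (suc k) * op v F + a k * op (v ℕ.+ suc k) F))
        ≈⟨ solve 5 (λ c p F a G → :- (c :* (p :* F :+ a :* G)) := :- (c :* p) :* F :+ :- (c :* a) :* G) refl _ _ _ _ _ ⟩
      - (c * p (suc k)) * op v F + - (c * a k) * op (v ℕ.+ suc k) F ∎

    -- Carrying the operator past each power sum p_{k+1} of the Newton sum costs a contraction term,
    -- in which the index v rises by k + 1.
    op-newton-⊛ : ∀ v (c : ℕ → Carrier) → (∀ k → Scalar (c k)) → ∀ g n →
      op v ((newton c ⊛ g) (suc n)) ≈
        (newton c ⊛ (op v ∘ g)) (suc n) + ((λ k → - (c k * a k)) ⊛₂ (λ k i → op (v ℕ.+ suc k) (g i))) n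
    op-newton-⊛ v c sc g n = begin
      op v (0# * g (suc n) + (newton c ∘ suc ⊛ g) n)
        ≈⟨ op-cong v (trans (+-congʳ (zeroˡ _)) (+-identityˡ _)) ⟩
      op v ((newton c ∘ suc ⊛ g) n)
        ≈⟨ go (λ k → k) n ⟩
      (newton c ∘ suc ⊛ (op v ∘ g)) n + rest
        ≈⟨ +-congʳ (sym (trans (+-congʳ (zeroˡ _)) (+-identityˡ _))) ⟩
      (newton c ⊛ (op v ∘ g)) (suc n) + rest ∎
      where
      rest = ((λ k → - (c k * a k)) ⊛₂ (λ k i → op (v ℕ.+ suc k) (g i))) n
      -- The reindexing `h` records how far the convolution has been unfolded.
      go : ∀ (h : ℕ → ℕ) n → op v (((λ k → newton c (suc (h k))) ⊛ g) n) ≈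
        ((λ k → newton c (suc (h k))) ⊛ (op v ∘ g)) n
          + ((λ k → - (c (h k) * a (h k))) ⊛₂ (λ k i → op (v ℕ.+ suc (h k)) (g i))) n
      go h zero = op-newton v (sc _) _ _
      go h (suc n) = trans (op-+ v _ _) (trans (+-cong (op-newton v (sc _) _ _) (go (h ∘ suc) n))
        (+-interchange _ _ _ _))

  -- By `contraction`, the `a` of A times the `b` of A′ is (1 - x^n)(1 - y^n) with n = k + 1, which
  -- is minus the n-th coefficient of the logarithmic derivative of the kernel.
  module Product (A A′ : VertexOperator) (x y α : Carrier) (α-eq : α * (x - y) ≈ (x - 1#) * (1# - y))
    (contraction : ∀ k → VertexOperator.b A′ k * VertexOperator.a A k ≈ (1# - x ^ suc k) * (1# - y ^ suc k)) where
    private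
      module A  = VertexOperator A
      module A′ = VertexOperator A′
    open Kernel x y α α-eq

    -- The coefficient of z^v w^r in kernel(w/z) ω(z) ω′(w).
    product : ℕ → Series
    product v = (λ j → kernel j * A.ω (v ℕ.+ j)) ⊛ A′.ω

    private
      σ : Series
      σ zero    = 0#
      σ (suc k) = - (A′.b k * A.a k)

      σ-kernel : kernel-logDer ≋ σ
      σ-kernel zero = solve 0 ((:- con (+ 0) :+ :- con (+ 0)) :+ (con (+ 0) :+ con (+ 0)) := con (+ 0)) refl
      σ-kernel (suc k) = begin
        - 1# ^ suc k + - (x * y) ^ suc k + (x ^ suc k + y ^ suc k)
          ≈⟨ +-congʳ (+-cong (-‿cong (1^ (suc k))) (-‿cong (^-distrib-* x y (suc k)))) ⟩
        - 1# + - (x ^ suc k * y ^ suc k) + (x ^ suc k + y ^ suc k)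
          ≈⟨ solve 2 (λ x y → :- con (+ 1) :+ :- (x :* y) :+ (x :+ y) := :- ((con (+ 1) :- x) :* (con (+ 1) :- y))) refl _ _ ⟩
        - ((1# - x ^ suc k) * (1# - y ^ suc k))
          ≈⟨ -‿cong (sym (contraction k)) ⟩
        σ (suc k) ∎

      LogDer-σ : LogDer kernel σ
      LogDer-σ = LogDer-cong (λ _ → refl) σ-kernel LogDer-kernel

      kernel-0 : kernel 0 ≈ 1#
      kernel-0 = trans (kernel-partialFractions 0) (solve 1 (λ a → con (+ 1) :+ a :* (con (+ 1) :- con (+ 1)) := con (+ 1)) refl α)

      module S = CommutativeRing seriesRing
      module SS = Solver seriesRing

      θ-weighted : ∀ v → θ (λ j → kernel j * A.ω (v ℕ.+ j)) ≋ (σ ⊛₂ (λ k j → kernel j * A.ω (v ℕ.+ k ℕ.+ j)))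
      θ-weighted v n = begin
        n · 1# * (kernel n * A.ω (v ℕ.+ n)) ≈⟨ sym (*-assoc _ _ _) ⟩
        θ kernel n * A.ω (v ℕ.+ n) ≈⟨ *-congʳ (LogDer-σ n) ⟩
        (σ ⊛ kernel) n * A.ω (v ℕ.+ n) ≈⟨ ⊛-weight σ kernel (λ j → A.ω (v ℕ.+ j)) n ⟩
        (σ ⊛₂ (λ k j → kernel j * A.ω (v ℕ.+ (k ℕ.+ j)))) n
          ≈⟨ ⊛₂-cong-≤ n (λ _ → refl) (λ k i _ → *-congˡ (reflexive (cong A.ω (≡.sym (ℕₚ.+-assoc v k i))))) ⟩
        (σ ⊛₂ (λ k j → kernel j * A.ω (v ℕ.+ k ℕ.+ j))) n ∎

      -- The recurrence in r that `op-newton-⊛` yields for A_v ω′_r: the derivative hits ω′, giving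
      -- the Newton terms, or the kernel, giving the contraction terms with v raised.
      θ-product : ∀ v n → n · 1# * product v n ≈ (newton A′.b ⊛ product v) n + (σ ⊛₂ (λ k → product (v ℕ.+ k))) n
      θ-product v n = trans (θ-⊛ _ A′.ω n) (trans (+-comm _ _) (+-cong
        (trans (S.*-congˡ {x = λ j → kernel j * A.ω (v ℕ.+ j)} A′.ω-LogDer n)
               (SS.solve 3 (λ f s g → f SS.:* (s SS.:* g) SS.:= s SS.:* (f SS.:* g)) S.refl (λ j → kernel j * A.ω (v ℕ.+ j)) (newton A′.b) A′.ω n))
        (trans (⊛-cong (θ-weighted v) (λ _ → refl) n) (⊛₂-⊛ σ _ A′.ω n))))

    -- Both sides obey one recurrence in r. The contraction terms change v, so the induction runs
    -- over all v at once.
    op-ω : ∀ v r → A.op v (A′.ω r) ≈ product v r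
    op-ω v r = below r v r ℕₚ.≤-refl
      where
      below : ∀ r v i → i ≤ r → A.op v (A′.ω i) ≈ product v i
      below r v zero _ = begin
        A.op v (A′.ω 0) ≈⟨ trans (A.op-cong v A′.ω-0) (A.op-1 v) ⟩
        A.ω v ≈⟨ sym (trans (*-congˡ A′.ω-0) (trans (*-identityʳ _) (trans (*-congʳ kernel-0) (*-identityˡ _)))) ⟩
        kernel 0 * A.ω v * A′.ω 0 ≈⟨ *-congʳ (*-congˡ (reflexive (cong A.ω (≡.sym (ℕₚ.+-identityʳ v))))) ⟩
        kernel 0 * A.ω (v ℕ.+ 0) * A′.ω 0 ∎
      below (suc r) v (suc i) (s≤s i≤r) = torsionFree i (begin
        suc i · 1# * A.op v (A′.ω (suc i)) ≈⟨ sym (A.op-· v (suc i) _) ⟩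
        A.op v (suc i · 1# * A′.ω (suc i)) ≈⟨ A.op-cong v (A′.ω-LogDer (suc i)) ⟩
        A.op v ((newton A′.b ⊛ A′.ω) (suc i)) ≈⟨ A.op-newton-⊛ v A′.b A′.b-scalar A′.ω i ⟩
        (newton A′.b ⊛ (A.op v ∘ A′.ω)) (suc i) + ((σ ∘ suc) ⊛₂ (λ k j → A.op (v ℕ.+ suc k) (A′.ω j))) i
          ≈⟨ +-cong (+-cong (trans (zeroˡ _) (sym (zeroˡ _))) (⊛-cong-≤ i (λ _ _ → refl) (λ j j≤i → below r v j (ℕₚ.≤-trans j≤i i≤r))))
                    (⊛₂-cong-≤ i (λ _ → refl) (λ k j j≤i → below r (v ℕ.+ suc k) j (ℕₚ.≤-trans j≤i i≤r))) ⟩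
        (newton A′.b ⊛ product v) (suc i) + ((σ ∘ suc) ⊛₂ (λ k → product (v ℕ.+ suc k))) i
          ≈⟨ +-congˡ (sym (trans (+-congʳ (zeroˡ _)) (+-identityˡ _))) ⟩
        (newton A′.b ⊛ product v) (suc i) + (σ ⊛₂ (λ k → product (v ℕ.+ k))) (suc i)
          ≈⟨ sym (θ-product v (suc i)) ⟩
        suc i · 1# * product v (suc i) ∎)

    geoProduct : Carrier → ℕ → ℕ → Carrier
    geoProduct c v r = ((λ j → c ^ j * A.ω (v ℕ.+ j)) ⊛ A′.ω) r

    -- The constant term of the partial fractions yields ω_v ω′_r, which is symmetric in the two
    -- operators and will drop out of the commutator.
    op-ω-expansion : ∀ v r → A.op v (A′.ω r) ≈ A.ω v * A′.ω r + α * (geoProduct x v r - geoProduct y v r)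
    op-ω-expansion v r = begin
      A.op v (A′.ω r) ≈⟨ op-ω v r ⟩
      product v r ≈⟨ ⊛-cong (λ j → trans (*-congʳ (kernel-partialFractions j))
                                 (trans (distribʳ _ _ _) (+-cong (at-0 j) (*-assoc _ _ _)))) (λ _ → refl) r ⟩
      ((λ j → A.ω v * δ j + α * ((x ^ j - y ^ j) * A.ω (v ℕ.+ j))) ⊛ A′.ω) r
        ≈⟨ trans (⊛-distribʳ A′.ω _ _ r) (+-cong (const-⊛ (A.ω v) A′.ω r) (⊛-scaleˡ α _ A′.ω r)) ⟩
      A.ω v * A′.ω r + α * ((λ j → (x ^ j - y ^ j) * A.ω (v ℕ.+ j)) ⊛ A′.ω) r
        ≈⟨ +-congˡ (*-congˡ (trans (⊛-cong (λ j → solve 3 (λ x y w → (x :- y) :* w := x :* w :+ (:- con (+ 1)) :* (y :* w)) refl _ _ _) (λ _ → refl) r)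
             (trans (⊛-distribʳ A′.ω _ _ r) (+-congˡ (⊛-scaleˡ (- 1#) _ A′.ω r))))) ⟩
      A.ω v * A′.ω r + α * (geoProduct x v r + (- 1#) * geoProduct y v r)
        ≈⟨ solve 4 (λ w a g h → w :+ a :* (g :+ (:- con (+ 1)) :* h) := w :+ a :* (g :- h)) refl _ _ _ _ ⟩
      A.ω v * A′.ω r + α * (geoProduct x v r - geoProduct y v r) ∎
      where
      at-0 : ∀ j → δ j * A.ω (v ℕ.+ j) ≈ A.ω v * δ j
      at-0 zero = trans (*-comm _ _) (*-congʳ (reflexive (cong A.ω (ℕₚ.+-identityʳ v))))
      at-0 (suc j) = trans (zeroˡ _) (sym (zeroʳ _))

  -- For D_u, D_u′ and D_{u+u′} take x = q^u, y = q^{-u′} and α = (1 - q^{-u})(1 - q^{-u′}) / (1 - q^{-u-u′}).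
  record Compatible (A A′ A″ : VertexOperator) : Set where
    private
      module A  = VertexOperator A
      module A′ = VertexOperator A′
      module A″ = VertexOperator A″
    field
      x x⁻¹ y y⁻¹ α : Carrier
      x-inverse     : x⁻¹ * x ≈ 1#
      y-inverse     : y⁻¹ * y ≈ 1#
      α-eq          : α * (x - y) ≈ (x - 1#) * (1# - y)
      contraction   : ∀ k → A′.b k * A.a k ≈ (1# - x ^ suc k) * (1# - y ^ suc k)
      contraction′  : ∀ k → A.b k * A′.a k ≈ (1# - y⁻¹ ^ suc k) * (1# - x⁻¹ ^ suc k)
      a-sum         : ∀ k → A.a k + A′.a k * x ^ suc k ≈ A″.a k
      a-sum′        : ∀ k → A.a k * y⁻¹ ^ suc k + A′.a k ≈ A″.a k
      b-sum         : ∀ k → y ^ suc k * A.b k + A′.b k ≈ A″.b k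
      b-sum′        : ∀ k → x ^ suc k * A.b k + A′.b k ≈ x ^ suc k * A″.b k

  module Commutator (A A′ A″ : VertexOperator) (compatible : Compatible A A′ A″) where
    open Compatible compatible
    private
      module A  = VertexOperator A
      module A′ = VertexOperator A′
      module A″ = VertexOperator A″

    coefficient : ℕ → ℕ → Carrier
    coefficient v w = α * (x ^ w - y⁻¹ ^ v)

    private
      -- `α-eq` multiplied by x⁻¹y⁻¹: the product in the opposite order has parameters y⁻¹ and x⁻¹
      -- but the same α.
      α-eq′ : α * (y⁻¹ - x⁻¹) ≈ (y⁻¹ - 1#) * (1# - x⁻¹)
      α-eq′ = begin
        α * (y⁻¹ - x⁻¹)
          ≈⟨ *-congˡ (+-cong (trans (sym (*-identityʳ _)) (*-congˡ (sym x-inverse)))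
                             (-‿cong (trans (sym (*-identityʳ _)) (*-congˡ (sym y-inverse))))) ⟩
        α * (y⁻¹ * (x⁻¹ * x) - x⁻¹ * (y⁻¹ * y))
          ≈⟨ solve 5 (λ a x y X Y → a :* (Y :* (X :* x) :- X :* (Y :* y)) := X :* Y :* (a :* (x :- y))) refl _ _ _ _ _ ⟩
        x⁻¹ * y⁻¹ * (α * (x - y))
          ≈⟨ *-congˡ α-eq ⟩
        x⁻¹ * y⁻¹ * ((x - 1#) * (1# - y))
          ≈⟨ solve 4 (λ x y X Y → X :* Y :* ((x :- con (+ 1)) :* (con (+ 1) :- y)) := (Y :- Y :* y) :* (X :* x :- X)) refl _ _ _ _ ⟩
        (y⁻¹ - y⁻¹ * y) * (x⁻¹ * x - x⁻¹)
          ≈⟨ *-cong (+-congˡ (-‿cong y-inverse)) (+-congʳ x-inverse) ⟩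
        (y⁻¹ - 1#) * (1# - x⁻¹) ∎

      module P  = Product A A′ x y α α-eq contraction
      module P′ = Product A′ A y⁻¹ x⁻¹ α α-eq′ contraction′

      newton-additive : ∀ {b₁ b₂ b₃ : ℕ → Carrier} c d → (∀ k → c ^ suc k * b₁ k + b₂ k ≈ d ^ suc k * b₃ k) →
        (λ n → c ^ n * newton b₁ n + newton b₂ n) ≋ (λ n → d ^ n * newton b₃ n)
      newton-additive c d h zero = solve 0 (con (+ 1) :* con (+ 0) :+ con (+ 0) := con (+ 1) :* con (+ 0)) refl
      newton-additive {b₁} {b₂} {b₃} c d h (suc k) = begin
        c ^ suc k * - (b₁ k * p (suc k)) + - (b₂ k * p (suc k))
          ≈⟨ solve 4 (λ c b b′ p → c :* :- (b :* p) :+ :- (b′ :* p) := :- ((c :* b :+ b′) :* p)) refl _ _ _ _ ⟩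
        - ((c ^ suc k * b₁ k + b₂ k) * p (suc k))
          ≈⟨ -‿cong (*-congʳ (h k)) ⟩
        - (d ^ suc k * b₃ k * p (suc k))
          ≈⟨ solve 3 (λ d b p → :- (d :* b :* p) := d :* :- (b :* p)) refl _ _ _ ⟩
        d ^ suc k * - (b₃ k * p (suc k)) ∎

      -- Both sides have the same logarithmic derivative and constant term 1. It is applied at the
      -- two poles, with (c, d) = (x, x) and (y, 1).
      ω-product : ∀ c d → (∀ k → c ^ suc k * A.b k + A′.b k ≈ d ^ suc k * A″.b k) →
        ((λ i → c ^ i * A.ω i) ⊛ A′.ω) ≋ (λ n → d ^ n * A″.ω n)
      ω-product c d h = LogDer-unique torsionFree (zeroʳ _)
        (LogDer-cong {(λ i → c ^ i * A.ω i) ⊛ A′.ω} {s = λ n → c ^ n * newton A.b n + newton A′.b n} (λ _ → refl) (newton-additive c d h)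
           (LogDer-⊛ (LogDer-dilate c A.ω-LogDer) A′.ω-LogDer))
        (LogDer-dilate d A″.ω-LogDer)
        (trans (*-cong (*-congˡ A.ω-0) A′.ω-0) (trans (*-identityʳ _) (*-congˡ (sym A″.ω-0))))

      -- The geometric sums at one pole, coming from the two orders of the product, run in opposite
      -- directions from the term ω_v ω′_w. Together they are a full convolution with that term
      -- counted twice.
      split : ∀ c c⁻¹ → c⁻¹ * c ≈ 1# → ∀ v w →
        c⁻¹ ^ v * ((λ i → c ^ i * A.ω i) ⊛ A′.ω) (v ℕ.+ w) + A.ω v * A′.ω w ≈ P.geoProduct c v w + P′.geoProduct c⁻¹ w v
      split c c⁻¹ h v w = begin
        c⁻¹ ^ v * (g ⊛ A′.ω) (v ℕ.+ w) + A.ω v * A′.ω w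
          ≈⟨ +-congˡ (trans (sym (*-identityˡ _)) (*-congʳ (sym (^-inverse h v)))) ⟩
        c⁻¹ ^ v * (g ⊛ A′.ω) (v ℕ.+ w) + c⁻¹ ^ v * c ^ v * (A.ω v * A′.ω w)
          ≈⟨ solve 5 (λ i F c a b → i :* F :+ i :* c :* (a :* b) := i :* (F :+ (c :* a) :* b)) refl _ _ _ _ _ ⟩
        c⁻¹ ^ v * ((g ⊛ A′.ω) (v ℕ.+ w) + g v * A′.ω w)
          ≈⟨ *-congˡ (⊛-split g A′.ω v w) ⟩
        c⁻¹ ^ v * (((λ j → g (v ℕ.+ j)) ⊛ A′.ω) w + ((λ j → A′.ω (w ℕ.+ j)) ⊛ g) v)
          ≈⟨ distribˡ _ _ _ ⟩
        c⁻¹ ^ v * ((λ j → g (v ℕ.+ j)) ⊛ A′.ω) w + c⁻¹ ^ v * ((λ j → A′.ω (w ℕ.+ j)) ⊛ g) v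
          ≈⟨ +-cong (sym (⊛-scaleˡ (c⁻¹ ^ v) (λ j → g (v ℕ.+ j)) A′.ω w)) (sym (⊛-dilate c⁻¹ (λ j → A′.ω (w ℕ.+ j)) g v)) ⟩
        ((λ j → c⁻¹ ^ v * g (v ℕ.+ j)) ⊛ A′.ω) w + ((λ j → c⁻¹ ^ j * A′.ω (w ℕ.+ j)) ⊛ (λ j → c⁻¹ ^ j * g j)) v
          ≈⟨ +-cong (⊛-cong shift (λ _ → refl) w) (⊛-cong (λ _ → refl) undo v) ⟩
        P.geoProduct c v w + P′.geoProduct c⁻¹ w v ∎
        where
        g : Series
        g i = c ^ i * A.ω i
        undo : ∀ j → c⁻¹ ^ j * g j ≈ A.ω j
        undo j = trans (sym (*-assoc _ _ _)) (trans (*-congʳ (^-inverse h j)) (*-identityˡ _))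
        shift : ∀ j → c⁻¹ ^ v * g (v ℕ.+ j) ≈ c ^ j * A.ω (v ℕ.+ j)
        shift j = begin
          c⁻¹ ^ v * (c ^ (v ℕ.+ j) * A.ω (v ℕ.+ j)) ≈⟨ *-congˡ (*-congʳ (^-homo-* c v j)) ⟩
          c⁻¹ ^ v * (c ^ v * c ^ j * A.ω (v ℕ.+ j)) ≈⟨ solve 4 (λ a b c d → a :* (b :* c :* d) := a :* b :* (c :* d)) refl _ _ _ _ ⟩
          c⁻¹ ^ v * c ^ v * (c ^ j * A.ω (v ℕ.+ j)) ≈⟨ trans (*-congʳ (^-inverse h v)) (*-identityˡ _) ⟩
          c ^ j * A.ω (v ℕ.+ j) ∎

    -- The commutator formula on one vector F, seen only through g v = A_v F, g′ w = A′_w F and g″ =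
    -- A″ F, so that F can be enlarged by power sums without being mentioned.
    Commutes : (g g′ g″ : ℕ → Carrier) → Set
    Commutes g g′ g″ = ∀ v w → A.op v (g′ w) - A′.op w (g v) ≈ coefficient v w * g″ (v ℕ.+ w)

    commutes-ω : Commutes A.ω A′.ω A″.ω
    commutes-ω v w = begin
      A.op v (A′.ω w) - A′.op w (A.ω v)
        ≈⟨ +-cong (P.op-ω-expansion v w) (-‿cong (P′.op-ω-expansion w v)) ⟩
      (A.ω v * A′.ω w + α * (P.geoProduct x v w - P.geoProduct y v w))
        - (A′.ω w * A.ω v + α * (P′.geoProduct y⁻¹ w v - P′.geoProduct x⁻¹ w v))
        -- The symmetric term ω_v ω′_w cancels, and the sums are regrouped by pole.
        ≈⟨ solve 7 (λ a b α X Y Y′ X′ → (a :* b :+ α :* (X :- Y)) :- (b :* a :+ α :* (Y′ :- X′))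
                     := α :* ((X :+ X′) :- (Y :+ Y′))) refl _ _ _ _ _ _ _ ⟩
      α * ((P.geoProduct x v w + P′.geoProduct x⁻¹ w v) - (P.geoProduct y v w + P′.geoProduct y⁻¹ w v))
        ≈⟨ *-congˡ (+-cong (sym (split x x⁻¹ x-inverse v w)) (-‿cong (sym (split y y⁻¹ y-inverse v w)))) ⟩
      α * ((x⁻¹ ^ v * ((λ i → x ^ i * A.ω i) ⊛ A′.ω) (v ℕ.+ w) + A.ω v * A′.ω w)
           - (y⁻¹ ^ v * ((λ i → y ^ i * A.ω i) ⊛ A′.ω) (v ℕ.+ w) + A.ω v * A′.ω w))
        ≈⟨ *-congˡ (+-cong (+-congʳ (*-congˡ (ω-product x x b-sum′ (v ℕ.+ w))))
             (-‿cong (+-congʳ (*-congˡ (trans (ω-product y 1# (λ k → trans (b-sum k) (sym (trans (*-congʳ (1^ (suc k))) (*-identityˡ _)))) (v ℕ.+ w))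
               (trans (*-congʳ (1^ (v ℕ.+ w))) (*-identityˡ _))))))) ⟩
      α * ((x⁻¹ ^ v * (x ^ (v ℕ.+ w) * A″.ω (v ℕ.+ w)) + A.ω v * A′.ω w) - (y⁻¹ ^ v * A″.ω (v ℕ.+ w) + A.ω v * A′.ω w))
        ≈⟨ *-congˡ (+-congʳ (+-congʳ (*-congˡ (*-congʳ (^-homo-* x v w))))) ⟩
      α * ((x⁻¹ ^ v * (x ^ v * x ^ w * A″.ω (v ℕ.+ w)) + A.ω v * A′.ω w) - (y⁻¹ ^ v * A″.ω (v ℕ.+ w) + A.ω v * A′.ω w))
        ≈⟨ solve 7 (λ α X x xw W c Y → α :* ((X :* (x :* xw :* W) :+ c) :- (Y :* W :+ c)) := α :* ((X :* x) :* xw :- Y) :* W) refl _ _ _ _ _ _ _ ⟩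
      α * ((x⁻¹ ^ v * x ^ v) * x ^ w - y⁻¹ ^ v) * A″.ω (v ℕ.+ w)
        ≈⟨ *-congʳ (*-congˡ (+-congʳ (trans (*-congʳ (^-inverse x-inverse v)) (*-identityˡ _)))) ⟩
      coefficient v w * A″.ω (v ℕ.+ w) ∎

    -- By `op-p`, the passage from v ↦ A_v F to v ↦ A_v (p_{k+1} F).
    raise : (ℕ → Carrier) → ℕ → (ℕ → Carrier) → ℕ → Carrier
    raise a k g v = p (suc k) * g v + a k * g (v ℕ.+ suc k)

    private
      -- Raising v or w by k + 1 multiplies one power in the coefficient by that of y⁻¹ or x; with
      -- this factor the `a` of the two operators combine to the `a` of A″ in front of either power.
      coefficient-raise : ∀ k v w → A.a k * coefficient (v ℕ.+ suc k) w + A′.a k * coefficient v (w ℕ.+ suc k)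
                                      ≈ coefficient v w * A″.a k
      coefficient-raise k v w = begin
        A.a k * (α * (x ^ w - y⁻¹ ^ (v ℕ.+ suc k))) + A′.a k * (α * (x ^ (w ℕ.+ suc k) - y⁻¹ ^ v))
          ≈⟨ +-cong (*-congˡ (*-congˡ (+-congˡ (-‿cong (^-homo-* y⁻¹ v (suc k))))))
                    (*-congˡ (*-congˡ (+-congʳ (^-homo-* x w (suc k))))) ⟩
        A.a k * (α * (x ^ w - y⁻¹ ^ v * y⁻¹ ^ suc k)) + A′.a k * (α * (x ^ w * x ^ suc k - y⁻¹ ^ v))
          ≈⟨ solve 7 (λ a a′ α X Y xk yk → a :* (α :* (X :- Y :* yk)) :+ a′ :* (α :* (X :* xk :- Y))
               := α :* (X :* (a :+ a′ :* xk) :- Y :* (a :* yk :+ a′))) refl _ _ _ _ _ _ _ ⟩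
        α * (x ^ w * (A.a k + A′.a k * x ^ suc k) - y⁻¹ ^ v * (A.a k * y⁻¹ ^ suc k + A′.a k))
          ≈⟨ *-congˡ (+-cong (*-congˡ (a-sum k)) (-‿cong (*-congˡ (a-sum′ k)))) ⟩
        α * (x ^ w * A″.a k - y⁻¹ ^ v * A″.a k)
          ≈⟨ solve 4 (λ α X Y a → α :* (X :* a :- Y :* a) := α :* (X :- Y) :* a) refl _ _ _ _ ⟩
        coefficient v w * A″.a k ∎

      op-raise : ∀ B (a : ℕ → Carrier) → (∀ k → Scalar (a k)) → ∀ k g v w → VertexOperator.op B v (raise a k g w) ≈
        p (suc k) * VertexOperator.op B v (g w) + VertexOperator.a B k * VertexOperator.op B (v ℕ.+ suc k) (g w)
          + a k * VertexOperator.op B v (g (w ℕ.+ suc k))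
      op-raise B a sc k g v w = trans (VertexOperator.op-+ B v _ _) (+-cong (VertexOperator.op-p B v k (g w)) (VertexOperator.op-scalar B v (sc k) _))

    commutes-raise : ∀ k {g g′ g″} → Commutes g g′ g″ → Commutes (raise A.a k g) (raise A′.a k g′) (raise A″.a k g″)
    commutes-raise k {g} {g′} {g″} h v w = begin
      A.op v (raise A′.a k g′ w) - A′.op w (raise A.a k g v)
        ≈⟨ +-cong (op-raise A A′.a A′.a-scalar k g′ v w) (-‿cong (op-raise A′ A.a A.a-scalar k g w v)) ⟩
      -- The contraction term of each operator is paired with the raised argument of the other, so
      -- that every difference is an instance of the hypothesis.
      _ ≈⟨ solve 9 (λ p a a′ X Y Z X′ Y′ Z′ → (p :* X :+ a :* Y :+ a′ :* Z) :- (p :* X′ :+ a′ :* Y′ :+ a :* Z′)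
             := p :* (X :- X′) :+ a :* (Y :- Z′) :+ a′ :* (Z :- Y′)) refl _ _ _ _ _ _ _ _ _ ⟩
      p (suc k) * (A.op v (g′ w) - A′.op w (g v))
        + A.a k * (A.op (v ℕ.+ suc k) (g′ w) - A′.op w (g (v ℕ.+ suc k)))
        + A′.a k * (A.op v (g′ (w ℕ.+ suc k)) - A′.op (w ℕ.+ suc k) (g v))
        ≈⟨ +-cong (+-cong (*-congˡ (h v w))
             (*-congˡ (trans (h (v ℕ.+ suc k) w) (*-congˡ (reflexive (cong g″ (regroup v (suc k) w)))))))
             (*-congˡ (trans (h v (w ℕ.+ suc k)) (*-congˡ (reflexive (cong g″ (≡.sym (ℕₚ.+-assoc v w (suc k)))))))) ⟩
      p (suc k) * (coefficient v w * g″ (v ℕ.+ w))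
        + A.a k * (coefficient (v ℕ.+ suc k) w * g″ (v ℕ.+ w ℕ.+ suc k))
        + A′.a k * (coefficient v (w ℕ.+ suc k) * g″ (v ℕ.+ w ℕ.+ suc k))
        ≈⟨ solve 8 (λ p c G a c₁ a′ c₂ H → p :* (c :* G) :+ a :* (c₁ :* H) :+ a′ :* (c₂ :* H)
             := c :* (p :* G) :+ (a :* c₁ :+ a′ :* c₂) :* H) refl _ _ _ _ _ _ _ _ ⟩
      coefficient v w * (p (suc k) * g″ (v ℕ.+ w)) + (A.a k * coefficient (v ℕ.+ suc k) w + A′.a k * coefficient v (w ℕ.+ suc k)) * g″ (v ℕ.+ w ℕ.+ suc k)
        ≈⟨ +-congˡ (*-congʳ (coefficient-raise k v w)) ⟩
      coefficient v w * (p (suc k) * g″ (v ℕ.+ w)) + coefficient v w * A″.a k * g″ (v ℕ.+ w ℕ.+ suc k)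
        ≈⟨ solve 5 (λ c p G a H → c :* (p :* G) :+ c :* a :* H := c :* (p :* G :+ a :* H)) refl _ _ _ _ _ ⟩
      coefficient v w * raise A″.a k g″ (v ℕ.+ w) ∎
      where
      regroup : ∀ v k w → v ℕ.+ k ℕ.+ w ≡ v ℕ.+ w ℕ.+ k
      regroup v k w = ≡.trans (ℕₚ.+-assoc v k w) (≡.trans (cong (v ℕ.+_) (ℕₚ.+-comm k w)) (≡.sym (ℕₚ.+-assoc v w k)))

-- Polynomials over ℚ

module ℚ[[q]] = PowerSeries ℚₚ.+-*-commutativeRing
open ℚ[[q]] using () renaming (_⊛_ to _⊛ᵠ_)

coeff-+ : ∀ p r i → coeffP (p +P r) i ≡ coeffP p i ℚ.+ coeffP r i
coeff-+ [] r i = ≡.sym (ℚₚ.+-identityˡ _)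
coeff-+ (a ∷ p) [] i = ≡.sym (ℚₚ.+-identityʳ _)
coeff-+ (a ∷ p) (b ∷ r) zero = ≡.refl
coeff-+ (a ∷ p) (b ∷ r) (suc i) = coeff-+ p r i

coeff-scale : ∀ c p i → coeffP (scaleP c p) i ≡ c ℚ.* coeffP p i
coeff-scale c [] i = ≡.sym (ℚₚ.*-zeroʳ c)
coeff-scale c (a ∷ p) zero = ≡.refl
coeff-scale c (a ∷ p) (suc i) = coeff-scale c p i

coeff-* : ∀ p r i → coeffP (p *P r) i ≡ (coeffP p ⊛ᵠ coeffP r) i
coeff-* [] r i = ≡.sym (ℚ[[q]].⊛-zeroˡ (coeffP r) i)
coeff-* (a ∷ p) r zero = ≡.trans (coeff-+ (scaleP a r) (0ℚ ∷ p *P r) 0)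
  (≡.trans (ℚₚ.+-identityʳ _) (coeff-scale a r 0))
coeff-* (a ∷ p) r (suc i) = ≡.trans (coeff-+ (scaleP a r) (0ℚ ∷ p *P r) (suc i))
  (cong₂ ℚ._+_ (coeff-scale a r (suc i)) (coeff-* p r i))

negP : Poly → Poly
negP = map (ℚ.-_)

coeff-neg : ∀ p i → coeffP (negP p) i ≡ ℚ.- coeffP p i
coeff-neg [] i = ≡.refl
coeff-neg (a ∷ p) zero = ≡.refl
coeff-neg (a ∷ p) (suc i) = coeff-neg p i

1P : Poly
1P = 1ℚ ∷ []

coeff-1 : ∀ i → coeffP 1P i ≡ ℚ[[q]].δ i
coeff-1 zero    = ≡.refl
coeff-1 (suc i) = ≡.refl

private
  module Q = CommutativeRing ℚ[[q]].seriesRing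

  -- Coefficient lists map to power series, and `≈P` is equality of the images; all ring laws of
  -- polynomials are inherited along this map.
  record _represents_ (p : Poly) (f : ℕ → ℚ) : Set where
    constructor coefficientwise
    field coefficients : ∀ i → coeffP p i ≡ f i
  open _represents_

  infixl 6 _⊞_
  infixl 7 _⊠_
  self : ∀ p → p represents coeffP p
  self p = coefficientwise λ _ → ≡.refl
  _⊞_ : ∀ {p r f g} → p represents f → r represents g → (p +P r) represents (λ i → f i ℚ.+ g i)
  _⊞_ {p} {r} P S = coefficientwise λ i → ≡.trans (coeff-+ p r i) (cong₂ ℚ._+_ (coefficients P i) (coefficients S i))
  _⊠_ : ∀ {p r f g} → p represents f → r represents g → (p *P r) represents (f ⊛ᵠ g)
  _⊠_ {p} {r} P S = coefficientwise λ i → ≡.trans (coeff-* p r i) (ℚ[[q]].⊛-cong (coefficients P) (coefficients S) i)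
  neg : ∀ {p f} → p represents f → negP p represents (λ i → ℚ.- f i)
  neg {p} P = coefficientwise λ i → ≡.trans (coeff-neg p i) (cong ℚ.-_ (coefficients P i))
  one : 1P represents ℚ[[q]].δ
  one = coefficientwise coeff-1
  zer : [] represents (λ _ → 0ℚ)
  zer = coefficientwise λ _ → ≡.refl

  equal : ∀ {p r f g} → p represents f → r represents g → (∀ i → f i ≡ g i) → p ≈P r
  equal P S f≡g i = ≡.trans (coefficients P i) (≡.trans (f≡g i) (≡.sym (coefficients S i)))

polyRing : CommutativeRing 0ℓ 0ℓ
polyRing = makeCommutativeRing {_≈_ = _≈P_} {_+P_} {_*P_} {negP} {[]} {1P}
  (record { refl = λ _ → ≡.refl ; sym = λ h i → ≡.sym (h i) ; trans = λ h k i → ≡.trans (h i) (k i) })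
  (λ {x} {y} {u} {v} h k → equal (self x ⊞ self u) (self y ⊞ self v) (Q.+-cong h k))
  (λ x y z → equal (self x ⊞ self y ⊞ self z) (self x ⊞ (self y ⊞ self z)) (Q.+-assoc (coeffP x) (coeffP y) (coeffP z)))
  (λ x y → equal (self x ⊞ self y) (self y ⊞ self x) (Q.+-comm (coeffP x) (coeffP y)))
  (λ x i → ≡.refl)
  (λ {x} {y} h → equal (neg (self x)) (neg (self y)) (Q.-‿cong h))
  (λ x → equal (neg (self x) ⊞ self x) zer (Q.-‿inverseˡ (coeffP x)))
  (λ {x} {y} {u} {v} h k → equal (self x ⊠ self u) (self y ⊠ self v) (Q.*-cong h k))
  (λ x y z → equal (self x ⊠ self y ⊠ self z) (self x ⊠ (self y ⊠ self z)) (Q.*-assoc (coeffP x) (coeffP y) (coeffP z)))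
  (λ x y → equal (self x ⊠ self y) (self y ⊠ self x) (Q.*-comm (coeffP x) (coeffP y)))
  (λ x → equal (one ⊠ self x) (self x) (Q.*-identityˡ (coeffP x)))
  (λ x y z → equal ((self y ⊞ self z) ⊠ self x) (self y ⊠ self x ⊞ self z ⊠ self x) (Q.distribʳ (coeffP x) (coeffP y) (coeffP z)))

isZero? : ∀ p → Dec (p ≈P [])
isZero? [] = yes (λ _ → ≡.refl)
isZero? (a ∷ p) with a ℚₚ.≟ 0ℚ | isZero? p
... | yes a≡0 | yes p≈0 = yes λ { zero → a≡0 ; (suc i) → p≈0 i }
... | no  a≢0 | _       = no λ h → a≢0 (h 0)
... | _       | no p≉0  = no λ h → p≉0 (h ∘ suc)

-- Low zero coefficients of r are stripped, which divides the product by q. Once the constant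
-- coefficient of r is nonzero, the coefficients of p vanish one after another from the bottom.
*-noZeroDivisors : ∀ p r → (p *P r) ≈P [] → p ≈P [] ⊎ r ≈P []
*-noZeroDivisors p r pr≈0 with isZero? r
... | yes r≈0 = inj₂ r≈0
... | no r≉0 = inj₁ (cancel r r≉0 p (λ i → ≡.trans (≡.sym (coeff-* p r i)) (pr≈0 i)))
  where
  cancelℚ : ∀ a b → ¬ b ≡ 0ℚ → a ℚ.* b ≡ 0ℚ → a ≡ 0ℚ
  cancelℚ a b b≢0 ab≡0 = begin
    a ≡⟨ ≡.sym (ℚₚ.*-identityʳ a) ⟩
    a ℚ.* 1ℚ ≡⟨ cong (λ c → a ℚ.* c) (≡.sym (ℚₚ.*-inverseʳ b)) ⟩
    a ℚ.* (b ℚ.* ℚ.1/ b) ≡⟨ ≡.sym (ℚₚ.*-assoc a b _) ⟩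
    a ℚ.* b ℚ.* ℚ.1/ b ≡⟨ cong (λ c → c ℚ.* ℚ.1/ b) ab≡0 ⟩
    0ℚ ℚ.* ℚ.1/ b ≡⟨ ℚₚ.*-zeroˡ (ℚ.1/ b) ⟩
    0ℚ ∎
    where open ≡-Reasoning
          instance _ = ℚ.≢-nonZero b≢0

  cancel-unit : ∀ b s → ¬ b ≡ 0ℚ → s 0 ≡ b → ∀ p → (∀ i → (coeffP p ⊛ᵠ s) i ≡ 0ℚ) → p ≈P []
  cancel-unit b s b≢0 s₀ [] h i = ≡.refl
  cancel-unit b s b≢0 s₀ (a ∷ p) h = λ { zero → a≡0 ; (suc i) → cancel-unit b s b≢0 s₀ p rest i }
    where
    a≡0 : a ≡ 0ℚ
    a≡0 = cancelℚ a b b≢0 (≡.trans (cong (a ℚ.*_) (≡.sym s₀)) (h 0))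
    rest : ∀ i → (coeffP p ⊛ᵠ s) i ≡ 0ℚ
    rest i = begin
      (coeffP p ⊛ᵠ s) i ≡⟨ ≡.sym (ℚₚ.+-identityˡ _) ⟩
      0ℚ ℚ.+ (coeffP p ⊛ᵠ s) i ≡⟨ cong (λ c → c ℚ.+ (coeffP p ⊛ᵠ s) i) (≡.sym (ℚₚ.*-zeroˡ (s (suc i)))) ⟩
      0ℚ ℚ.* s (suc i) ℚ.+ (coeffP p ⊛ᵠ s) i ≡⟨ cong (λ c → c ℚ.* s (suc i) ℚ.+ (coeffP p ⊛ᵠ s) i) (≡.sym a≡0) ⟩
      a ℚ.* s (suc i) ℚ.+ (coeffP p ⊛ᵠ s) i ≡⟨ h (suc i) ⟩
      0ℚ ∎
      where open ≡-Reasoning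

  cancel : ∀ r → ¬ r ≈P [] → ∀ p → (∀ i → (coeffP p ⊛ᵠ coeffP r) i ≡ 0ℚ) → p ≈P []
  cancel [] r≉0 p h = contradiction (λ _ → ≡.refl) r≉0
  cancel (b ∷ r) r≉0 p h with b ℚₚ.≟ 0ℚ
  ... | no b≢0 = cancel-unit b (coeffP (b ∷ r)) b≢0 ≡.refl p h
  ... | yes b≡0 = cancel r (λ r≈0 → r≉0 λ { zero → b≡0 ; (suc i) → r≈0 i }) p λ i → begin
    (coeffP p ⊛ᵠ coeffP r) i ≡⟨ ≡.sym (ℚₚ.+-identityˡ _) ⟩
    0ℚ ℚ.+ (coeffP p ⊛ᵠ coeffP r) i ≡⟨ cong (λ c → c ℚ.+ (coeffP p ⊛ᵠ coeffP r) i) (≡.sym (ℚₚ.*-zeroʳ (coeffP p (suc i)))) ⟩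
    coeffP p (suc i) ℚ.* 0ℚ ℚ.+ (coeffP p ⊛ᵠ coeffP r) i ≡⟨ cong (λ c → coeffP p (suc i) ℚ.* c ℚ.+ (coeffP p ⊛ᵠ coeffP r) i) (≡.sym b≡0) ⟩
    coeffP p (suc i) ℚ.* b ℚ.+ (coeffP p ⊛ᵠ coeffP r) i ≡⟨ ≡.sym (ℚ[[q]].⊛-last (coeffP p) (coeffP (b ∷ r)) i) ⟩
    (coeffP p ⊛ᵠ coeffP (b ∷ r)) (suc i) ≡⟨ h (suc i) ⟩
    0ℚ ∎
    where open ≡-Reasoning

-- The fraction field

NoZeroDivisors : CommutativeRing 0ℓ 0ℓ → Set
NoZeroDivisors R = ∀ x y → x * y ≈ 0# → x ≈ 0# ⊎ y ≈ 0#
  where open CommutativeRing R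

Nontrivial : CommutativeRing 0ℓ 0ℓ → Set
Nontrivial R = ¬ 1# ≈ 0#
  where open CommutativeRing R

module Fractions (R : CommutativeRing 0ℓ 0ℓ) (1≉0 : Nontrivial R) (noZeroDivisors : NoZeroDivisors R) where
  open CommutativeRing R
  open Solver R

  record Fraction : Set where
    no-eta-equality
    pattern
    constructor _/_[_]
    field
      numerator denominator : Carrier
      denominator≉0 : ¬ denominator ≈ 0#
  open Fraction public

  infix 4 _≃_
  record _≃_ (x y : Fraction) : Set where
    no-eta-equality
    pattern
    constructor cross
    field cross-equal : numerator x * denominator y ≈ numerator y * denominator x
  open _≃_ public

  product≉0 : ∀ {x y} → ¬ x ≈ 0# → ¬ y ≈ 0# → ¬ x * y ≈ 0#
  product≉0 {x} {y} x≉0 y≉0 xy≈0 with noZeroDivisors x y xy≈0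
  ... | inj₁ x≈0 = x≉0 x≈0
  ... | inj₂ y≈0 = y≉0 y≈0

  cancelˡ : ∀ {x} y z → ¬ x ≈ 0# → x * y ≈ x * z → y ≈ z
  cancelˡ {x} y z x≉0 h with noZeroDivisors x (y - z)
    (trans (solve 3 (λ x y z → x :* (y :- z) := x :* y :- x :* z) refl x y z) (trans (+-congʳ h) (-‿inverseʳ _)))
  ... | inj₁ x≈0 = contradiction x≈0 x≉0
  ... | inj₂ y-z≈0 = trans (solve 2 (λ y z → y := (y :- z) :+ z) refl y z) (trans (+-congʳ y-z≈0) (+-identityˡ z))

  infixl 7 _⊗_
  infixl 6 _⊕_
  _⊕_ _⊗_ : Fraction → Fraction → Fraction
  (a / b [ b≉0 ]) ⊕ (c / d [ d≉0 ]) = (a * d + c * b) / b * d [ product≉0 b≉0 d≉0 ]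
  (a / b [ b≉0 ]) ⊗ (c / d [ d≉0 ]) = (a * c) / b * d [ product≉0 b≉0 d≉0 ]

  ⊖_ : Fraction → Fraction
  ⊖ (a / b [ b≉0 ]) = (- a) / b [ b≉0 ]

  integral : Carrier → Fraction
  integral a = a / 1# [ 1≉0 ]

  -- The middle denominator has to be cancelled. This fails for `≈F` on raw fractions, where 0//0 is
  -- related to everything.
  ≃-trans : ∀ {x y z} → x ≃ y → y ≃ z → x ≃ z
  ≃-trans {a / b [ _ ]} {c / d [ d≉0 ]} {e / f [ _ ]} (cross h) (cross k) = cross (cancelˡ _ _ d≉0 (begin
    d * (a * f) ≈⟨ solve 3 (λ d a f → d :* (a :* f) := a :* d :* f) refl _ _ _ ⟩
    a * d * f ≈⟨ *-congʳ h ⟩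
    c * b * f ≈⟨ solve 3 (λ c b f → c :* b :* f := c :* f :* b) refl _ _ _ ⟩
    c * f * b ≈⟨ *-congʳ k ⟩
    e * d * b ≈⟨ solve 3 (λ e d b → e :* d :* b := d :* (e :* b)) refl _ _ _ ⟩
    d * (e * b) ∎))
    where open SetoidReasoning setoid

  fractionField : CommutativeRing 0ℓ 0ℓ
  fractionField = makeCommutativeRing {_≈_ = _≃_} {_⊕_} {_⊗_} {⊖_} {integral 0#} {integral 1#}
    (record { refl = cross refl ; sym = λ { (cross h) → cross (sym h) } ; trans = ≃-trans })
    (λ { {a / b [ _ ]} {a′ / b′ [ _ ]} {c / d [ _ ]} {c′ / d′ [ _ ]} (cross h) (cross k) → cross (trans
      (solve 6 (λ a b b′ c d d′ → (a :* d :+ c :* b) :* (b′ :* d′) := (a :* b′) :* (d :* d′) :+ (c :* d′) :* (b :* b′)) refl a b b′ c d d′)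
      (trans (+-cong (*-congʳ h) (*-congʳ k))
      (solve 6 (λ a′ b b′ c′ d d′ → (a′ :* b) :* (d :* d′) :+ (c′ :* d) :* (b :* b′) := (a′ :* d′ :+ c′ :* b′) :* (b :* d)) refl a′ b b′ c′ d d′))) })
    (λ { (a / b [ _ ]) (c / d [ _ ]) (e / f [ _ ]) →
      cross (solve 6 (λ a b c d e f → ((a :* d :+ c :* b) :* f :+ e :* (b :* d)) :* (b :* (d :* f)) := (a :* (d :* f) :+ (c :* f :+ e :* d) :* b) :* (b :* d :* f)) refl a b c d e f) })
    (λ { (a / b [ _ ]) (c / d [ _ ]) → cross (solve 4 (λ a b c d → (a :* d :+ c :* b) :* (d :* b) := (c :* b :+ a :* d) :* (b :* d)) refl a b c d) })
    (λ { (a / b [ _ ]) → cross (solve 2 (λ a b → (con (+ 0) :* b :+ a :* con (+ 1)) :* b := a :* (con (+ 1) :* b)) refl a b) })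
    (λ { {a / b [ _ ]} {c / d [ _ ]} (cross h) → cross (trans (solve 2 (λ a d → :- a :* d := :- (a :* d)) refl a d)
      (trans (-‿cong h) (solve 2 (λ c b → :- (c :* b) := :- c :* b) refl c b))) })
    (λ { (a / b [ _ ]) → cross (solve 2 (λ a b → (:- a :* b :+ a :* b) :* con (+ 1) := con (+ 0) :* (b :* b)) refl a b) })
    (λ { {a / b [ _ ]} {a′ / b′ [ _ ]} {c / d [ _ ]} {c′ / d′ [ _ ]} (cross h) (cross k) → cross (trans
      (solve 4 (λ a c b′ d′ → a :* c :* (b′ :* d′) := (a :* b′) :* (c :* d′)) refl a c b′ d′)
      (trans (*-cong h k) (solve 4 (λ a c b d → (a :* b) :* (c :* d) := a :* c :* (b :* d)) refl a′ c′ b d))) })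
    (λ { (a / b [ _ ]) (c / d [ _ ]) (e / f [ _ ]) →
      cross (solve 6 (λ a b c d e f → a :* c :* e :* (b :* (d :* f)) := a :* (c :* e) :* (b :* d :* f)) refl a b c d e f) })
    (λ { (a / b [ _ ]) (c / d [ _ ]) → cross (solve 4 (λ a b c d → a :* c :* (d :* b) := c :* a :* (b :* d)) refl a b c d) })
    (λ { (a / b [ _ ]) → cross (solve 2 (λ a b → con (+ 1) :* a :* b := a :* (con (+ 1) :* b)) refl a b) })
    (λ { (a / b [ _ ]) (c / d [ _ ]) (e / f [ _ ]) →
      cross (solve 6 (λ a b c d e f → (c :* f :+ e :* d) :* a :* ((d :* b) :* (f :* b)) := (c :* a :* (f :* b) :+ e :* a :* (d :* b)) :* ((d :* f) :* b)) refl a b c d e f) })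

  ≃0⇒numerator≈0 : ∀ {x} → x ≃ integral 0# → numerator x ≈ 0#
  ≃0⇒numerator≈0 (cross h) = trans (sym (*-identityʳ _)) (trans h (zeroˡ _))

  numerator≈0⇒≃0 : ∀ {x} → numerator x ≈ 0# → x ≃ integral 0#
  numerator≈0⇒≃0 h = cross (trans (*-identityʳ _) (trans h (sym (zeroˡ _))))

  1≄0 : ¬ integral 1# ≃ integral 0#
  1≄0 h = 1≉0 (≃0⇒numerator≈0 h)

  ⊗-cancelˡ : ∀ {x} y z → ¬ x ≃ integral 0# → x ⊗ y ≃ x ⊗ z → y ≃ z
  ⊗-cancelˡ {a / b [ b≉0 ]} (c / d [ _ ]) (e / f [ _ ]) x≄0 (cross h) =
    cross (cancelˡ (c * f) (e * d) (product≉0 (λ a≈0 → x≄0 (numerator≈0⇒≃0 a≈0)) b≉0)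
      (trans (solve 4 (λ a b c f → a :* b :* (c :* f) := a :* c :* (b :* f)) refl a b c f)
        (trans h (solve 4 (λ a b e d → a :* e :* (b :* d) := a :* b :* (e :* d)) refl a b e d))))

  integral-cong : ∀ {a b} → a ≈ b → integral a ≃ integral b
  integral-cong a≈b = cross (*-congʳ a≈b)

  integral-injective : ∀ {a b} → integral a ≃ integral b → a ≈ b
  integral-injective (cross h) = trans (sym (*-identityʳ _)) (trans h (*-identityʳ _))

  integral-+ : ∀ a b → integral (a + b) ≃ integral a ⊕ integral b
  integral-+ a b = cross (solve 2 (λ a b → (a :+ b) :* (con (+ 1) :* con (+ 1)) := (a :* con (+ 1) :+ b :* con (+ 1)) :* con (+ 1)) refl a b)

  integral-* : ∀ a b → integral (a * b) ≃ integral a ⊗ integral b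
  integral-* a b = cross (solve 2 (λ a b → a :* b :* (con (+ 1) :* con (+ 1)) := a :* b :* con (+ 1)) refl a b)

  ⊗-inverseˡ : ∀ {a b} (a≉0 : ¬ a ≈ 0#) (b≉0 : ¬ b ≈ 0#) → (b / a [ a≉0 ]) ⊗ (a / b [ b≉0 ]) ≃ integral 1#
  ⊗-inverseˡ {a} {b} _ _ = cross (solve 2 (λ a b → b :* a :* con (+ 1) := con (+ 1) :* (a :* b)) refl a b)

-- Evaluation of formal fractions in a field

Bad : Frac → Set
Bad x = den x ≈P []

bad? : ∀ x → Dec (Bad x)
bad? x = isZero? (den x)

bad-* : ∀ x y → Bad (x *F y) → Bad x ⊎ Bad y
bad-* x y = *-noZeroDivisors (den x) (den y)

good-* : ∀ {x y} → ¬ Bad x → ¬ Bad y → ¬ Bad (x *F y)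
good-* {x} {y} gx gy bad with bad-* x y bad
... | inj₁ bx = gx bx
... | inj₂ by = gy by

bad-*ˡ : ∀ x y → Bad x → Bad (x *F y)
bad-*ˡ x y bx = ℚ[q].trans {den x *P den y} {[] *P den y} {[]} (ℚ[q].*-congʳ {den y} {den x} {[]} bx) (ℚ[q].zeroˡ (den y))
  where module ℚ[q] = CommutativeRing polyRing

bad-*ʳ : ∀ x y → Bad y → Bad (x *F y)
bad-*ʳ x y by = ℚ[q].trans {den x *P den y} {den x *P []} {[]} (ℚ[q].*-congˡ {den x} {den y} {[]} by) (ℚ[q].zeroʳ (den x))
  where module ℚ[q] = CommutativeRing polyRing

-- All that is used of ℚ(q). Fractions with zero denominator have a value too, namely 0 in the
-- instance below: this respects products without exception, but sums and the reflection of equality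
-- only for nonzero denominators.
record Evaluation (K : CommutativeRing 0ℓ 0ℓ) : Set where
  open CommutativeRing K
  open Solver K using (_·_)
  open Powers K using (_^_)
  field
    val         : Frac → Carrier
    val-*       : ∀ x y → val (x *F y) ≈ val x * val y
    val-+       : ∀ x y → ¬ Bad x → ¬ Bad y → val (x +F y) ≈ val x + val y
    val-0       : val 0F ≈ 0#
    val-1       : val 1F ≈ 1#
    val-neg1    : val -1F ≈ - 1#
    val-qpow    : ∀ n → val (qpow n) ≈ val (qpow 1) ^ n
    val-ℕ       : ∀ n → val (fromℕF n) ≈ n · 1#
    val-inv     : ∀ x → ¬ val x ≈ 0# → val (invF x) * val x ≈ 1#
    val≉0⇒good  : ∀ x → ¬ val x ≈ 0# → ¬ Bad x × ¬ Bad (invF x)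
    val-reflect : ∀ x y → ¬ Bad x → ¬ Bad y → val x ≈ val y → x ≈F y
    represent   : Carrier → Frac
    val-represent : ∀ a → val (represent a) ≈ a
    1≉0         : ¬ 1# ≈ 0#
    cancelˡ     : ∀ {x} y z → ¬ x ≈ 0# → x * y ≈ x * z → y ≈ z
    suc≉0       : ∀ n → ¬ suc n · 1# ≈ 0#
    q≉0         : ¬ val (qpow 1) ≈ 0#
    -- q is not a root of unity, which keeps the denominators of the q-numbers and of 1/M nonzero.
    q^suc≉1     : ∀ n → ¬ val (qpow 1) ^ suc n ≈ 1#

module RationalFunctions where
  1P≉0 : ¬ 1P ≈P []
  1P≉0 h = ℚₚ.1≢0 (h 0)

  open Fractions polyRing 1P≉0 *-noZeroDivisors

  module ℚ[q] = CommutativeRing polyRing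
  module K = CommutativeRing fractionField
  open Solver fractionField using () renaming (_·_ to _·ᴷ_; 1+· to 1+·ᴷ)
  open Powers fractionField using (_^_)

  eval : Frac → K.Carrier
  eval x with bad? x
  ... | yes _ = K.0#
  ... | no good = num x / den x [ good ]

  eval-good : ∀ x (good : ¬ Bad x) → eval x K.≈ num x / den x [ good ]
  eval-good x good with bad? x
  ... | yes bad = contradiction bad good
  ... | no _ = cross (ℚ[q].refl {num x *P den x})

  eval-bad : ∀ x → Bad x → eval x K.≈ K.0#
  eval-bad x bad with bad? x
  ... | yes _ = K.refl
  ... | no good = contradiction bad good

  eval-* : ∀ x y → eval (x *F y) K.≈ (eval x K.* eval y)
  eval-* x y = helper (bad? x) (bad? y)
    where
    helper : Dec (Bad x) → Dec (Bad y) → eval (x *F y) K.≈ (eval x K.* eval y)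
    helper (yes bad) _ = K.trans (eval-bad (x *F y) (bad-*ˡ x y bad)) (K.sym (K.trans (K.*-congʳ (eval-bad x bad)) (K.zeroˡ (eval y))))
    helper (no _) (yes bad) = K.trans (eval-bad (x *F y) (bad-*ʳ x y bad)) (K.sym (K.trans (K.*-congˡ (eval-bad y bad)) (K.zeroʳ (eval x))))
    helper (no gx) (no gy) = K.trans (eval-good (x *F y) (good-* {x} {y} gx gy)) (K.sym (K.*-cong (eval-good x gx) (eval-good y gy)))

  eval-+ : ∀ x y → ¬ Bad x → ¬ Bad y → eval (x +F y) K.≈ (eval x K.+ eval y)
  eval-+ x y gx gy = K.trans (eval-good (x +F y) (good-* {x} {y} gx gy))
    (K.sym (K.+-cong (eval-good x gx) (eval-good y gy)))

  eval-reflect : ∀ x y → ¬ Bad x → ¬ Bad y → eval x K.≈ eval y → x ≈F y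
  eval-reflect x y gx gy h = cross-equal (K.trans (K.sym (eval-good x gx)) (K.trans h (eval-good y gy)))

  numerator≉0 : ∀ x → ¬ eval x K.≈ K.0# → ¬ num x ≈P []
  numerator≉0 x h n≈0 with bad? x
  ... | yes _ = h K.refl
  ... | no _ = h (numerator≈0⇒≃0 n≈0)

  eval≉0⇒good : ∀ x → ¬ eval x K.≈ K.0# → ¬ Bad x × ¬ Bad (invF x)
  eval≉0⇒good x h = (λ bad → h (eval-bad x bad)) , numerator≉0 x h

  eval-inv : ∀ x → ¬ eval x K.≈ K.0# → (eval (invF x) K.* eval x) K.≈ K.1#
  eval-inv x h = K.trans (K.*-cong (eval-good (invF x) n≉0) (eval-good x good)) (⊗-inverseˡ {num x} {den x} n≉0 good)
    where
    n≉0 = numerator≉0 x h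
    good = proj₁ (eval≉0⇒good x h)

  qmon-suc : ∀ n → (qmon 1 *P qmon n) ≈P qmon (suc n)
  qmon-suc n zero = ≡.trans (coeff-* (qmon 1) (qmon n) 0) (ℚₚ.*-zeroˡ (coeffP (qmon n) 0))
  qmon-suc n (suc i) = begin
    coeffP (qmon 1 *P qmon n) (suc i) ≡⟨ coeff-* (qmon 1) (qmon n) (suc i) ⟩
    0ℚ ℚ.* c (suc i) ℚ.+ (coeffP 1P ⊛ c) i ≡⟨ cong₂ ℚ._+_ (ℚₚ.*-zeroˡ (c (suc i))) (ℚ[[q]].⊛-cong coeff-1 (λ _ → ≡.refl) i) ⟩
    0ℚ ℚ.+ (ℚ[[q]].δ ⊛ c) i ≡⟨ ≡.trans (ℚₚ.+-identityˡ _) (ℚ[[q]].⊛-identityˡ c i) ⟩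
    c i ∎
    where
    open ≡-Reasoning
    open ℚ[[q]] using (_⊛_)
    c : ℕ → ℚ
    c = coeffP (qmon n)

  eval-qpow : ∀ n → eval (qpow n) K.≈ (eval (qpow 1) ^ n)
  eval-qpow zero = eval-good (qpow 0) 1P≉0
  eval-qpow (suc n) = begin
    eval (qpow (suc n)) ≈⟨ eval-good (qpow (suc n)) 1P≉0 ⟩
    integral (qmon (suc n)) ≈⟨ integral-cong (ℚ[q].sym {qmon 1 *P qmon n} {qmon (suc n)} (qmon-suc n)) ⟩
    integral (qmon 1 *P qmon n) ≈⟨ integral-* (qmon 1) (qmon n) ⟩
    integral (qmon 1) K.* integral (qmon n) ≈⟨ K.*-cong (K.sym (eval-good (qpow 1) 1P≉0)) (K.sym (eval-good (qpow n) 1P≉0)) ⟩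
    eval (qpow 1) K.* eval (qpow n) ≈⟨ K.*-congˡ (eval-qpow n) ⟩
    eval (qpow 1) ^ suc n ∎
    where open SetoidReasoning K.setoid

  q≉0 : ¬ eval (qpow 1) K.≈ K.0#
  q≉0 h = ℚₚ.1≢0 (≃0⇒numerator≈0 (K.trans (K.sym (eval-good (qpow 1) 1P≉0)) h) 1)

  -- The constant coefficients 0 and 1 differ.
  q^suc≉1 : ∀ n → ¬ (eval (qpow 1) ^ suc n) K.≈ K.1#
  q^suc≉1 n h = ℚₚ.1≢0 (≡.sym (integral-injective qmon≃1 0))
    where
    qmon≃1 : integral (qmon (suc n)) K.≈ integral 1P
    qmon≃1 = K.trans (K.sym (eval-good (qpow (suc n)) 1P≉0)) (K.trans (eval-qpow (suc n)) h)

  fromℚ-+ : ∀ c d → eval (fromℚ (c ℚ.+ d)) K.≈ (eval (fromℚ c) K.+ eval (fromℚ d))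
  fromℚ-+ c d = K.trans (eval-good (fromℚ (c ℚ.+ d)) 1P≉0) (K.trans (integral-+ (c ∷ []) (d ∷ []))
    (K.+-cong (K.sym (eval-good (fromℚ c) 1P≉0)) (K.sym (eval-good (fromℚ d) 1P≉0))))

  toℚᵘ-ℕ : ∀ n → toℚᵘ ((+ n) ℚ./ 1) ℚᵘ.≃ ℚᵘ.mkℚᵘ (+ n) 0
  toℚᵘ-ℕ n = ℚₚ.toℚᵘ-fromℚᵘ (ℚᵘ.mkℚᵘ (+ n) 0)

  -- Reduction to lowest terms blocks computation with a variable n, hence the detour through
  -- unnormalised rationals.
  suc/1 : ∀ n → (+ suc n) ℚ./ 1 ≡ 1ℚ ℚ.+ (+ n) ℚ./ 1
  suc/1 n = ℚₚ.toℚᵘ-injective (ℚᵘₚ.≃-trans (toℚᵘ-ℕ (suc n)) (ℚᵘₚ.≃-sym (ℚᵘₚ.≃-trans (ℚₚ.toℚᵘ-homo-+ 1ℚ ((+ n) ℚ./ 1))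
    (ℚᵘₚ.≃-trans (ℚᵘₚ.+-congʳ ℚᵘ.1ℚᵘ (toℚᵘ-ℕ n)) (ℚᵘ.*≡* (cong (ℤ._* (+ 1)) (cong (λ i → + 1 ℤ.+ i) (ℤₚ.*-identityʳ (+ n)))))))))

  eval-0 : eval 0F K.≈ K.0#
  eval-0 = K.trans (eval-good 0F 1P≉0) (numerator≈0⇒≃0 λ { zero → ≡.refl ; (suc _) → ≡.refl })

  eval-ℕ : ∀ n → eval (fromℕF n) K.≈ (n ·ᴷ K.1#)
  eval-ℕ zero = eval-0
  eval-ℕ (suc n) = K.trans (K.reflexive (cong (λ c → eval (fromℚ c)) (suc/1 n)))
    (K.trans (fromℚ-+ 1ℚ ((+ n) ℚ./ 1))
      (K.trans (K.+-cong (eval-good 1F 1P≉0) (eval-ℕ n))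
        (K.sym (1+·ᴷ n K.1#))))

  suc≉0 : ∀ n → ¬ (suc n ·ᴷ K.1#) K.≈ K.0#
  suc≉0 n h = suc/1≢0 (≃0⇒numerator≈0 suc/1≃0 0)
    where
    suc/1≃0 : ((((+ suc n) ℚ./ 1) ∷ []) / 1P [ 1P≉0 ]) K.≈ K.0#
    suc/1≃0 = K.trans (K.sym (eval-good (fromℕF (suc n)) 1P≉0)) (K.trans (eval-ℕ (suc n)) h)
    suc/1≢0 : ¬ (+ suc n) ℚ./ 1 ≡ 0ℚ
    suc/1≢0 eq with ℚᵘₚ.≃-trans (ℚᵘₚ.≃-sym (toℚᵘ-ℕ (suc n))) (ℚᵘₚ.≃-reflexive (cong toℚᵘ eq))
    ... | ℚᵘ.*≡* ()

  fractionEvaluation : Evaluation fractionField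
  fractionEvaluation = record
    { val = eval ; val-* = eval-* ; val-+ = eval-+
    ; val-0 = eval-0 ; val-1 = eval-good 1F 1P≉0 ; val-neg1 = eval-good -1F 1P≉0
    ; val-qpow = eval-qpow ; val-ℕ = eval-ℕ ; val-inv = eval-inv ; val≉0⇒good = eval≉0⇒good ; val-reflect = eval-reflect
    ; represent = λ { (a / b [ _ ]) → a // b }
    ; val-represent = λ { (a / b [ b≉0 ]) → eval-good (a // b) b≉0 }
    ; 1≉0 = 1≄0 ; cancelˡ = ⊗-cancelˡ ; suc≉0 = suc≉0 ; q≉0 = q≉0 ; q^suc≉1 = q^suc≉1 }

-- Values of the q-numbers and the scalar identities of the commutator

module Scalars (K : CommutativeRing 0ℓ 0ℓ) (E : Evaluation K) where
  open CommutativeRing K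
  open Evaluation E
  open Solver K
  open Powers K
  open SetoidReasoning setoid

  *≉0 : ∀ {x y} → ¬ x ≈ 0# → ¬ y ≈ 0# → ¬ x * y ≈ 0#
  *≉0 {x} {y} x≉0 y≉0 xy≈0 = y≉0 (cancelˡ y 0# x≉0 (trans xy≈0 (sym (zeroʳ x))))

  *≉0ˡ : ∀ {x y} → ¬ x * y ≈ 0# → ¬ x ≈ 0#
  *≉0ˡ xy≉0 x≈0 = xy≉0 (trans (*-congʳ x≈0) (zeroˡ _))

  ≈-≉0 : ∀ {x y} → x ≈ y → ¬ y ≈ 0# → ¬ x ≈ 0#
  ≈-≉0 x≈y y≉0 x≈0 = y≉0 (trans (sym x≈y) x≈0)

  good : ∀ x → ¬ val x ≈ 0# → ¬ Bad x
  good x x≉0 = proj₁ (val≉0⇒good x x≉0)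

  -1≉0 : ¬ - 1# ≈ 0#
  -1≉0 h = 1≉0 (trans (solve 0 (con (+ 1) := :- (:- con (+ 1))) refl) (trans (-‿cong h) (solve 0 (:- con (+ 0) := con (+ 0)) refl)))

  -- A nonzero value certifies a nonzero denominator, which additivity of `val` requires.
  val-1- : ∀ x → ¬ val x ≈ 0# → val (1F -F x) ≈ 1# - val x
  val-1- x x≉0 = begin
    val (1F -F x) ≈⟨ val-+ 1F (-F x) (good 1F (≈-≉0 val-1 1≉0))
                                (good (-F x) (≈-≉0 (val-* -1F x) (*≉0 (≈-≉0 val-neg1 -1≉0) x≉0))) ⟩
    val 1F + val (-F x) ≈⟨ +-cong val-1 (trans (val-* -1F x) (*-congʳ val-neg1)) ⟩
    1# + (- 1#) * val x ≈⟨ solve 1 (λ x → con (+ 1) :+ (:- con (+ 1)) :* x := con (+ 1) :- x) refl _ ⟩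
    1# - val x ∎

  val-divF : ∀ x y → ¬ val y ≈ 0# → val (divF x y) * val y ≈ val x
  val-divF x y y≉0 = begin
    val (divF x y) * val y ≈⟨ *-congʳ (val-* x (invF y)) ⟩
    val x * val (invF y) * val y ≈⟨ trans (*-assoc _ _ _) (*-congˡ (val-inv y y≉0)) ⟩
    val x * 1# ≈⟨ *-identityʳ _ ⟩
    val x ∎

  ℕ≉0 : ∀ n → ¬ val (fromℕF (suc n)) ≈ 0#
  ℕ≉0 n = ≈-≉0 (val-ℕ (suc n)) (suc≉0 n)

  fact≉0 : ∀ j → ¬ fact j · 1# ≈ 0#
  fact≉0 zero    = suc≉0 0
  fact≉0 (suc j) = ≈-≉0 (×1-homo-* (suc j) (fact j)) (*≉0 (suc≉0 j) (fact≉0 j))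

  q t : Carrier
  q = val (qpow 1)
  t = val (qinv 1)

  t*q : t * q ≈ 1#
  t*q = val-inv (qpow 1) q≉0

  t^*q^ : ∀ n → t ^ n * q ^ n ≈ 1#
  t^*q^ = ^-inverse t*q

  q^≉0 : ∀ n → ¬ q ^ n ≈ 0#
  q^≉0 zero    = 1≉0
  q^≉0 (suc n) = *≉0 q≉0 (q^≉0 n)

  val-qinv : ∀ n → val (qinv n) ≈ t ^ n
  val-qinv n = cancelˡ _ _ (q^≉0 n) (begin
    q ^ n * val (qinv n) ≈⟨ *-congʳ (sym (val-qpow n)) ⟩
    val (qpow n) * val (qinv n) ≈⟨ trans (*-comm _ _) (val-inv (qpow n) (≈-≉0 (val-qpow n) (q^≉0 n))) ⟩
    1# ≈⟨ sym (trans (*-comm _ _) (t^*q^ n)) ⟩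
    q ^ n * t ^ n ∎)

  t^≉0 : ∀ n → ¬ t ^ n ≈ 0#
  t^≉0 n = *≉0ˡ (≈-≉0 (t^*q^ n) 1≉0)

  val-1-qpow : ∀ n → val (1F -F qpow n) ≈ 1# - q ^ n
  val-1-qpow n = trans (val-1- (qpow n) (≈-≉0 (val-qpow n) (q^≉0 n))) (+-congˡ (-‿cong (val-qpow n)))

  val-1-qinv : ∀ n → val (1F -F qinv n) ≈ 1# - t ^ n
  val-1-qinv n = trans (val-1- (qinv n) (≈-≉0 (val-qinv n) (t^≉0 n))) (+-congˡ (-‿cong (val-qinv n)))

  1-q^≉0 : ∀ n → ¬ 1# - q ^ suc n ≈ 0#
  1-q^≉0 n h = q^suc≉1 n (begin
    q ^ suc n ≈⟨ solve 1 (λ x → x := con (+ 1) :- (con (+ 1) :- x)) refl _ ⟩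
    1# - (1# - q ^ suc n) ≈⟨ +-congˡ (-‿cong h) ⟩
    1# - 0# ≈⟨ solve 0 (con (+ 1) :- con (+ 0) := con (+ 1)) refl ⟩
    1# ∎)

  1-t^≉0 : ∀ n → ¬ 1# - t ^ suc n ≈ 0#
  1-t^≉0 n h = 1-q^≉0 n (begin
    1# - q ^ suc n ≈⟨ +-congʳ (sym (t^*q^ (suc n))) ⟩
    t ^ suc n * q ^ suc n - q ^ suc n ≈⟨ solve 2 (λ t q → t :* q :- q := :- ((con (+ 1) :- t) :* q)) refl _ _ ⟩
    - ((1# - t ^ suc n) * q ^ suc n) ≈⟨ -‿cong (trans (*-congʳ h) (zeroˡ _)) ⟩
    - 0# ≈⟨ solve 0 (:- con (+ 0) := con (+ 0)) refl ⟩
    0# ∎)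

  bq-val : ∀ k u → val (bq (suc k) u) * (1# - q ^ suc k) ≈ 1# - q ^ (suc k ℕ.* u)
  bq-val k u = begin
    val (bq (suc k) u) * (1# - q ^ suc k) ≈⟨ *-congˡ (sym (val-1-qpow (suc k))) ⟩
    val (bq (suc k) u) * val (1F -F qpow (suc k)) ≈⟨ val-divF (1F -F qpow (suc k ℕ.* u)) (1F -F qpow (suc k)) (≈-≉0 (val-1-qpow (suc k)) (1-q^≉0 k)) ⟩
    val (1F -F qpow (suc k ℕ.* u)) ≈⟨ val-1-qpow (suc k ℕ.* u) ⟩
    1# - q ^ (suc k ℕ.* u) ∎

  bt-val : ∀ k u → val (bt (suc k) u) * (1# - t ^ suc k) ≈ 1# - t ^ (suc k ℕ.* u)
  bt-val k u = begin
    val (bt (suc k) u) * (1# - t ^ suc k) ≈⟨ *-congˡ (sym (val-1-qinv (suc k))) ⟩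
    val (bt (suc k) u) * val (1F -F qinv (suc k)) ≈⟨ val-divF (1F -F qinv (suc k ℕ.* u)) (1F -F qinv (suc k)) (≈-≉0 (val-1-qinv (suc k)) (1-t^≉0 k)) ⟩
    val (1F -F qinv (suc k ℕ.* u)) ≈⟨ val-1-qinv (suc k ℕ.* u) ⟩
    1# - t ^ (suc k ℕ.* u) ∎

  Mk-val : ∀ k → val (Mk (suc k)) ≈ (1# - t ^ suc k) * (1# - q ^ suc k)
  Mk-val k = trans (val-* (1F -F qinv (suc k)) (1F -F qpow (suc k))) (*-cong (val-1-qinv (suc k)) (val-1-qpow (suc k)))

  bq≉0 : ∀ k u → ¬ val (bq (suc k) (suc u)) ≈ 0#
  bq≉0 k u = *≉0ˡ (≈-≉0 (bq-val k (suc u)) (1-q^≉0 (u ℕ.+ k ℕ.* suc u)))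

  bt≉0 : ∀ k u → ¬ val (bt (suc k) (suc u)) ≈ 0#
  bt≉0 k u = *≉0ˡ (≈-≉0 (bt-val k (suc u)) (1-t^≉0 (u ℕ.+ k ℕ.* suc u)))

  Mk≉0 : ∀ k → ¬ val (Mk (suc k)) ≈ 0#
  Mk≉0 k = ≈-≉0 (Mk-val k) (*≉0 (1-t^≉0 k) (1-q^≉0 k))

  [_] : ℕ → Carrier
  [ u ] = val (bq 1 u)

  q^* : ∀ u k → q ^ (k ℕ.* u) ≈ (q ^ u) ^ k
  q^* u k = sym (trans (^-assocʳ q u k) (reflexive (cong (q ^_) (ℕₚ.*-comm u k))))

  t^* : ∀ u k → t ^ (k ℕ.* u) ≈ (t ^ u) ^ k
  t^* u k = sym (trans (^-assocʳ t u k) (reflexive (cong (t ^_) (ℕₚ.*-comm u k))))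

  [_]-val : ∀ u → [ u ] * (1# - q) ≈ 1# - q ^ u
  [ u ]-val = begin
    [ u ] * (1# - q) ≈⟨ *-congˡ (+-congˡ (-‿cong (sym (*-identityʳ q)))) ⟩
    [ u ] * (1# - q ^ 1) ≈⟨ bq-val 0 u ⟩
    1# - q ^ (1 ℕ.* u) ≈⟨ +-congˡ (-‿cong (reflexive (cong (q ^_) (ℕₚ.*-identityˡ u)))) ⟩
    1# - q ^ u ∎

  M-val : val M ≈ (1# - t) * (1# - q)
  M-val = trans (Mk-val 0) (*-cong (+-congˡ (-‿cong (*-identityʳ t))) (+-congˡ (-‿cong (*-identityʳ q))))

  -- charge u k = p_{k+1}[M[u]_q], coupling u k = p_{k+1}[[u]_t]
  charge coupling : ℕ → ℕ → Carrier
  charge u k   = val (Mk (suc k) *F bq (suc k) u)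
  coupling u k = val (bt (suc k) u)

  charge-val : ∀ u k → charge u k ≈ (1# - t ^ suc k) * (1# - (q ^ u) ^ suc k)
  charge-val u k = begin
    val (Mk (suc k) *F bq (suc k) u) ≈⟨ trans (val-* (Mk (suc k)) (bq (suc k) u)) (*-congʳ (Mk-val k)) ⟩
    (1# - t ^ suc k) * (1# - q ^ suc k) * val (bq (suc k) u) ≈⟨ trans (*-assoc _ _ _) (*-congˡ (*-comm _ _)) ⟩
    (1# - t ^ suc k) * (val (bq (suc k) u) * (1# - q ^ suc k)) ≈⟨ *-congˡ (trans (bq-val k u) (+-congˡ (-‿cong (q^* u (suc k))))) ⟩
    (1# - t ^ suc k) * (1# - (q ^ u) ^ suc k) ∎

  coupling-val : ∀ u k → coupling u k * (1# - t ^ suc k) ≈ 1# - (t ^ u) ^ suc k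
  coupling-val u k = trans (bt-val k u) (+-congˡ (-‿cong (t^* u (suc k))))

  -- The factor 1 - t^n of p_n[M] cancels the denominator of p_n[[u′]_t]. This is the collapse
  -- M[u]_q [u′]_t = (1 - q^u)(1 - t^u′).
  contraction : ∀ u u′ k → coupling u′ k * charge u k ≈ (1# - (q ^ u) ^ suc k) * (1# - (t ^ u′) ^ suc k)
  contraction u u′ k = begin
    coupling u′ k * charge u k ≈⟨ *-congˡ (charge-val u k) ⟩
    coupling u′ k * ((1# - t ^ suc k) * (1# - (q ^ u) ^ suc k)) ≈⟨ solve 3 (λ a b c → a :* (b :* c) := c :* (a :* b)) refl _ _ _ ⟩
    (1# - (q ^ u) ^ suc k) * (coupling u′ k * (1# - t ^ suc k)) ≈⟨ *-congˡ (coupling-val u′ k) ⟩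
    (1# - (q ^ u) ^ suc k) * (1# - (t ^ u′) ^ suc k) ∎

  q^+^ : ∀ u u′ k → (q ^ (u ℕ.+ u′)) ^ k ≈ (q ^ u) ^ k * (q ^ u′) ^ k
  q^+^ u u′ k = trans (^-congˡ k (^-homo-* q u u′)) (^-distrib-* _ _ k)

  t^+^ : ∀ u u′ k → (t ^ (u ℕ.+ u′)) ^ k ≈ (t ^ u) ^ k * (t ^ u′) ^ k
  t^+^ u u′ k = trans (^-congˡ k (^-homo-* t u u′)) (^-distrib-* _ _ k)

  t^^*q^^ : ∀ u k → (t ^ u) ^ k * (q ^ u) ^ k ≈ 1#
  t^^*q^^ u = ^-inverse (t^*q^ u)

  -- [u] + q^u [u′] = [u + u′], with q replaced by its powers.
  charge-sum : ∀ u u′ k → charge u k + charge u′ k * (q ^ u) ^ suc k ≈ charge (u ℕ.+ u′) k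
  charge-sum u u′ k = begin
    charge u k + charge u′ k * (q ^ u) ^ suc k
      ≈⟨ +-cong (charge-val u k) (*-congʳ (charge-val u′ k)) ⟩
    (1# - t ^ suc k) * (1# - (q ^ u) ^ suc k) + (1# - t ^ suc k) * (1# - (q ^ u′) ^ suc k) * (q ^ u) ^ suc k
      ≈⟨ solve 3 (λ T x x′ → T :* (con (+ 1) :- x) :+ T :* (con (+ 1) :- x′) :* x := T :* (con (+ 1) :- x :* x′)) refl _ _ _ ⟩
    (1# - t ^ suc k) * (1# - (q ^ u) ^ suc k * (q ^ u′) ^ suc k)
      ≈⟨ *-congˡ (+-congˡ (-‿cong (sym (q^+^ u u′ (suc k))))) ⟩
    (1# - t ^ suc k) * (1# - (q ^ (u ℕ.+ u′)) ^ suc k)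
      ≈⟨ sym (charge-val (u ℕ.+ u′) k) ⟩
    charge (u ℕ.+ u′) k ∎

  charge-sum′ : ∀ u u′ k → charge u k * (q ^ u′) ^ suc k + charge u′ k ≈ charge (u ℕ.+ u′) k
  charge-sum′ u u′ k = trans (+-comm _ _) (trans (charge-sum u′ u k) (reflexive (cong (λ w → charge w k) (ℕₚ.+-comm u′ u))))

  coupling-sum : ∀ u u′ k → (t ^ u′) ^ suc k * coupling u k + coupling u′ k ≈ coupling (u ℕ.+ u′) k
  coupling-sum u u′ k = cancelˡ _ _ (1-t^≉0 k) (begin
    (1# - t ^ suc k) * ((t ^ u′) ^ suc k * coupling u k + coupling u′ k)
      ≈⟨ solve 4 (λ T y b b′ → T :* (y :* b :+ b′) := y :* (b :* T) :+ b′ :* T) refl _ _ _ _ ⟩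
    (t ^ u′) ^ suc k * (coupling u k * (1# - t ^ suc k)) + coupling u′ k * (1# - t ^ suc k)
      ≈⟨ +-cong (*-congˡ (coupling-val u k)) (coupling-val u′ k) ⟩
    (t ^ u′) ^ suc k * (1# - (t ^ u) ^ suc k) + (1# - (t ^ u′) ^ suc k)
      ≈⟨ solve 2 (λ y x → y :* (con (+ 1) :- x) :+ (con (+ 1) :- y) := con (+ 1) :- x :* y) refl _ _ ⟩
    1# - (t ^ u) ^ suc k * (t ^ u′) ^ suc k
      ≈⟨ +-congˡ (-‿cong (sym (t^+^ u u′ (suc k)))) ⟩
    1# - (t ^ (u ℕ.+ u′)) ^ suc k
      ≈⟨ trans (sym (coupling-val (u ℕ.+ u′) k)) (*-comm _ _) ⟩
    (1# - t ^ suc k) * coupling (u ℕ.+ u′) k ∎)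

  -- `coupling-sum` with u and u′ exchanged, multiplied by the power of q^u.
  coupling-sum′ : ∀ u u′ k → (q ^ u) ^ suc k * coupling u k + coupling u′ k ≈ (q ^ u) ^ suc k * coupling (u ℕ.+ u′) k
  coupling-sum′ u u′ k = begin
    (q ^ u) ^ suc k * coupling u k + coupling u′ k
      ≈⟨ +-congˡ (sym (trans (*-congʳ (trans (*-comm _ _) (t^^*q^^ u (suc k)))) (*-identityˡ _))) ⟩
    (q ^ u) ^ suc k * coupling u k + (q ^ u) ^ suc k * (t ^ u) ^ suc k * coupling u′ k
      ≈⟨ solve 4 (λ x b y b′ → x :* b :+ x :* y :* b′ := x :* (y :* b′ :+ b)) refl _ _ _ _ ⟩
    (q ^ u) ^ suc k * ((t ^ u) ^ suc k * coupling u′ k + coupling u k)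
      ≈⟨ *-congˡ (trans (coupling-sum u′ u k) (reflexive (cong (λ w → coupling w k) (ℕₚ.+-comm u′ u)))) ⟩
    (q ^ u) ^ suc k * coupling (u ℕ.+ u′) k ∎

  -- (1 - q^{-u})(1 - q^{-u'}) / (1 - q^{-u-u'})
  residue : ℕ → ℕ → Carrier
  residue u u′ = - (1# - q) * ([ u ] * [ u′ ] * val (invF (bq 1 (u ℕ.+ u′))))

  residue-val : ∀ u u′ → residue (suc u) u′ * [ suc u ℕ.+ u′ ] ≈ - (1# - q) * ([ suc u ] * [ u′ ])
  residue-val u u′ = begin
    - (1# - q) * ([ suc u ] * [ u′ ] * val (invF (bq 1 (suc u ℕ.+ u′)))) * [ suc u ℕ.+ u′ ]
      ≈⟨ solve 4 (λ a b c d → a :* (b :* c) :* d := a :* b :* (c :* d)) refl _ _ _ _ ⟩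
    - (1# - q) * ([ suc u ] * [ u′ ]) * (val (invF (bq 1 (suc u ℕ.+ u′))) * [ suc u ℕ.+ u′ ])
      ≈⟨ trans (*-congˡ (val-inv (bq 1 (suc u ℕ.+ u′)) (bq≉0 0 (u ℕ.+ u′)))) (*-identityʳ _) ⟩
    - (1# - q) * ([ suc u ] * [ u′ ]) ∎

  -- q^u - q^(-u′) = -q^(-u′)(1 - q^(u+u′)), and the last factor cancels the denominator of the
  -- residue.
  residue-eq : ∀ u u′ → residue (suc u) u′ * (q ^ suc u - t ^ u′) ≈ (q ^ suc u - 1#) * (1# - t ^ u′)
  residue-eq u u′ = begin
    α * (q ^ suc u - t ^ u′)
      ≈⟨ *-congˡ (+-congʳ (sym (trans (*-congʳ (t^*q^ u′)) (*-identityˡ _)))) ⟩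
    α * (t ^ u′ * q ^ u′ * q ^ suc u - t ^ u′)
      ≈⟨ solve 4 (λ α y z x → α :* (y :* z :* x :- y) := α :* (:- y) :* (con (+ 1) :- x :* z)) refl _ _ _ _ ⟩
    α * (- t ^ u′) * (1# - q ^ suc u * q ^ u′)
      ≈⟨ *-congˡ (+-congˡ (-‿cong (sym (^-homo-* q (suc u) u′)))) ⟩
    α * (- t ^ u′) * (1# - q ^ (suc u ℕ.+ u′))
      ≈⟨ *-congˡ (sym [ suc u ℕ.+ u′ ]-val) ⟩
    α * (- t ^ u′) * ([ suc u ℕ.+ u′ ] * (1# - q))
      ≈⟨ solve 4 (λ α y w z → α :* (:- y) :* (w :* z) := (:- y) :* z :* (α :* w)) refl _ _ _ _ ⟩
    - t ^ u′ * (1# - q) * (α * [ suc u ℕ.+ u′ ])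
      ≈⟨ *-congˡ (residue-val u u′) ⟩
    - t ^ u′ * (1# - q) * (- (1# - q) * ([ suc u ] * [ u′ ]))
      ≈⟨ solve 4 (λ y z a b → (:- y) :* z :* ((:- z) :* (a :* b)) := y :* ((a :* z) :* (b :* z))) refl _ _ _ _ ⟩
    t ^ u′ * (([ suc u ] * (1# - q)) * ([ u′ ] * (1# - q)))
      ≈⟨ *-congˡ (*-cong [ suc u ]-val [ u′ ]-val) ⟩
    t ^ u′ * ((1# - q ^ suc u) * (1# - q ^ u′))
      ≈⟨ solve 3 (λ y x z → y :* ((con (+ 1) :- x) :* (con (+ 1) :- z)) := (x :- con (+ 1)) :* (y :* z :- y)) refl _ _ _ ⟩
    (q ^ suc u - 1#) * (t ^ u′ * q ^ u′ - t ^ u′)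
      ≈⟨ *-congˡ (+-congʳ (t^*q^ u′)) ⟩
    (q ^ suc u - 1#) * (1# - t ^ u′) ∎
    where α = residue (suc u) u′

  -- The area condition turns q^{uv′} - q^{u′v} into q^{uv′}(1 - q^k), so [k] appears; the residue
  -- exchanges [u][u′] for [u + u′]; the remaining -(1 - q)²/M equals q and accounts for the `suc`
  -- in the exponent.
  step-val : ∀ u v u′ v′ k {κ κ′ e e′} → κ * [ suc u ] ≈ q ^ e → κ′ * [ u′ ] ≈ q ^ e′ → u′ ℕ.* v ≡ suc u ℕ.* v′ ℕ.+ k →
    val (invF M) * (κ * κ′ * (residue (suc u) u′ * ((q ^ suc u) ^ v′ - (q ^ u′) ^ v))) * [ suc u ℕ.+ u′ ]
      ≈ [ k ] * q ^ suc (e ℕ.+ e′ ℕ.+ suc u ℕ.* v′)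
  step-val u v u′ v′ k {κ} {κ′} {e} {e′} κ-eq κ′-eq det = begin
    val (invF M) * (κ * κ′ * (α * ((q ^ suc u) ^ v′ - (q ^ u′) ^ v))) * [ suc u ℕ.+ u′ ]
      ≈⟨ *-congʳ (*-congˡ (*-congˡ (*-congˡ difference))) ⟩
    val (invF M) * (κ * κ′ * (α * (q ^ (suc u ℕ.* v′) * ([ k ] * (1# - q))))) * [ suc u ℕ.+ u′ ]
      ≈⟨ solve 8 (λ m c c′ α x k z w → m :* (c :* c′ :* (α :* (x :* (k :* z)))) :* w := k :* (m :* c :* c′ :* x :* z) :* (α :* w)) refl _ _ _ _ _ _ _ _ ⟩
    [ k ] * (val (invF M) * κ * κ′ * q ^ (suc u ℕ.* v′) * (1# - q)) * (α * [ suc u ℕ.+ u′ ])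
      ≈⟨ *-congˡ (residue-val u u′) ⟩
    [ k ] * (val (invF M) * κ * κ′ * q ^ (suc u ℕ.* v′) * (1# - q)) * (- (1# - q) * ([ suc u ] * [ u′ ]))
      ≈⟨ solve 8 (λ k m c c′ x z a b → k :* (m :* c :* c′ :* x :* z) :* ((:- z) :* (a :* b))
           := k :* ((m :* (:- z :* z)) :* ((c :* a) :* (c′ :* b) :* x))) refl _ _ _ _ _ _ _ _ ⟩
    [ k ] * ((val (invF M) * (- (1# - q) * (1# - q))) * ((κ * [ suc u ]) * (κ′ * [ u′ ]) * q ^ (suc u ℕ.* v′)))
      ≈⟨ *-congˡ (*-cong normalisation (trans (*-congʳ (trans (*-cong κ-eq κ′-eq) (sym (^-homo-* q e e′)))) (sym (^-homo-* q (e ℕ.+ e′) (suc u ℕ.* v′))))) ⟩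
    [ k ] * q ^ suc (e ℕ.+ e′ ℕ.+ suc u ℕ.* v′) ∎
    where
    α = residue (suc u) u′
    difference : (q ^ suc u) ^ v′ - (q ^ u′) ^ v ≈ q ^ (suc u ℕ.* v′) * ([ k ] * (1# - q))
    difference = begin
      (q ^ suc u) ^ v′ - (q ^ u′) ^ v
        ≈⟨ +-cong (^-assocʳ q (suc u) v′) (-‿cong (trans (^-assocʳ q u′ v) (trans (reflexive (cong (q ^_) det)) (^-homo-* q (suc u ℕ.* v′) k)))) ⟩
      q ^ (suc u ℕ.* v′) - q ^ (suc u ℕ.* v′) * q ^ k
        ≈⟨ solve 2 (λ a b → a :- a :* b := a :* (con (+ 1) :- b)) refl _ _ ⟩
      q ^ (suc u ℕ.* v′) * (1# - q ^ k)
        ≈⟨ *-congˡ (sym [ k ]-val) ⟩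
      q ^ (suc u ℕ.* v′) * ([ k ] * (1# - q)) ∎
    -- M = (1 - 1/q)(1 - q) = -(1 - q)²/q.
    normalisation : val (invF M) * (- (1# - q) * (1# - q)) ≈ q
    normalisation = begin
      val (invF M) * (- (1# - q) * (1# - q))
        ≈⟨ solve 2 (λ m q → m :* ((:- (con (+ 1) :- q)) :* (con (+ 1) :- q)) := m :* ((q :- con (+ 1)) :* (con (+ 1) :- q))) refl _ _ ⟩
      val (invF M) * ((q - 1#) * (1# - q))
        ≈⟨ *-congˡ (*-congʳ (+-congˡ (-‿cong (sym t*q)))) ⟩
      val (invF M) * ((q - t * q) * (1# - q))
        ≈⟨ solve 3 (λ m q t → m :* ((q :- t :* q) :* (con (+ 1) :- q)) := q :* (m :* ((con (+ 1) :- t) :* (con (+ 1) :- q)))) refl _ _ _ ⟩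
      q * (val (invF M) * ((1# - t) * (1# - q)))
        ≈⟨ *-congˡ (*-congˡ (sym M-val)) ⟩
      q * (val (invF M) * val M)
        ≈⟨ trans (*-congˡ (val-inv M (Mk≉0 0))) (*-identityʳ q) ⟩
      q ∎

  [1]≈1 : [ 1 ] ≈ 1#
  [1]≈1 = cancelˡ _ _ (≈-≉0 (+-congˡ (-‿cong (sym (*-identityʳ q)))) (1-q^≉0 0)) (begin
    (1# - q) * [ 1 ] ≈⟨ trans (*-comm _ _) [ 1 ]-val ⟩
    1# - q * 1# ≈⟨ solve 1 (λ q → con (+ 1) :- q :* con (+ 1) := (con (+ 1) :- q) :* con (+ 1)) refl q ⟩
    (1# - q) * 1# ∎)

addMon-identityʳ : ∀ μ → addMon μ [] ≡ μ
addMon-identityʳ [] = ≡.refl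
addMon-identityʳ (a ∷ μ) = ≡.refl

addMon-comm : ∀ μ ν → addMon μ ν ≡ addMon ν μ
addMon-comm [] ν = ≡.sym (addMon-identityʳ ν)
addMon-comm (a ∷ μ) [] = ≡.refl
addMon-comm (a ∷ μ) (b ∷ ν) = cong₂ _∷_ (ℕₚ.+-comm a b) (addMon-comm μ ν)

addMon-assoc : ∀ μ ν ρ → addMon (addMon μ ν) ρ ≡ addMon μ (addMon ν ρ)
addMon-assoc [] ν ρ = ≡.refl
addMon-assoc (a ∷ μ) [] ρ = ≡.refl
addMon-assoc (a ∷ μ) (b ∷ ν) [] = ≡.refl
addMon-assoc (a ∷ μ) (b ∷ ν) (c ∷ ρ) = cong₂ _∷_ (ℕₚ.+-assoc a b c) (addMon-assoc μ ν ρ)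

-- Two elements of Λ are identified when every K-valued function on raw
-- exponent vectors gives them the same weighted sum; a coefficient with zero
-- denominator contributes 0, which keeps all operations on Λ compatible.

module SymmetricFunctions (K : CommutativeRing 0ℓ 0ℓ) (E : Evaluation K) where
  private module K = CommutativeRing K
  open K using (_≈_; _+_; _*_; 0#; 1#; -_) renaming (Carrier to 𝕂)
  open Evaluation E
  open Solver K
  open SetoidReasoning K.setoid

  pair : Λ → (Mon → 𝕂) → 𝕂
  pair [] φ = 0#
  pair ((c , μ) ∷ F) φ = val c * φ μ + pair F φ

  infix 4 _~_
  record _~_ (F G : Λ) : Set where
    no-eta-equality
    constructor by-pairing
    field pairing : ∀ φ → pair F φ ≈ pair G φ
  open _~_ public

  pair-cong : ∀ F {φ ψ} → (∀ μ → φ μ ≈ ψ μ) → pair F φ ≈ pair F ψ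
  pair-cong [] h = K.refl
  pair-cong ((c , μ) ∷ F) h = K.+-cong (K.*-congˡ (h μ)) (pair-cong F h)

  pair-++ : ∀ F G φ → pair (F ++ G) φ ≈ pair F φ + pair G φ
  pair-++ [] G φ = K.sym (K.+-identityˡ _)
  pair-++ (s ∷ F) G φ = K.trans (K.+-congˡ (pair-++ F G φ)) (K.sym (K.+-assoc _ _ _))

  pair-scale : ∀ c F φ → pair (scaleΛ c F) φ ≈ val c * pair F φ
  pair-scale c [] φ = K.sym (K.zeroʳ _)
  pair-scale c ((d , μ) ∷ F) φ = K.trans (K.+-cong (K.*-congʳ (val-* c d)) (pair-scale c F φ))
    (solve 4 (λ c d x y → c :* d :* x :+ c :* y := c :* (d :* x :+ y)) K.refl _ _ _ _)

  pair-+ : ∀ F φ ψ → pair F (λ μ → φ μ + ψ μ) ≈ pair F φ + pair F ψ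
  pair-+ [] φ ψ = K.sym (K.+-identityˡ _)
  pair-+ ((c , μ) ∷ F) φ ψ = K.trans (K.+-congˡ (pair-+ F φ ψ))
    (solve 5 (λ c a b x y → c :* (a :+ b) :+ (x :+ y) := c :* a :+ x :+ (c :* b :+ y)) K.refl _ _ _ _ _)

  pair-linear : ∀ F a φ → pair F (λ μ → a * φ μ) ≈ a * pair F φ
  pair-linear [] a φ = K.sym (K.zeroʳ a)
  pair-linear ((c , μ) ∷ F) a φ = K.trans (K.+-congˡ (pair-linear F a φ))
    (solve 4 (λ c a x y → c :* (a :* x) :+ a :* y := a :* (c :* x :+ y)) K.refl _ _ _ _)

  pair-0 : ∀ F → pair F (λ _ → 0#) ≈ 0#
  pair-0 [] = K.refl
  pair-0 (_ ∷ F) = K.trans (K.+-cong (K.zeroʳ _) (pair-0 F)) (K.+-identityʳ 0#)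

  -- Interchange of finite sums, from which commutativity of `*Λ` follows.
  pair-swap : ∀ F G (h : Mon → Mon → 𝕂) → pair F (λ μ → pair G (h μ)) ≈ pair G (λ ν → pair F (λ μ → h μ ν))
  pair-swap [] G h = K.sym (pair-0 G)
  pair-swap ((c , μ) ∷ F) G h = K.trans (K.+-cong (K.sym (pair-linear G (val c) (h μ))) (pair-swap F G h))
    (K.sym (pair-+ G (λ ν → val c * h μ ν) (λ ν → pair F (λ μ′ → h μ′ ν))))

  pair-monomial : ∀ c μ G φ → pair (map (λ t → (c *F proj₁ t) , addMon μ (proj₂ t)) G) φ ≈ val c * pair G (λ ν → φ (addMon μ ν))
  pair-monomial c μ [] φ = K.sym (K.zeroʳ _)
  pair-monomial c μ ((d , ν) ∷ G) φ = K.trans (K.+-cong (K.*-congʳ (val-* c d)) (pair-monomial c μ G φ))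
    (solve 4 (λ c d x y → c :* d :* x :+ c :* y := c :* (d :* x :+ y)) K.refl _ _ _ _)

  pair-* : ∀ F G φ → pair (F *Λ G) φ ≈ pair F (λ μ → pair G (λ ν → φ (addMon μ ν)))
  pair-* [] G φ = K.refl
  pair-* ((c , μ) ∷ F) G φ = K.trans (pair-++ (map _ G) _ φ) (K.+-cong (pair-monomial c μ G φ) (pair-* F G φ))

  pair-constant : ∀ c φ → pair (constΛ c) φ ≈ val c * φ []
  pair-constant c φ = K.+-identityʳ _

  pair-constant-* : ∀ c G φ → pair (constΛ c *Λ G) φ ≈ val c * pair G φ
  pair-constant-* c G φ = K.trans (pair-* (constΛ c) G φ) (K.+-identityʳ _)

  ΛRing : CommutativeRing 0ℓ 0ℓ
  ΛRing = makeCommutativeRing {_≈_ = _~_} {_+Λ_} {_*Λ_} {scaleΛ -1F} {0Λ} {constΛ 1F}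
    (record { refl = by-pairing λ φ → K.refl ; sym = λ h → by-pairing λ φ → K.sym (pairing h φ)
            ; trans = λ h k → by-pairing λ φ → K.trans (pairing h φ) (pairing k φ) })
    (λ {F} {F′} {G} {G′} h k → by-pairing λ φ → K.trans (pair-++ F G φ) (K.trans (K.+-cong (pairing h φ) (pairing k φ)) (K.sym (pair-++ F′ G′ φ))))
    (λ F G H → by-pairing λ φ → K.trans (pair-++ (F +Λ G) H φ) (K.trans (K.+-congʳ (pair-++ F G φ)) (K.trans (K.+-assoc _ _ _)
      (K.sym (K.trans (pair-++ F (G +Λ H) φ) (K.+-congˡ (pair-++ G H φ)))))))
    (λ F G → by-pairing λ φ → K.trans (pair-++ F G φ) (K.trans (K.+-comm _ _) (K.sym (pair-++ G F φ))))
    (λ F → by-pairing λ φ → K.refl)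
    (λ {F} {F′} h → by-pairing λ φ → K.trans (pair-scale -1F F φ) (K.trans (K.*-congˡ (pairing h φ)) (K.sym (pair-scale -1F F′ φ))))
    (λ F → by-pairing λ φ → K.trans (pair-++ (scaleΛ -1F F) F φ) (K.trans (K.+-congʳ (K.trans (pair-scale -1F F φ) (K.*-congʳ val-neg1)))
      (solve 1 (λ x → (:- con (+ 1)) :* x :+ x := con (+ 0)) K.refl _)))
    (λ {F} {F′} {G} {G′} h k → by-pairing λ φ → K.trans (pair-* F G φ) (K.trans (pairing h _) (K.trans (pair-cong F′ (λ μ → pairing k _)) (K.sym (pair-* F′ G′ φ)))))
    (λ F G H → by-pairing λ φ → begin
      pair ((F *Λ G) *Λ H) φ
        ≈⟨ K.trans (pair-* (F *Λ G) H φ) (pair-* F G _) ⟩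
      pair F (λ μ → pair G (λ ν → pair H (λ ρ → φ (addMon (addMon μ ν) ρ))))
        ≈⟨ pair-cong F (λ μ → pair-cong G (λ ν → pair-cong H (λ ρ → K.reflexive (cong φ (addMon-assoc μ ν ρ))))) ⟩
      pair F (λ μ → pair G (λ ν → pair H (λ ρ → φ (addMon μ (addMon ν ρ)))))
        ≈⟨ pair-cong F (λ μ → K.sym (pair-* G H (λ ξ → φ (addMon μ ξ)))) ⟩
      pair F (λ μ → pair (G *Λ H) (λ ξ → φ (addMon μ ξ)))
        ≈⟨ K.sym (pair-* F (G *Λ H) φ) ⟩
      pair (F *Λ (G *Λ H)) φ ∎)
    (λ F G → by-pairing λ φ → begin
      pair (F *Λ G) φ ≈⟨ pair-* F G φ ⟩
      pair F (λ μ → pair G (λ ν → φ (addMon μ ν))) ≈⟨ pair-swap F G (λ μ ν → φ (addMon μ ν)) ⟩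
      pair G (λ ν → pair F (λ μ → φ (addMon μ ν))) ≈⟨ pair-cong G (λ ν → pair-cong F (λ μ → K.reflexive (cong φ (addMon-comm μ ν)))) ⟩
      pair G (λ ν → pair F (λ μ → φ (addMon ν μ))) ≈⟨ K.sym (pair-* G F φ) ⟩
      pair (G *Λ F) φ ∎)
    (λ F → by-pairing λ φ → K.trans (pair-constant-* 1F F φ) (K.trans (K.*-congʳ val-1) (K.*-identityˡ _)))
    (λ H F G → by-pairing λ φ → begin
      pair ((F +Λ G) *Λ H) φ ≈⟨ K.trans (pair-* (F +Λ G) H φ) (pair-++ F G _) ⟩
      pair F _ + pair G _ ≈⟨ K.sym (K.+-cong (pair-* F H φ) (pair-* G H φ)) ⟩
      pair (F *Λ H) φ + pair (G *Λ H) φ ≈⟨ K.sym (pair-++ (F *Λ H) (G *Λ H) φ) ⟩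
      pair ((F *Λ H) +Λ (G *Λ H)) φ ∎)

  private module R = CommutativeRing ΛRing
  private module SΛ = Solver ΛRing
  open Powers K using (_^_)
  open Powers ΛRing using () renaming (_^_ to _^Λ_)

  -- Scaling becomes multiplication by an element of `ΛRing`, which puts scalars within reach of the
  -- ring solver.
  η : 𝕂 → Λ
  η a = constΛ (represent a)

  pair-η-* : ∀ a G φ → pair (η a *Λ G) φ ≈ a * pair G φ
  pair-η-* a G φ = K.trans (pair-constant-* (represent a) G φ) (K.*-congʳ (val-represent a))

  pair-η : ∀ a φ → pair (η a) φ ≈ a * φ []
  pair-η a φ = K.trans (pair-constant (represent a) φ) (K.*-congʳ (val-represent a))

  constant~η : ∀ c → constΛ c ~ η (val c)
  constant~η c = by-pairing λ φ → K.trans (pair-constant c φ) (K.sym (pair-η (val c) φ))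

  scale~η : ∀ c F → scaleΛ c F ~ η (val c) *Λ F
  scale~η c F = by-pairing λ φ → K.trans (pair-scale c F φ) (K.sym (pair-η-* (val c) F φ))

  η-cong : ∀ {a b} → a ≈ b → η a ~ η b
  η-cong a≈b = by-pairing λ φ → K.trans (pair-η _ φ) (K.trans (K.*-congʳ a≈b) (K.sym (pair-η _ φ)))

  η-+ : ∀ a b → η (a + b) ~ η a +Λ η b
  η-+ a b = by-pairing λ φ → K.trans (pair-η (a + b) φ) (K.trans (K.distribʳ _ _ _)
    (K.sym (K.trans (pair-++ (η a) (η b) φ) (K.+-cong (pair-η a φ) (pair-η b φ)))))

  η-* : ∀ a b → η (a * b) ~ η a *Λ η b
  η-* a b = by-pairing λ φ → K.trans (pair-η (a * b) φ) (K.trans (K.*-assoc _ _ _)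
    (K.sym (K.trans (pair-η-* a (η b) φ) (K.*-congˡ (pair-η b φ)))))

  η-neg : ∀ a → η (- a) ~ scaleΛ -1F (η a)
  η-neg a = by-pairing λ φ → K.trans (pair-η (- a) φ) (K.trans
    (solve 2 (λ a x → :- a :* x := :- con (+ 1) :* (a :* x)) K.refl _ _)
    (K.sym (K.trans (pair-scale -1F (η a) φ) (K.*-cong val-neg1 (pair-η a φ)))))

  η-1 : η 1# ~ constΛ 1F
  η-1 = R.sym (R.trans (constant~η 1F) (η-cong val-1))

  η-0 : η 0# ~ 0Λ
  η-0 = by-pairing λ φ → K.trans (pair-η 0# φ) (K.zeroˡ _)

  η-^ : ∀ a n → η (a ^ n) ~ η a ^Λ n
  η-^ a zero    = η-1
  η-^ a (suc n) = R.trans (η-* a (a ^ n)) (R.*-congˡ {η a} (η-^ a n))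

  η-· : ∀ n → n SΛ.· constΛ 1F ~ η (n · 1#)
  η-· zero    = R.sym η-0
  η-· (suc n) = R.trans (SΛ.1+· n (constΛ 1F)) (R.trans (R.+-cong (R.sym η-1) (η-· n))
    (R.trans (R.sym (η-+ 1# (n · 1#))) (η-cong (K.sym (1+· n 1#)))))

  Λ-torsionFree : PowerSeries.TorsionFree ΛRing
  Λ-torsionFree n {F} {G} h = by-pairing λ φ → cancelˡ _ _ (suc≉0 n) (begin
    suc n · 1# * pair F φ ≈⟨ K.sym (pair-η-* (suc n · 1#) F φ) ⟩
    pair (η (suc n · 1#) *Λ F) φ ≈⟨ pairing (R.trans (R.*-congʳ (R.sym (η-· (suc n)))) (R.trans h (R.*-congʳ (η-· (suc n))))) φ ⟩
    pair (η (suc n · 1#) *Λ G) φ ≈⟨ pair-η-* (suc n · 1#) G φ ⟩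
    suc n · 1# * pair G φ ∎)

-- The operators D as vertex operators on Λ

-- S = Σ_j S_j w^j acts on sequences by letting w shift the index forward.
act : List Λ → (ℕ → Λ) → ℕ → Λ
act []      g v = 0Λ
act (f ∷ S) g v = (f *Λ g v) +Λ act S g (suc v)

D≡act : ∀ u v F → D u v F ≡ act (shiftPlus u F) (omegaCoeff u) v
D≡act u v F = ≡.trans (cong sumΛ (Listₚ.map-upTo _ (length (shiftPlus u F))))
  (go (shiftPlus u F) v _ (λ j → ≡.refl))
  where
  go : ∀ S v (h : ℕ → Λ) → (∀ j → h j ≡ (lookupL S j *Λ omegaCoeff u (v ℕ.+ j))) → sumΛ (applyUpTo h (length S)) ≡ act S (omegaCoeff u) v
  go [] v h eq = ≡.refl
  go (f ∷ S) v h eq = cong₂ _+Λ_ (≡.trans (eq 0) (cong (λ w → f *Λ omegaCoeff u w) (ℕₚ.+-identityʳ v)))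
    (go S (suc v) (h ∘ suc) (λ j → ≡.trans (eq (suc j)) (cong (λ w → lookupL S j *Λ omegaCoeff u w) (ℕₚ.+-suc v j))))

lookup-addL : ∀ F G n → lookupL (addL F G) n ≡ lookupL F n +Λ lookupL G n
lookup-addL [] G n = ≡.refl
lookup-addL (f ∷ F) [] n = ≡.sym (Listₚ.++-identityʳ _)
lookup-addL (f ∷ F) (g ∷ G) zero = ≡.refl
lookup-addL (f ∷ F) (g ∷ G) (suc n) = lookup-addL F G n

lookup-applyUpTo : ∀ (f : ℕ → Λ) N i → i < N → lookupL (applyUpTo f N) i ≡ f i
lookup-applyUpTo f (suc N) zero _ = ≡.refl
lookup-applyUpTo f (suc N) (suc i) (s≤s i<N) = lookup-applyUpTo (f ∘ suc) N i i<N

omegaSummand : ℕ → ℕ → ℕ → Λ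
omegaSummand u r j = scaleΛ (invF (fromℕF (fact j))) (lookupL (powL (omegaSeries u r) j) r)

omegaCoeff≡sum : ∀ u r → omegaCoeff u r ≡ sumΛ (applyUpTo (omegaSummand u r) (suc r))
omegaCoeff≡sum u r = cong sumΛ (Listₚ.map-upTo (omegaSummand u r) (suc r))

module Operators (K : CommutativeRing 0ℓ 0ℓ) (E : Evaluation K) where
  open SymmetricFunctions K E
  open Scalars K E
  open Evaluation E
  private
    module K = CommutativeRing K
    module R = CommutativeRing ΛRing
    module SK = Solver K
    _·ᴷ_ : ℕ → K.Carrier → K.Carrier
    _·ᴷ_ = SK._·_
  open PowerSeries ΛRing
  open Solver ΛRing
  open Powers K using (_^_)
  open Powers ΛRing using () renaming (_^_ to _^Λ_)
  open Powers seriesRing using () renaming (_^_ to _^ˢ_)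
  open SetoidReasoning R.setoid

  *Λ-congˡ : ∀ F {G G′} → G ~ G′ → (F *Λ G) ~ (F *Λ G′)
  *Λ-congˡ F h = R.*-congˡ {F} h

  *Λ-congʳ : ∀ {F F′} G → F ~ F′ → (F *Λ G) ~ (F′ *Λ G)
  *Λ-congʳ G h = R.*-congʳ {G} h

  act-cong : ∀ S {g g′} → (∀ v → g v ~ g′ v) → ∀ v → act S g v ~ act S g′ v
  act-cong []      h v = R.refl
  act-cong (f ∷ S) h v = R.+-cong (*Λ-congˡ f (h v)) (act-cong S h (suc v))

  act-addL : ∀ S T g v → act (addL S T) g v ~ act S g v +Λ act T g v
  act-addL [] T g v = R.refl
  act-addL (f ∷ S) [] g v = R.sym (R.+-identityʳ _)
  act-addL (f ∷ S) (h ∷ T) g v = begin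
    ((f +Λ h) *Λ g v) +Λ act (addL S T) g (suc v)
      ≈⟨ R.+-cong (R.distribʳ (g v) f h) (act-addL S T g (suc v)) ⟩
    ((f *Λ g v) +Λ (h *Λ g v)) +Λ (act S g (suc v) +Λ act T g (suc v))
      ≈⟨ +-interchange (f *Λ g v) (h *Λ g v) (act S g (suc v)) (act T g (suc v)) ⟩
    act (f ∷ S) g v +Λ act (h ∷ T) g v ∎

  act-map-* : ∀ c S g v → act (map (c *Λ_) S) g v ~ (c *Λ act S g v)
  act-map-* c [] g v = R.sym (R.zeroʳ c)
  act-map-* c (f ∷ S) g v = R.trans (R.+-cong (R.*-assoc c f (g v)) (act-map-* c S g (suc v))) (R.sym (R.distribˡ c (f *Λ g v) (act S g (suc v))))

  act-map-scale : ∀ c S g v → act (map (scaleΛ c) S) g v ~ (η (val c) *Λ act S g v)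
  act-map-scale c [] g v = R.sym (R.zeroʳ (η (val c)))
  act-map-scale c (f ∷ S) g v = R.trans (R.+-cong (R.trans (*Λ-congʳ (g v) (scale~η c f)) (R.*-assoc (η (val c)) f (g v))) (act-map-scale c S g (suc v)))
    (R.sym (R.distribˡ (η (val c)) (f *Λ g v) (act S g (suc v))))

  -- Sequences form a module over polynomials in w, so products act by composition. The substitution
  -- can therefore be studied one factor at a time.
  act-mulL : ∀ S T g v → act (mulL S T) g v ~ act S (act T g) v
  act-mulL [] T g v = R.refl
  act-mulL (f ∷ S) T g v = R.trans (act-addL (map (f *Λ_) T) (0Λ ∷ mulL S T) g v) (R.+-cong (act-map-* f T g v) (act-mulL S T g (suc v)))

  act-suc : ∀ S g v → act S (g ∘ suc) v ≡ act S g (suc v)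
  act-suc [] g v = ≡.refl
  act-suc (f ∷ S) g v = cong ((f *Λ g (suc v)) +Λ_) (act-suc S g (suc v))

  act-+ : ∀ S g h v → act S (λ w → g w +Λ h w) v ~ act S g v +Λ act S h v
  act-+ [] g h v = R.refl
  act-+ (f ∷ S) g h v = R.trans (R.+-cong (R.distribˡ f (g v) (h v)) (act-+ S g h (suc v)))
    (+-interchange (f *Λ g v) (f *Λ h v) (act S g (suc v)) (act S h (suc v)))

  act-linear : ∀ S c g v → act S (λ w → c *Λ g w) v ~ (c *Λ act S g v)
  act-linear [] c g v = R.sym (R.zeroʳ c)
  act-linear (f ∷ S) c g v = R.trans (R.+-congˡ {f *Λ (c *Λ g v)} (act-linear S c g (suc v)))
    (solve 4 (λ f c g h → f :* (c :* g) :+ c :* h := c :* (f :* g :+ h)) R.refl f c (g v) (act S g (suc v)))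

  act-0 : ∀ S v → act S (λ _ → 0Λ) v ~ 0Λ
  act-0 [] v = R.refl
  act-0 (f ∷ S) v = R.+-cong (R.zeroʳ f) (act-0 S (suc v))

  act-swap : ∀ S T g v → act S (act T g) v ~ act T (act S g) v
  act-swap [] T g v = R.sym (act-0 T v)
  act-swap (f ∷ S) T g v = R.sym (R.trans (act-+ T (λ w → f *Λ g w) (λ w → act S g (suc w)) v) (R.+-cong (act-linear T f g v)
    (R.trans (R.reflexive (act-suc T (act S g) v)) (R.sym (act-swap S T g (suc v))))))

  act-one : ∀ g v → act (constΛ 1F ∷ []) g v ~ g v
  act-one g v = R.trans (R.+-identityʳ _) (R.*-identityˡ (g v))

  act-powL-+ : ∀ S a b g v → act (powL S (a ℕ.+ b)) g v ~ act (powL S a) (act (powL S b) g) v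
  act-powL-+ S zero b g v = R.sym (act-one (act (powL S b) g) v)
  act-powL-+ S (suc a) b g v = begin
    act (mulL S (powL S (a ℕ.+ b))) g v ≈⟨ act-mulL S (powL S (a ℕ.+ b)) g v ⟩
    act S (act (powL S (a ℕ.+ b)) g) v ≈⟨ act-cong S (act-powL-+ S a b g) v ⟩
    act S (act (powL S a) (act (powL S b) g)) v ≈⟨ R.sym (act-mulL S (powL S a) (act (powL S b) g) v) ⟩
    act (powL S (suc a)) (act (powL S b) g) v ∎

  -- The substitution is multiplicative; the factors belonging to the same power sum are brought
  -- together by commuting actions.
  act-addMon : ∀ u i μ ν g v → act (substMon u i (addMon μ ν)) g v ~ act (substMon u i μ) (act (substMon u i ν) g) v
  act-addMon u i [] ν g v = R.sym (act-one (act (substMon u i ν) g) v)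
  act-addMon u i (a ∷ μ) [] g v = act-cong (substMon u i (a ∷ μ)) (λ w → R.sym (act-one g w)) v
  act-addMon u i (a ∷ μ) (b ∷ ν) g v = begin
    act (mulL (powL X (a ℕ.+ b)) (substMon u (suc i) (addMon μ ν))) g v
      ≈⟨ act-mulL (powL X (a ℕ.+ b)) (substMon u (suc i) (addMon μ ν)) g v ⟩
    act (powL X (a ℕ.+ b)) (act (substMon u (suc i) (addMon μ ν)) g) v
      ≈⟨ act-cong (powL X (a ℕ.+ b)) (act-addMon u (suc i) μ ν g) v ⟩
    act (powL X (a ℕ.+ b)) (act (substMon u (suc i) μ) (act (substMon u (suc i) ν) g)) v
      ≈⟨ act-powL-+ X a b (act (substMon u (suc i) μ) (act (substMon u (suc i) ν) g)) v ⟩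
    act (powL X a) (act (powL X b) (act (substMon u (suc i) μ) (act (substMon u (suc i) ν) g))) v
      ≈⟨ act-cong (powL X a) (act-swap (powL X b) (substMon u (suc i) μ) (act (substMon u (suc i) ν) g)) v ⟩
    act (powL X a) (act (substMon u (suc i) μ) (act (powL X b) (act (substMon u (suc i) ν) g))) v
      ≈⟨ act-cong (powL X a) (act-cong (substMon u (suc i) μ) (λ w → R.sym (act-mulL (powL X b) (substMon u (suc i) ν) g w))) v ⟩
    act (powL X a) (act (substMon u (suc i) μ) (act (substMon u i (b ∷ ν)) g)) v
      ≈⟨ R.sym (act-mulL (powL X a) (substMon u (suc i) μ) (act (substMon u i (b ∷ ν)) g) v) ⟩
    act (substMon u i (a ∷ μ)) (act (substMon u i (b ∷ ν)) g) v ∎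
    where
    X : List Λ
    X = substVar u i

  act-unit : ∀ u i k g v → act (substMon u i (replicate k 0 ++ 1 ∷ [])) g v ~ act (substVar u (i ℕ.+ k)) g v
  act-unit u i zero g v = begin
    act (mulL (powL X 1) (constΛ 1F ∷ [])) g v ≈⟨ act-mulL (powL X 1) (constΛ 1F ∷ []) g v ⟩
    act (powL X 1) (act (constΛ 1F ∷ []) g) v ≈⟨ act-mulL X (constΛ 1F ∷ []) (act (constΛ 1F ∷ []) g) v ⟩
    act X (act (constΛ 1F ∷ []) (act (constΛ 1F ∷ []) g)) v ≈⟨ act-cong X (λ w → R.trans (act-one (act (constΛ 1F ∷ []) g) w) (act-one g w)) v ⟩
    act X g v ≈⟨ R.reflexive (cong (λ j → act (substVar u j) g v) (≡.sym (ℕₚ.+-identityʳ i))) ⟩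
    act (substVar u (i ℕ.+ 0)) g v ∎
    where
    X : List Λ
    X = substVar u i
  act-unit u i (suc k) g v = begin
    act (mulL (constΛ 1F ∷ []) (substMon u (suc i) (replicate k 0 ++ 1 ∷ []))) g v
      ≈⟨ R.trans (act-mulL (constΛ 1F ∷ []) (substMon u (suc i) (replicate k 0 ++ 1 ∷ [])) g v) (act-one (act (substMon u (suc i) (replicate k 0 ++ 1 ∷ [])) g) v) ⟩
    act (substMon u (suc i) (replicate k 0 ++ 1 ∷ [])) g v
      ≈⟨ act-unit u (suc i) k g v ⟩
    act (substVar u (suc i ℕ.+ k)) g v
      ≈⟨ R.reflexive (cong (λ j → act (substVar u j) g v) (≡.sym (ℕₚ.+-suc i k))) ⟩
    act (substVar u (i ℕ.+ suc k)) g v ∎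

  act-replicate : ∀ k c g v → act (replicate k 0Λ ++ c ∷ []) g v ~ (c *Λ g (v ℕ.+ k))
  act-replicate zero c g v = R.trans (R.+-identityʳ _) (R.reflexive (cong (λ w → c *Λ g w) (≡.sym (ℕₚ.+-identityʳ v))))
  act-replicate (suc k) c g v = R.trans (act-replicate k c g (suc v)) (R.reflexive (cong (λ w → c *Λ g w) (≡.sym (ℕₚ.+-suc v k))))

  act-substVar : ∀ u k g v → act (substVar u (suc k)) g v ~ (pΛ (suc k) *Λ g v) +Λ (η (charge u k) *Λ g (v ℕ.+ suc k))
  act-substVar u k g v = R.+-congˡ {pΛ (suc k) *Λ g v} (R.trans (act-replicate k (constΛ c) g (suc v))
    (R.trans (*Λ-congʳ (g (suc v ℕ.+ k)) (constant~η c)) (R.reflexive (cong (λ w → η (charge u k) *Λ g w) (≡.sym (ℕₚ.+-suc v k))))))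
    where
    c : Frac
    c = Mk (suc k) *F bq (suc k) u

  act-shiftPlus : ∀ u F g v φ → pair (act (shiftPlus u F) g v) φ K.≈ pair F (λ μ → pair (act (substMon u 1 μ) g v) φ)
  act-shiftPlus u [] g v φ = K.refl
  act-shiftPlus u ((c , μ) ∷ F) g v φ = K.trans (pairing (act-addL (map (scaleΛ c) (substMon u 1 μ)) (shiftPlus u F) g v) φ)
    (K.trans (pair-++ (act (map (scaleΛ c) (substMon u 1 μ)) g v) (act (shiftPlus u F) g v) φ)
      (K.+-cong (K.trans (pairing (act-map-scale c (substMon u 1 μ) g v) φ) (pair-η-* (val c) (act (substMon u 1 μ) g v) φ)) (act-shiftPlus u F g v φ)))

  -- Pairing D F with φ amounts to pairing F with a function of raw exponent vectors. As `~` tests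
  -- all such functions, congruence and linearity of D follow at once.
  D-pair : ∀ u v F φ → pair (D u v F) φ K.≈ pair F (λ μ → pair (act (substMon u 1 μ) (omegaCoeff u) v) φ)
  D-pair u v F φ = K.trans (K.reflexive (cong (λ G → pair G φ) (D≡act u v F))) (act-shiftPlus u F (omegaCoeff u) v φ)

  D-cong : ∀ u v {F G} → F ~ G → D u v F ~ D u v G
  D-cong u v {F} {G} h = by-pairing λ φ → K.trans (D-pair u v F φ) (K.trans (pairing h (λ μ → pair (act (substMon u 1 μ) (omegaCoeff u) v) φ)) (K.sym (D-pair u v G φ)))

  D-+ : ∀ u v F G → D u v (F +Λ G) ~ D u v F +Λ D u v G
  D-+ u v F G = by-pairing λ φ → K.trans (D-pair u v (F +Λ G) φ) (K.trans (pair-++ F G (λ μ → pair (act (substMon u 1 μ) (omegaCoeff u) v) φ))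
    (K.sym (K.trans (pair-++ (D u v F) (D u v G) φ) (K.+-cong (D-pair u v F φ) (D-pair u v G φ)))))

  D-η : ∀ u v a F → D u v (η a *Λ F) ~ (η a *Λ D u v F)
  D-η u v a F = by-pairing λ φ → K.trans (D-pair u v (η a *Λ F) φ) (K.trans (pair-η-* a F (λ μ → pair (act (substMon u 1 μ) (omegaCoeff u) v) φ))
    (K.sym (K.trans (pair-η-* a (D u v F) φ) (K.*-congˡ (D-pair u v F φ)))))

  D-monomial : ∀ u v c μ F → D u v ((c , μ) ∷ F) ~ (η (val c) *Λ act (substMon u 1 μ) (omegaCoeff u) v) +Λ D u v F
  D-monomial u v c μ F = by-pairing λ φ → K.trans (D-pair u v ((c , μ) ∷ F) φ) (K.sym
    (K.trans (pair-++ (η (val c) *Λ act (substMon u 1 μ) (omegaCoeff u) v) (D u v F) φ) (K.+-cong (pair-η-* (val c) (act (substMon u 1 μ) (omegaCoeff u) v) φ) (D-pair u v F φ))))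

  pair-p : ∀ k F φ → pair (pΛ (suc k) *Λ F) φ K.≈ pair F (λ μ → φ (addMon (replicate k 0 ++ 1 ∷ []) μ))
  pair-p k F φ = K.trans (pair-* (pΛ (suc k)) F φ) (K.trans (K.+-identityʳ _) (K.trans (K.*-congʳ val-1) (K.*-identityˡ _)))

  -- Multiplication by p_{k+1} adds a unit exponent vector, and the substitution sends p_{k+1} to
  -- p_{k+1} + p_{k+1}[M[u]_q] w^{k+1}, whose second term shifts v.
  D-p : ∀ u v k F → D u v (pΛ (suc k) *Λ F) ~ (pΛ (suc k) *Λ D u v F) +Λ (η (charge u k) *Λ D u (v ℕ.+ suc k) F)
  D-p u v k F = by-pairing λ φ → K.trans (D-pair u v (pΛ (suc k) *Λ F) φ) (K.trans (pair-p k F (λ μ → pair (X μ v) φ)) (K.trans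
    (pair-cong F λ μ → K.trans (pairing (R.trans (act-addMon u 1 pₖ μ ω v) (R.trans (act-unit u 1 k (X μ) v) (act-substVar u k (X μ) v))) φ)
      (pair-raise (X μ v) (X μ (v ℕ.+ suc k)) φ))
    (K.trans (pair-+ F (λ μ → pair (X μ v) (φ ∘ addMon pₖ)) (λ μ → charge u k K.* pair (X μ (v ℕ.+ suc k)) φ))
    (K.trans (K.+-cong (K.sym (D-pair u v F (φ ∘ addMon pₖ)))
      (K.trans (pair-linear F (charge u k) (λ μ → pair (X μ (v ℕ.+ suc k)) φ)) (K.*-congˡ (K.sym (D-pair u (v ℕ.+ suc k) F φ)))))
      (K.sym (pair-raise (D u v F) (D u (v ℕ.+ suc k) F) φ))))))
    where
    pₖ : Mon
    pₖ = replicate k 0 ++ 1 ∷ []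
    ω : ℕ → Λ
    ω = omegaCoeff u
    X : Mon → ℕ → Λ
    X μ = act (substMon u 1 μ) ω
    pair-raise : ∀ G H φ → pair ((pΛ (suc k) *Λ G) +Λ (η (charge u k) *Λ H)) φ K.≈ pair G (φ ∘ addMon pₖ) K.+ charge u k K.* pair H φ
    pair-raise G H φ = K.trans (pair-++ (pΛ (suc k) *Λ G) (η (charge u k) *Λ H) φ) (K.+-cong (pair-p k G φ) (pair-η-* (charge u k) H φ))

  D-1 : ∀ u v → D u v (constΛ 1F) ~ omegaCoeff u v
  D-1 u v = R.trans (D-monomial u v 1F [] []) (R.trans (R.+-identityʳ _) (R.trans (*Λ-congʳ (act (constΛ 1F ∷ []) (omegaCoeff u) v) (R.trans (η-cong val-1) η-1))
    (R.trans (R.*-identityˡ (act (constΛ 1F ∷ []) (omegaCoeff u) v)) (act-one (omegaCoeff u) v))))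

  lookup-map-* : ∀ f G n → lookupL (map (f *Λ_) G) n ~ (f *Λ lookupL G n)
  lookup-map-* f [] n = R.sym (R.zeroʳ f)
  lookup-map-* f (g ∷ G) zero = R.refl
  lookup-map-* f (g ∷ G) (suc n) = lookup-map-* f G n

  lookup-mulL : ∀ F G n → lookupL (mulL F G) n ~ (lookupL F ⊛ lookupL G) n
  lookup-mulL [] G n = R.sym (⊛-zeroˡ (lookupL G) n)
  lookup-mulL (f ∷ F) G zero = R.trans (R.reflexive (lookup-addL (map (f *Λ_) G) (0Λ ∷ mulL F G) 0))
    (R.trans (R.+-identityʳ _) (lookup-map-* f G 0))
  lookup-mulL (f ∷ F) G (suc n) = R.trans (R.reflexive (lookup-addL (map (f *Λ_) G) (0Λ ∷ mulL F G) (suc n)))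
    (R.+-cong (lookup-map-* f G (suc n)) (lookup-mulL F G n))

  -- Agreement up to N suffices, so the truncated list in `omegaCoeff` computes the true powers.
  lookup-powL : ∀ N S {s : Series} → (∀ i → i ≤ N → lookupL S i ~ s i) → ∀ j n → n ≤ N → lookupL (powL S j) n ~ (s ^ˢ j) n
  lookup-powL N S h zero zero _ = R.refl
  lookup-powL N S h zero (suc n) _ = R.refl
  lookup-powL N S h (suc j) n n≤N = R.trans (lookup-mulL S (powL S j) n)
    (⊛-cong-≤ n (λ i i≤n → h i (ℕₚ.≤-trans i≤n n≤N)) (λ i i≤n → lookup-powL N S h j i (ℕₚ.≤-trans i≤n n≤N)))

  -- The full series of which `omegaSeries` is a truncation.
  exponent : ℕ → Series
  exponent u zero    = 0Λ
  exponent u (suc k) = scaleΛ (divF (-F bt (suc k) u) (fromℕF (suc k))) (pΛ (suc k))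

  lookup-omegaSeries : ∀ u N i → i ≤ N → lookupL (omegaSeries u N) i ~ exponent u i
  lookup-omegaSeries u N zero _ = R.refl
  lookup-omegaSeries u N (suc i) i<N = R.reflexive (≡.trans
    (cong (λ S → lookupL S i) (Listₚ.map-upTo (exponent u ∘ suc) N)) (lookup-applyUpTo (exponent u ∘ suc) N i i<N))

  1/fact : ℕ → K.Carrier
  1/fact j = val (invF (fromℕF (fact j)))

  1/fact-inverse : ∀ j → 1/fact j K.* (fact j ·ᴷ K.1#) K.≈ K.1#
  1/fact-inverse j = K.trans (K.*-congˡ (K.sym (val-ℕ (fact j)))) (val-inv (fromℕF (fact j)) (≈-≉0 (val-ℕ (fact j)) (fact≉0 j)))

  1/fact-suc : ∀ j → suc j ·ᴷ K.1# K.* 1/fact (suc j) K.≈ 1/fact j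
  1/fact-suc j = cancelˡ _ _ (fact≉0 j) (K.trans
    (SK.solve 3 (λ f s i → f SK.:* (s SK.:* i) SK.:= i SK.:* (s SK.:* f)) K.refl (fact j ·ᴷ K.1#) (suc j ·ᴷ K.1#) (1/fact (suc j)))
    (K.trans (K.*-congˡ (K.sym (SK.×1-homo-* (suc j) (fact j)))) (K.trans (1/fact-inverse (suc j))
      (K.sym (K.trans (K.*-comm _ _) (1/fact-inverse j))))))

  1/factΛ-suc : ∀ j → ((suc j · constΛ 1F) *Λ η (1/fact (suc j))) ~ η (1/fact j)
  1/factΛ-suc j = R.trans (*Λ-congʳ (η (1/fact (suc j))) (η-· (suc j))) (R.trans (R.sym (η-* (suc j ·ᴷ K.1#) (1/fact (suc j)))) (η-cong (1/fact-suc j)))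

  module Exp-Ω (u : ℕ) = Exponential (exponent u) R.refl (η ∘ 1/fact) 1/factΛ-suc

  sumΛ~sumTo : ∀ N (f : ℕ → Λ) → sumΛ (applyUpTo f N) ~ sumTo N f
  sumΛ~sumTo zero    f = R.refl
  sumΛ~sumTo (suc N) f = R.+-congˡ {f 0} (sumΛ~sumTo N (f ∘ suc))

  summand : ∀ u r j → omegaSummand u r j ~ (η (1/fact j) *Λ (exponent u ^ˢ j) r)
  summand u r j = R.trans (scale~η (invF (fromℕF (fact j))) (lookupL (powL (omegaSeries u r) j) r))
    (*Λ-congˡ (η (1/fact j)) (lookup-powL r (omegaSeries u r) (lookup-omegaSeries u r) j r ℕₚ.≤-refl))

  omegaCoeff~exp : ∀ u r → omegaCoeff u r ~ Exp-Ω.exp u r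
  omegaCoeff~exp u r = R.trans (R.reflexive (omegaCoeff≡sum u r)) (R.trans (sumΛ~sumTo (suc r) (omegaSummand u r))
    (Exp-Ω.exp-sum u r (omegaSummand u r) (summand u r)))

  open VertexOperators ΛRing Λ-torsionFree pΛ (λ c → ∃ λ a → c ~ η a) public

  -- θ cancels the 1/k of the exponent and leaves the Newton terms.
  θ-exponent : ∀ u → θ (exponent u) ≋ newton (η ∘ coupling u)
  θ-exponent u zero = R.zeroʳ 0Λ
  θ-exponent u (suc k) = begin
    (suc k · constΛ 1F) *Λ scaleΛ c (pΛ (suc k))
      ≈⟨ R.*-cong (η-· (suc k)) (scale~η c (pΛ (suc k))) ⟩
    η (suc k ·ᴷ K.1#) *Λ (η (val c) *Λ pΛ (suc k))
      ≈⟨ R.sym (R.*-assoc (η (suc k ·ᴷ K.1#)) (η (val c)) (pΛ (suc k))) ⟩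
    (η (suc k ·ᴷ K.1#) *Λ η (val c)) *Λ pΛ (suc k)
      ≈⟨ *Λ-congʳ (pΛ (suc k)) (R.trans (R.sym (η-* (suc k ·ᴷ K.1#) (val c))) (R.trans (η-cong value) (η-neg (coupling u k)))) ⟩
    scaleΛ -1F (η (coupling u k)) *Λ pΛ (suc k)
      ≈⟨ solve 2 (λ b p → :- b :* p := :- (b :* p)) R.refl (η (coupling u k)) (pΛ (suc k)) ⟩
    newton (η ∘ coupling u) (suc k) ∎
    where
    c : Frac
    c = divF (-F bt (suc k) u) (fromℕF (suc k))
    value : (suc k ·ᴷ K.1#) K.* val c K.≈ K.- coupling u k
    value = K.trans (K.*-comm _ _) (K.trans (K.*-congˡ (K.sym (val-ℕ (suc k)))) (K.trans (val-divF (-F bt (suc k) u) (fromℕF (suc k)) (ℕ≉0 k))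
      (K.trans (val-* -1F (bt (suc k) u)) (K.trans (K.*-congʳ val-neg1)
        (SK.solve 1 (λ x → SK.:- SK.con (+ 1) SK.:* x SK.:= SK.:- x) K.refl (coupling u k))))))

  omega-0 : ∀ u → omegaCoeff u 0 ~ constΛ 1F
  omega-0 u = R.trans (omegaCoeff~exp u 0) (R.trans (Exp-Ω.exp-0 u) (R.trans (η-cong 1/0!) η-1))
    where
    1/0! : 1/fact 0 K.≈ K.1#
    1/0! = K.trans (K.sym (K.*-identityʳ _)) (1/fact-inverse 0)

  D-operator : ℕ → VertexOperator
  D-operator u = record
    { op = D u ; a = η ∘ charge u ; b = η ∘ coupling u ; ω = omegaCoeff u
    ; op-cong = D-cong u
    ; op-+ = D-+ u
    ; op-scalar = λ { v {c} (a , c~ηa) F → R.trans (D-cong u v (*Λ-congʳ F c~ηa)) (R.trans (D-η u v a F) (*Λ-congʳ (D u v F) (R.sym c~ηa))) }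
    ; op-p = D-p u
    ; op-1 = D-1 u
    ; a-scalar = λ k → _ , R.refl
    ; b-scalar = λ k → _ , R.refl
    ; ω-LogDer = LogDer-cong {Exp-Ω.exp u} {omegaCoeff u} {θ (exponent u)} (λ n → R.sym (omegaCoeff~exp u n)) (θ-exponent u) (Exp-Ω.LogDer-exp u)
    ; ω-0 = omega-0 u }

  η-sub : ∀ a b → η (a K.- b) ~ (η a -Λ η b)
  η-sub a b = R.trans (η-+ a (K.- b)) (R.+-congˡ {η a} (η-neg b))

  η-1- : ∀ a → η (K.1# K.- a) ~ (constΛ 1F -Λ η a)
  η-1- a = R.trans (η-sub K.1# a) (R.+-congʳ η-1)

  η-1-^ : ∀ a k → η (K.1# K.- a ^ k) ~ (constΛ 1F -Λ (η a ^Λ k))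
  η-1-^ a k = R.trans (η-1- (a ^ k)) (R.+-congˡ {constΛ 1F} (R.-‿cong (η-^ a k)))

  η-*-cong : ∀ a b {F G} → η a ~ F → η b ~ G → η (a K.* b) ~ (F *Λ G)
  η-*-cong a b {F} {G} h k = R.trans (η-* a b) (R.*-cong {η a} {F} {η b} {G} h k)

  module _ (u₀ u₀′ : ℕ) where
    private
      u u′ : ℕ
      u = suc u₀
      u′ = suc u₀′

      inverse : ∀ u → (η (t ^ u) *Λ η (q ^ u)) ~ constΛ 1F
      inverse u = R.trans (R.sym (η-* (t ^ u) (q ^ u))) (R.trans (η-cong (t^*q^ u)) η-1)
      inverse′ : ∀ u → (η (q ^ u) *Λ η (t ^ u)) ~ constΛ 1F
      inverse′ u = R.trans (R.*-comm (η (q ^ u)) (η (t ^ u))) (inverse u)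
      α-eq : (η (residue u u′) *Λ (η (q ^ u) -Λ η (t ^ u′))) ~ ((η (q ^ u) -Λ constΛ 1F) *Λ (constΛ 1F -Λ η (t ^ u′)))
      α-eq = R.trans (R.sym (η-*-cong (residue u u′) (q ^ u K.- t ^ u′) R.refl (η-sub (q ^ u) (t ^ u′))))
        (R.trans (η-cong (residue-eq u₀ u′))
          (η-*-cong (q ^ u K.- K.1#) (K.1# K.- t ^ u′) (R.trans (η-sub (q ^ u) K.1#) (R.+-congˡ {η (q ^ u)} (R.-‿cong η-1))) (η-1- (t ^ u′))))
      contractionΛ : ∀ u u′ k → (η (coupling u′ k) *Λ η (charge u k)) ~
        ((constΛ 1F -Λ (η (q ^ u) ^Λ suc k)) *Λ (constΛ 1F -Λ (η (t ^ u′) ^Λ suc k)))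
      contractionΛ u u′ k = R.trans (R.sym (η-* (coupling u′ k) (charge u k))) (R.trans (η-cong (contraction u u′ k))
        (η-*-cong (K.1# K.- (q ^ u) ^ suc k) (K.1# K.- (t ^ u′) ^ suc k) (η-1-^ (q ^ u) (suc k)) (η-1-^ (t ^ u′) (suc k))))

    compatible : Compatible (D-operator u) (D-operator u′) (D-operator (u ℕ.+ u′))
    compatible = record
      { x = η (q ^ u) ; x⁻¹ = η (t ^ u) ; y = η (t ^ u′) ; y⁻¹ = η (q ^ u′) ; α = η (residue u u′)
      ; x-inverse = inverse u ; y-inverse = inverse′ u′ ; α-eq = α-eq
      ; contraction = contractionΛ u u′ ; contraction′ = contractionΛ u′ u
      ; a-sum = λ k → R.trans (R.+-congˡ {η (charge u k)} (R.sym (η-*-cong (charge u′ k) ((q ^ u) ^ suc k) R.refl (η-^ (q ^ u) (suc k)))))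
          (R.trans (R.sym (η-+ (charge u k) _)) (η-cong (charge-sum u u′ k)))
      ; a-sum′ = λ k → R.trans (R.+-congʳ {η (charge u′ k)} (R.sym (η-*-cong (charge u k) ((q ^ u′) ^ suc k) R.refl (η-^ (q ^ u′) (suc k)))))
          (R.trans (R.sym (η-+ _ (charge u′ k))) (η-cong (charge-sum′ u u′ k)))
      ; b-sum = λ k → R.trans (R.+-congʳ {η (coupling u′ k)} (R.sym (η-*-cong ((t ^ u′) ^ suc k) (coupling u k) (η-^ (t ^ u′) (suc k)) R.refl)))
          (R.trans (R.sym (η-+ _ (coupling u′ k))) (η-cong (coupling-sum u u′ k)))
      ; b-sum′ = λ k → R.trans (R.+-congʳ {η (coupling u′ k)} (R.sym (η-*-cong ((q ^ u) ^ suc k) (coupling u k) (η-^ (q ^ u) (suc k)) R.refl)))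
          (R.trans (R.sym (η-+ _ (coupling u′ k))) (R.trans (η-cong (coupling-sum′ u u′ k))
            (η-*-cong ((q ^ u) ^ suc k) (coupling (u ℕ.+ u′) k) (η-^ (q ^ u) (suc k)) R.refl))) }

    module C = Commutator (D-operator u) (D-operator u′) (D-operator (u ℕ.+ u′)) compatible

    commutes-cong : ∀ {g g₁ g′ g₁′ g″ g₁″} → (∀ v → g v ~ g₁ v) → (∀ v → g′ v ~ g₁′ v) → (∀ v → g″ v ~ g₁″ v) →
      C.Commutes g₁ g₁′ g₁″ → C.Commutes g g′ g″
    commutes-cong h h′ h″ c v w = R.trans (R.+-cong (D-cong u v (h′ w)) (R.-‿cong (D-cong u′ w (h v))))
      (R.trans (c v w) (*Λ-congˡ (C.coefficient v w) (R.sym (h″ (v ℕ.+ w)))))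

    commutes-powL : ∀ i e {g g′ g″} → C.Commutes g g′ g″ →
      C.Commutes (act (powL (substVar u (suc i)) e) g) (act (powL (substVar u′ (suc i)) e) g′) (act (powL (substVar (u ℕ.+ u′) (suc i)) e) g″)
    commutes-powL i zero {g} {g′} {g″} c = commutes-cong (act-one g) (act-one g′) (act-one g″) c
    commutes-powL i (suc e) {g} {g′} {g″} c = commutes-cong (unfold u g) (unfold u′ g′) (unfold (u ℕ.+ u′) g″)
      (C.commutes-raise i {act (powL (substVar u (suc i)) e) g} {act (powL (substVar u′ (suc i)) e) g′} {act (powL (substVar (u ℕ.+ u′) (suc i)) e) g″}
        (commutes-powL i e c))
      where
      unfold : ∀ u g v → act (powL (substVar u (suc i)) (suc e)) g v ~ C.raise (η ∘ charge u) i (act (powL (substVar u (suc i)) e) g) v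
      unfold u g v = R.trans (act-mulL (substVar u (suc i)) (powL (substVar u (suc i)) e) g v) (act-substVar u i (act (powL (substVar u (suc i)) e) g) v)

    -- A monomial arises from 1 by successive multiplication with power sums, each of which
    -- preserves the relation.
    commutes-substMon : ∀ i μ {g g′ g″} → C.Commutes g g′ g″ →
      C.Commutes (act (substMon u (suc i) μ) g) (act (substMon u′ (suc i) μ) g′) (act (substMon (u ℕ.+ u′) (suc i) μ) g″)
    commutes-substMon i [] {g} {g′} {g″} c = commutes-cong (act-one g) (act-one g′) (act-one g″) c
    commutes-substMon i (e ∷ μ) {g} {g′} {g″} c = commutes-cong (unfold u g) (unfold u′ g′) (unfold (u ℕ.+ u′) g″)
      (commutes-powL i e (commutes-substMon (suc i) μ c))
      where
      unfold : ∀ u g v → act (substMon u (suc i) (e ∷ μ)) g v ~ act (powL (substVar u (suc i)) e) (act (substMon u (suc (suc i)) μ) g) v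
      unfold u g v = act-mulL (powL (substVar u (suc i)) e) (substMon u (suc (suc i)) μ) g v

    -- Linear extension from monomials, each of which is reached from `commutes-ω`.
    D-commutator : ∀ v w F → ⟦ D u v , D u′ w ⟧ F ~ (C.coefficient v w *Λ D (u ℕ.+ u′) (v ℕ.+ w) F)
    D-commutator v w [] = R.sym (R.zeroʳ (C.coefficient v w))
    D-commutator v w ((c , μ) ∷ F) = begin
      D u v (D u′ w ((c , μ) ∷ F)) -Λ D u′ w (D u v ((c , μ) ∷ F))
        ≈⟨ R.+-cong (expand u v (D u′ w ((c , μ) ∷ F)) (m u′ w) (D u′ w F) (D-monomial u′ w c μ F)) (R.-‿cong (expand u′ w (D u v ((c , μ) ∷ F)) (m u v) (D u v F) (D-monomial u v c μ F))) ⟩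
      ((η (val c) *Λ D u v (m u′ w)) +Λ D u v (D u′ w F)) -Λ ((η (val c) *Λ D u′ w (m u v)) +Λ D u′ w (D u v F))
        ≈⟨ solve 5 (λ c a b a′ b′ → (c :* a :+ b) :- (c :* a′ :+ b′) := c :* (a :- a′) :+ (b :- b′)) R.refl
             (η (val c)) (D u v (m u′ w)) (D u v (D u′ w F)) (D u′ w (m u v)) (D u′ w (D u v F)) ⟩
      (η (val c) *Λ (D u v (m u′ w) -Λ D u′ w (m u v))) +Λ (D u v (D u′ w F) -Λ D u′ w (D u v F))
        ≈⟨ R.+-cong (*Λ-congˡ (η (val c)) (commutes-substMon 0 μ C.commutes-ω v w)) (D-commutator v w F) ⟩
      (η (val c) *Λ (C.coefficient v w *Λ m (u ℕ.+ u′) (v ℕ.+ w))) +Λ (C.coefficient v w *Λ D (u ℕ.+ u′) (v ℕ.+ w) F)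
        ≈⟨ solve 4 (λ c k a b → c :* (k :* a) :+ k :* b := k :* (c :* a :+ b)) R.refl
             (η (val c)) (C.coefficient v w) (m (u ℕ.+ u′) (v ℕ.+ w)) (D (u ℕ.+ u′) (v ℕ.+ w) F) ⟩
      C.coefficient v w *Λ ((η (val c) *Λ m (u ℕ.+ u′) (v ℕ.+ w)) +Λ D (u ℕ.+ u′) (v ℕ.+ w) F)
        ≈⟨ *Λ-congˡ (C.coefficient v w) (R.sym (D-monomial (u ℕ.+ u′) (v ℕ.+ w) c μ F)) ⟩
      C.coefficient v w *Λ D (u ℕ.+ u′) (v ℕ.+ w) ((c , μ) ∷ F) ∎
      where
      m : ℕ → ℕ → Λ
      m u v = act (substMon u 1 μ) (omegaCoeff u) v
      expand : ∀ u v G X Y → G ~ ((η (val c) *Λ X) +Λ Y) → D u v G ~ ((η (val c) *Λ D u v X) +Λ D u v Y)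
      expand u v G X Y h = R.trans (D-cong u v h) (R.trans (D-+ u v (η (val c) *Λ X) Y) (R.+-congʳ (D-η u v (val c) X)))

  MultipleOfD : Op → ℕ → ℕ → K.Carrier → Set
  MultipleOfD A u v κ = ∀ F → A F ~ (η κ *Λ D u v F)

  multiple-step : ∀ {A A′} u v u′ v′ {κ κ′} → MultipleOfD A (suc u) v κ → MultipleOfD A′ (suc u′) v′ κ′ →
    MultipleOfD (invF M • ⟦ A , A′ ⟧) (suc u ℕ.+ suc u′) (v ℕ.+ v′)
      (val (invF M) K.* (κ K.* κ′ K.* (residue (suc u) (suc u′) K.* ((q ^ suc u) ^ v′ K.- (q ^ suc u′) ^ v))))
  multiple-step {A} {A′} u v u′ v′ {κ} {κ′} h h′ F = begin
    scaleΛ (invF M) (A (A′ F) -Λ A′ (A F))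
      ≈⟨ scale~η (invF M) (A (A′ F) -Λ A′ (A F)) ⟩
    η m *Λ (A (A′ F) -Λ A′ (A F))
      ≈⟨ *Λ-congˡ (η m) (R.+-cong
           (expand (suc u) v (A (A′ F)) (A′ F) (D (suc u′) v′ F) κ κ′ (h (A′ F)) (h′ F))
           (R.-‿cong (expand (suc u′) v′ (A′ (A F)) (A F) (D (suc u) v F) κ′ κ (h′ (A F)) (h F)))) ⟩
    η m *Λ ((η κ *Λ (η κ′ *Λ D (suc u) v (D (suc u′) v′ F))) -Λ (η κ′ *Λ (η κ *Λ D (suc u′) v′ (D (suc u) v F))))
      ≈⟨ solve 5 (λ m k k′ a b → m :* (k :* (k′ :* a) :- k′ :* (k :* b)) := m :* (k :* k′ :* (a :- b))) R.refl
           (η m) (η κ) (η κ′) (D (suc u) v (D (suc u′) v′ F)) (D (suc u′) v′ (D (suc u) v F)) ⟩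
    η m *Λ ((η κ *Λ η κ′) *Λ ⟦ D (suc u) v , D (suc u′) v′ ⟧ F)
      ≈⟨ *Λ-congˡ (η m) (*Λ-congˡ (η κ *Λ η κ′) (D-commutator u u′ v v′ F)) ⟩
    η m *Λ ((η κ *Λ η κ′) *Λ (c *Λ G))
      ≈⟨ solve 5 (λ m k k′ c g → m :* (k :* k′ :* (c :* g)) := m :* (k :* k′ :* c) :* g) R.refl (η m) (η κ) (η κ′) c G ⟩
    (η m *Λ ((η κ *Λ η κ′) *Λ c)) *Λ G
      ≈⟨ *Λ-congʳ G (R.sym (η-*-cong m (κ K.* κ′ K.* a) R.refl (η-*-cong (κ K.* κ′) a (η-* κ κ′)
           (η-*-cong (residue (suc u) (suc u′)) _ R.refl (R.trans (η-sub ((q ^ suc u) ^ v′) ((q ^ suc u′) ^ v))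
             (R.+-cong (η-^ (q ^ suc u) v′) (R.-‿cong (η-^ (q ^ suc u′) v)))))))) ⟩
    η (m K.* (κ K.* κ′ K.* a)) *Λ G ∎
    where
    m a : K.Carrier
    m = val (invF M)
    a = residue (suc u) (suc u′) K.* ((q ^ suc u) ^ v′ K.- (q ^ suc u′) ^ v)
    c G : Λ
    c = C.coefficient u u′ v v′
    G = D (suc u ℕ.+ suc u′) (v ℕ.+ v′) F
    expand : ∀ u v X Y Z κ κ′ → X ~ (η κ *Λ D u v Y) → Y ~ (η κ′ *Λ Z) → X ~ (η κ *Λ (η κ′ *Λ D u v Z))
    expand u v X Y Z κ κ′ h k = R.trans h (*Λ-congˡ (η κ) (R.trans (D-cong u v k) (D-η u v κ′ Z)))

-- Lattice points below the diagonal

open import Data.Nat.Base using (_+_; _*_; _∸_; _%_; _/_; ⌊_/2⌋)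
open ≡ using (refl; sym; trans)

Inverse : (m n : ℕ) .{{_ : ℕ.NonZero m}} → ℕ → Set
Inverse m n a = (n * a) % m ≡ 1 % m

-- `findA` returns the first match, so one solution among the candidates guarantees success, though
-- perhaps with another solution.
findA-finds : ∀ m n .{{_ : ℕ.NonZero m}} as {a} → a ∈ as → Inverse m n a →
  ∃ λ a → findA m n as ≡ just (a , (n * a ∸ 1) / m) × a ∈ as × Inverse m n a
findA-finds m n (a ∷ as) a∈ inv with ((n * a) % m) ℕ.≡ᵇ (1 % m) in eq
... | true = a , refl , here refl , ℕₚ.≡ᵇ⇒≡ _ _ (subst T (sym eq) tt)
findA-finds m n (a ∷ as) (here refl) inv | false = contradiction (subst T eq (ℕₚ.≡⇒≡ᵇ _ _ inv)) (λ ())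
findA-finds m n (a ∷ as) (there a∈) inv | false with findA-finds m n as a∈ inv
... | a′ , found , a′∈ , inv′ = a′ , found , there a′∈ , inv′

inverse-reduce : ∀ m n a .{{_ : ℕ.NonZero m}} → Inverse m n a → Inverse m n (a % m)
inverse-reduce m n a inv = begin
  (n * (a % m)) % m ≡⟨ sym ([m+kn]%n≡m%n (n * (a % m)) (n * (a / m)) m) ⟩
  (n * (a % m) + n * (a / m) * m) % m ≡⟨ cong (_% m) (regroup n (a % m) (a / m) m) ⟩
  (n * (a % m + a / m * m)) % m ≡⟨ cong (λ b → (n * b) % m) (sym (m≡m%n+[m/n]*n a m)) ⟩
  (n * a) % m ≡⟨ inv ⟩
  1 % m ∎
  where
  open ≡-Reasoning
  regroup : ∀ n r s m → n * r + n * s * m ≡ n * (r + s * m)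
  regroup = solve-∀

inverse-exists : ∀ m n → Coprime (suc m) n → ∃ λ a → Inverse (suc m) n a
inverse-exists m n c with coprime-Bézout c
... | Bézout.-+ x y eq = y , trans (cong (_% suc m) (trans (ℕₚ.*-comm n y) (sym eq))) ([m+kn]%n≡m%n 1 x (suc m))
-- Here n y is -1 modulo `suc m`, and multiplication by `m` repairs the sign.
... | Bézout.+- x y eq = m * y , (begin
  (n * (m * y)) % suc m ≡⟨ sym ([m+kn]%n≡m%n (n * (m * y)) 1 (suc m)) ⟩
  (n * (m * y) + 1 * suc m) % suc m ≡⟨ cong (_% suc m) (regroup n m y) ⟩
  (1 + m * (1 + y * n)) % suc m ≡⟨ cong (λ z → (1 + z) % suc m) (trans (cong (m *_) eq) (sym (ℕₚ.*-assoc m x (suc m)))) ⟩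
  (1 + m * x * suc m) % suc m ≡⟨ [m+kn]%n≡m%n 1 (m * x) (suc m) ⟩
  1 % suc m ∎)
  where
  open ≡-Reasoning
  regroup : ∀ n m y → n * (m * y) + 1 * suc m ≡ 1 + m * (1 + y * n)
  regroup = solve-∀

inverse-in-range : ∀ k m n → 2 ≤ k * suc m → Coprime (suc m) n → ∃ λ a → Inverse (suc m) n a × 1 ≤ a × a < k * suc m
-- Modulo 1 everything is congruent, so 1 serves; the bound on k keeps it in range.
inverse-in-range k zero n 2≤k c = 1 , trans (n%1≡0 (n * 1)) (sym (n%1≡0 1)) , s≤s z≤n , 2≤k
inverse-in-range zero (suc m) n () c
inverse-in-range (suc k) (suc m) n 2≤k c with inverse-exists (suc m) n c
... | a₀ , inv with a₀ % suc (suc m) in eq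
...   | zero = contradiction
  (trans (sym (trans (cong (λ a → (n * a) % suc (suc m)) eq) (cong (_% suc (suc m)) (ℕₚ.*-zeroʳ n))))
    (trans (inverse-reduce (suc (suc m)) n a₀ inv) (m<n⇒m%n≡m {n = suc (suc m)} (s≤s (s≤s z≤n))))) (λ ())
...   | suc a = suc a , subst (Inverse (suc (suc m)) n) eq (inverse-reduce (suc (suc m)) n a₀ inv) , s≤s z≤n ,
  ℕₚ.<-≤-trans (subst (_< suc (suc m)) eq (m%n<n a₀ (suc (suc m)))) (ℕₚ.m≤m+n (suc (suc m)) (k * suc (suc m)))

-- The rounded division in `choose` is exact: if z + 1 leaves remainder 1, then z is divisible. For
-- modulus 1 every division is exact.
exact-quotient : ∀ m z → suc z % suc m ≡ 1 % suc m → suc z ≡ suc m * (z / suc m) + 1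
exact-quotient zero z _ = trans (cong suc (trans (m≡m%n+[m/n]*n z 1) (cong₂ _+_ (n%1≡0 z) (ℕₚ.*-comm (z / 1) 1)))) (ℕₚ.+-comm 1 _)
exact-quotient (suc m) z h = begin
  suc z ≡⟨ cong suc z≡ ⟩
  suc (w * suc (suc m)) ≡⟨ cong (λ x → suc (x * suc (suc m))) (sym (m*n/n≡m w (suc (suc m)))) ⟩
  suc (w * suc (suc m) / suc (suc m) * suc (suc m)) ≡⟨ cong (λ x → suc (x / suc (suc m) * suc (suc m))) (sym z≡) ⟩
  suc (z / suc (suc m) * suc (suc m)) ≡⟨ trans (cong suc (ℕₚ.*-comm (z / suc (suc m)) (suc (suc m)))) (ℕₚ.+-comm 1 _) ⟩
  suc (suc m) * (z / suc (suc m)) + 1 ∎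
  where
  open ≡-Reasoning
  w : ℕ
  w = suc z / suc (suc m)
  z≡ : z ≡ w * suc (suc m)
  z≡ = ℕₚ.suc-injective (trans (m≡m%n+[m/n]*n (suc z) (suc (suc m)))
    (cong (_+ w * suc (suc m)) (trans h (m<n⇒m%n≡m {n = suc (suc m)} (s≤s (s≤s z≤n))))))

-- A solution in range exists, so the default (0, 0) of `choose` is never reached, and its
-- subtraction and division are exact.
choose-spec : ∀ k m n → 2 ≤ k * suc m → 1 ≤ n → Coprime (suc m) n →
  ∃₂ λ a b → choose k (suc m) n ≡ (a , b) × 1 ≤ a × a < k * suc m × n * a ≡ suc m * b + 1
choose-spec k m n 2≤km 1≤n c with inverse-in-range k m n 2≤km c
... | a₀ , inv₀ , 1≤a₀ , a₀<km with findA-finds (suc m) n candidates (member a₀ 1≤a₀ a₀<km) inv₀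
  where
  candidates : List ℕ
  candidates = map suc (upTo (k * suc m ∸ 1))
  member : ∀ a → 1 ≤ a → a < k * suc m → a ∈ candidates
  member (suc a) _ a<km = subst (suc a ∈_) (sym (Listₚ.map-upTo suc (k * suc m ∸ 1))) (∈-applyUpTo⁺ suc (ℕₚ.∸-monoˡ-≤ 1 a<km))
... | a , found , a∈ , inv with ∈-applyUpTo⁻ suc (subst (a ∈_) (Listₚ.map-upTo suc (k * suc m ∸ 1)) a∈)
choose-spec k m (suc n) 2≤km 1≤n c | _ | _ , found , a∈ , inv | i , i<km-1 , refl =
  suc i , _ , chosen , s≤s z≤n , subst (suc i <_) (ℕₚ.m+[n∸m]≡n {1} (ℕₚ.≤-trans (s≤s z≤n) 2≤km)) (s≤s i<km-1) ,
  exact-quotient m _ inv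
  where
  chosen : choose k (suc m) (suc n) ≡ (suc i , (suc n * suc i ∸ 1) / suc m)
  chosen rewrite found = refl

bezout⇒coprime : ∀ {x y s r} → r * y ≡ s * x + 1 → Coprime x y
bezout⇒coprime {x} {y} {s} {r} eq {d} (d∣x , d∣y) =
  ∣1⇒≡1 (∣m+n∣m⇒∣n (subst (d ∣_) eq (∣n⇒∣m*n r d∣y)) (∣n⇒∣m*n s d∣x))

-- The lattice point (a, b) below the diagonal of the km × kn rectangle and its
-- complement: both are primitive, and they span a parallelogram of area k.
record Splitting (k m n : ℕ) : Set where
  field
    a b a′ b′       : ℕ
    chosen          : choose k m n ≡ (suc a , b)
    complementˡ     : k * m ∸ suc a ≡ suc a′
    complementʳ     : k * n ∸ b ≡ b′
    width           : suc a′ + suc a ≡ k * m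
    height          : b′ + b ≡ k * n
    area            : suc a * b′ ≡ suc a′ * b + k
    coprime         : Coprime (suc a) b
    coprime′        : Coprime (suc a′) b′

-- Everything follows from n a - m b = 1. With a + a′ = km and b + b′ = kn it gives a b′ - a′ b =
-- k(n a - m b) = k for the area and m b′ - n a′ = 1 for coprimality of the complement.
splitting : ∀ k m n → 2 ≤ k * suc m → 1 ≤ n → Coprime (suc m) n → Splitting k (suc m) n
splitting k m n 2≤km 1≤n c with choose-spec k m n 2≤km 1≤n c
... | suc a , b , chosen , _ , a<km , det = record
  { a = a ; b = b ; a′ = a′ ; b′ = b′ ; chosen = chosen ; complementˡ = complementˡ ; complementʳ = refl
  ; width = width ; height = height ; area = area
  ; coprime = λ {d} (d∣a , d∣b) → bezout⇒coprime {b} {suc a} {suc m} {n} det (d∣b , d∣a)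
  ; coprime′ = bezout⇒coprime {suc a′} {b′} {n} {suc m} det′ }
  where
  open ≡-Reasoning
  km kn a′ b′ : ℕ
  km = k * suc m
  kn = k * n
  a′ = km ∸ suc (suc a)
  b′ = kn ∸ b
  width : suc a′ + suc a ≡ km
  width = trans (sym (ℕₚ.+-suc a′ (suc a))) (ℕₚ.m∸n+n≡m a<km)
  complementˡ : km ∸ suc a ≡ suc a′
  complementˡ = trans (cong (_∸ suc a) (sym width)) (ℕₚ.m+n∸n≡m (suc a′) (suc a))
  -- From m b < n a ≤ n k m; hence `kn ∸ b` is a true difference.
  b≤kn : b ≤ kn
  b≤kn = ℕₚ.*-cancelˡ-≤ (suc m) (ℕₚ.≤-trans (ℕₚ.m≤m+n (suc m * b) 1) (subst (_≤ suc m * kn) det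
    (ℕₚ.≤-trans (ℕₚ.*-monoʳ-≤ n (ℕₚ.<⇒≤ a<km)) (ℕₚ.≤-reflexive (regroup n k m)))))
    where
    regroup : ∀ n k m → n * (k * suc m) ≡ suc m * (k * n)
    regroup = solve-∀
  height : b′ + b ≡ kn
  height = ℕₚ.m∸n+n≡m b≤kn
  area : suc a * b′ ≡ suc a′ * b + k
  area = ℕₚ.+-cancelʳ-≡ (suc a * b) _ _ (begin
    suc a * b′ + suc a * b ≡⟨ sym (ℕₚ.*-distribˡ-+ (suc a) b′ b) ⟩
    suc a * (b′ + b) ≡⟨ cong (suc a *_) height ⟩
    suc a * (k * n) ≡⟨ regroup₁ (suc a) k n ⟩
    k * (n * suc a) ≡⟨ cong (k *_) det ⟩
    k * (suc m * b + 1) ≡⟨ regroup₂ k (suc m) b ⟩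
    k * suc m * b + k ≡⟨ cong (λ w → w * b + k) (sym width) ⟩
    (suc a′ + suc a) * b + k ≡⟨ regroup₃ (suc a′) (suc a) b k ⟩
    suc a′ * b + k + suc a * b ∎)
    where
    regroup₁ : ∀ a k n → a * (k * n) ≡ k * (n * a)
    regroup₁ = solve-∀
    regroup₂ : ∀ k m b → k * (m * b + 1) ≡ k * m * b + k
    regroup₂ = solve-∀
    regroup₃ : ∀ a′ a b k → (a′ + a) * b + k ≡ a′ * b + k + a * b
    regroup₃ = solve-∀
  det′ : suc m * b′ ≡ n * suc a′ + 1
  det′ = ℕₚ.+-cancelʳ-≡ (suc m * b) _ _ (begin
    suc m * b′ + suc m * b ≡⟨ sym (ℕₚ.*-distribˡ-+ (suc m) b′ b) ⟩
    suc m * (b′ + b) ≡⟨ cong (suc m *_) height ⟩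
    suc m * (k * n) ≡⟨ regroup₁ (suc m) k n ⟩
    n * (k * suc m) ≡⟨ cong (n *_) (sym width) ⟩
    n * (suc a′ + suc a) ≡⟨ ℕₚ.*-distribˡ-+ n (suc a′) (suc a) ⟩
    n * suc a′ + n * suc a ≡⟨ cong (λ x → n * suc a′ + x) det ⟩
    n * suc a′ + (suc m * b + 1) ≡⟨ regroup₂ (n * suc a′) (suc m * b) ⟩
    n * suc a′ + 1 + suc m * b ∎)
    where
    regroup₁ : ∀ m k n → m * (k * n) ≡ n * (k * m)
    regroup₁ = solve-∀
    regroup₂ : ∀ x y → x + (y + 1) ≡ x + 1 + y
    regroup₂ = solve-∀

-- The equation forces X to be even, so the rounding in `expL` is harmless. The induction moves E
-- into X two units at a time.
⌊half⌋ : ∀ X E Y → X + (E + E) ≡ Y + Y → ⌊ X /2⌋ + E ≡ Y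
⌊half⌋ X zero Y eq = trans (ℕₚ.+-identityʳ _) (trans (cong ⌊_/2⌋ (trans (sym (ℕₚ.+-identityʳ X)) eq)) (sym (ℕₚ.n≡⌊n+n/2⌋ Y)))
⌊half⌋ X (suc E) Y eq = trans (ℕₚ.+-suc ⌊ X /2⌋ E) (⌊half⌋ (suc (suc X)) E Y (trans (regroup X E) eq))
  where
  regroup : ∀ X E → suc (suc X) + (E + E) ≡ X + (suc E + suc E)
  regroup = solve-∀

-- Which terms occur in formal sums, products and series

Term : Set
Term = Frac × Mon

_⊙_ : Term → Term → Term
(c , μ) ⊙ (d , ν) = (c *F d) , addMon μ ν

∈-*Λ⁺ : ∀ {F G s r} → s ∈ F → r ∈ G → (s ⊙ r) ∈ (F *Λ G)
∈-*Λ⁺ (here refl) r∈G = ∈-++⁺ˡ (∈-map⁺ _ r∈G)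
∈-*Λ⁺ {s₀ ∷ F} {G} (there s∈F) r∈G = ∈-++⁺ʳ (map (s₀ ⊙_) G) (∈-*Λ⁺ s∈F r∈G)

∈-*Λ⁻ : ∀ F G {t} → t ∈ (F *Λ G) → ∃₂ λ s r → s ∈ F × r ∈ G × t ≡ s ⊙ r
∈-*Λ⁻ (s ∷ F) G t∈ with ∈-++⁻ (map (s ⊙_) G) t∈
... | inj₁ t∈sG with ∈-map⁻ (s ⊙_) t∈sG
...   | r , r∈G , eq = s , r , here refl , r∈G , eq
∈-*Λ⁻ (s ∷ F) G t∈ | inj₂ t∈FG with ∈-*Λ⁻ F G t∈FG
...   | s′ , r , s′∈F , r∈G , eq = s′ , r , there s′∈F , r∈G , eq

∈-scale⁺ : ∀ c {F s} → s ∈ F → (c *F proj₁ s , proj₂ s) ∈ scaleΛ c F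
∈-scale⁺ c = ∈-map⁺ _

∈-scale⁻ : ∀ c F {t} → t ∈ scaleΛ c F → ∃ λ s → s ∈ F × t ≡ (c *F proj₁ s , proj₂ s)
∈-scale⁻ c F = ∈-map⁻ _

lookup-map : ∀ (f : Λ → Λ) → f [] ≡ [] → ∀ G n → lookupL (map f G) n ≡ f (lookupL G n)
lookup-map f f[] [] n = sym f[]
lookup-map f f[] (g ∷ G) zero = refl
lookup-map f f[] (g ∷ G) (suc n) = lookup-map f f[] G n

*Λ-[] : ∀ F → (F *Λ []) ≡ []
*Λ-[] [] = refl
*Λ-[] (s ∷ F) = *Λ-[] F

∈-mulL⁺ : ∀ F G i j {s r} → s ∈ lookupL F i → r ∈ lookupL G j → (s ⊙ r) ∈ lookupL (mulL F G) (i + j)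
∈-mulL⁺ (f ∷ F) G i j s∈ r∈ rewrite lookup-addL (map (f *Λ_) G) (0Λ ∷ mulL F G) (i + j) with i
... | zero = ∈-++⁺ˡ (subst (_ ∈_) (sym (lookup-map (f *Λ_) (*Λ-[] f) G j)) (∈-*Λ⁺ s∈ r∈))
... | suc i = ∈-++⁺ʳ (lookupL (map (f *Λ_) G) (suc i + j)) (∈-mulL⁺ F G i j s∈ r∈)

∈-mulL⁻ : ∀ F G n {t} → t ∈ lookupL (mulL F G) n →
  ∃₂ λ i j → ∃₂ λ s r → i + j ≡ n × s ∈ lookupL F i × r ∈ lookupL G j × t ≡ s ⊙ r
∈-mulL⁻ (f ∷ F) G n t∈ with ∈-++⁻ (lookupL (map (f *Λ_) G) n) (subst (_ ∈_) (lookup-addL (map (f *Λ_) G) (0Λ ∷ mulL F G) n) t∈)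
... | inj₁ t∈fG with ∈-*Λ⁻ f (lookupL G n) (subst (_ ∈_) (lookup-map (f *Λ_) (*Λ-[] f) G n) t∈fG)
...   | s , r , s∈ , r∈ , eq = 0 , n , s , r , refl , s∈ , r∈ , eq
∈-mulL⁻ (f ∷ F) G (suc n) t∈ | inj₂ t∈FG with ∈-mulL⁻ F G n t∈FG
...   | i , j , s , r , i+j , s∈ , r∈ , eq = suc i , j , s , r , cong suc i+j , s∈ , r∈ , eq

∈-act⁺ : ∀ S g v j {s r} → s ∈ lookupL S j → r ∈ g (v + j) → (s ⊙ r) ∈ act S g v
∈-act⁺ (f ∷ S) g v zero {r = r} s∈ r∈ = ∈-++⁺ˡ (∈-*Λ⁺ s∈ (subst (λ w → r ∈ g w) (ℕₚ.+-identityʳ v) r∈))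
∈-act⁺ (f ∷ S) g v (suc j) {r = r} s∈ r∈ = ∈-++⁺ʳ (f *Λ g v) (∈-act⁺ S g (suc v) j s∈ (subst (λ w → r ∈ g w) (ℕₚ.+-suc v j) r∈))

∈-act⁻ : ∀ S g v {t} → t ∈ act S g v → ∃ λ j → ∃₂ λ s r → s ∈ lookupL S j × r ∈ g (v + j) × t ≡ s ⊙ r
∈-act⁻ (f ∷ S) g v t∈ with ∈-++⁻ (f *Λ g v) t∈
... | inj₁ t∈fg with ∈-*Λ⁻ f (g v) t∈fg
...   | s , r , s∈ , r∈ , eq = 0 , s , r , s∈ , subst (λ w → r ∈ g w) (sym (ℕₚ.+-identityʳ v)) r∈ , eq
∈-act⁻ (f ∷ S) g v t∈ | inj₂ t∈S with ∈-act⁻ S g (suc v) t∈S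
...   | j , s , r , s∈ , r∈ , eq = suc j , s , r , s∈ , subst (λ w → r ∈ g w) (sym (ℕₚ.+-suc v j)) r∈ , eq

∈-shiftPlus⁺ : ∀ u F j {c μ s} → (c , μ) ∈ F → s ∈ lookupL (substMon u 1 μ) j → (c *F proj₁ s , proj₂ s) ∈ lookupL (shiftPlus u F) j
∈-shiftPlus⁺ u ((c , μ) ∷ F) j c∈ s∈ rewrite lookup-addL (map (scaleΛ c) (substMon u 1 μ)) (shiftPlus u F) j with c∈
... | here refl = ∈-++⁺ˡ (subst (_ ∈_) (sym (lookup-map (scaleΛ c) refl (substMon u 1 μ) j)) (∈-scale⁺ c s∈))
... | there c∈F = ∈-++⁺ʳ (lookupL (map (scaleΛ c) (substMon u 1 μ)) j) (∈-shiftPlus⁺ u F j c∈F s∈)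

∈-shiftPlus⁻ : ∀ u F j {t} → t ∈ lookupL (shiftPlus u F) j →
  ∃₂ λ c μ → ∃ λ s → (c , μ) ∈ F × s ∈ lookupL (substMon u 1 μ) j × t ≡ (c *F proj₁ s , proj₂ s)
∈-shiftPlus⁻ u ((c , μ) ∷ F) j t∈ with ∈-++⁻ (lookupL (map (scaleΛ c) (substMon u 1 μ)) j)
  (subst (_ ∈_) (lookup-addL (map (scaleΛ c) (substMon u 1 μ)) (shiftPlus u F) j) t∈)
... | inj₁ t∈c with ∈-scale⁻ c (lookupL (substMon u 1 μ) j) (subst (_ ∈_) (lookup-map (scaleΛ c) refl (substMon u 1 μ) j) t∈c)
...   | s , s∈ , eq = c , μ , s , here refl , s∈ , eq
∈-shiftPlus⁻ u ((c , μ) ∷ F) j t∈ | inj₂ t∈F with ∈-shiftPlus⁻ u F j t∈F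
...   | c′ , μ′ , s , c′∈ , s∈ , eq = c′ , μ′ , s , there c′∈ , s∈ , eq

unit : ℕ → Mon
unit k = replicate k 0 ++ 1 ∷ []

-- Degree of a monomial in the power sums, when the first entry of the vector is the exponent of
-- p_i.
degree : ℕ → Mon → ℕ
degree i []      = 0
degree i (e ∷ μ) = e * i + degree (suc i) μ

size : Mon → ℕ
size []      = 0
size (e ∷ μ) = e + size μ

degree-addMon : ∀ i μ ν → degree i (addMon μ ν) ≡ degree i μ + degree i ν
degree-addMon i [] ν = refl
degree-addMon i (a ∷ μ) [] = sym (ℕₚ.+-identityʳ _)
degree-addMon i (a ∷ μ) (b ∷ ν) rewrite degree-addMon (suc i) μ ν = regroup a b i (degree (suc i) μ) (degree (suc i) ν)
  where
  regroup : ∀ a b i m n → (a + b) * i + (m + n) ≡ a * i + m + (b * i + n)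
  regroup = solve-∀

degree-unit : ∀ i k → degree i (unit k) ≡ i + k
degree-unit i zero = trans (ℕₚ.+-identityʳ (1 * i)) (trans (ℕₚ.*-identityˡ i) (sym (ℕₚ.+-identityʳ i)))
degree-unit i (suc k) = trans (degree-unit (suc i) k) (sym (ℕₚ.+-suc i k))

degree-suc : ∀ i μ → degree (suc i) μ ≡ size μ + degree i μ
degree-suc i [] = refl
degree-suc i (e ∷ μ) rewrite degree-suc (suc i) μ = regroup e i (size μ) (degree (suc i) μ)
  where
  regroup : ∀ e i s d → e * suc i + (s + d) ≡ e + s + (e * i + d)
  regroup = solve-∀

degree-strip : ∀ i μ → degree i (strip μ) ≡ degree i μ
degree-strip i [] = refl
degree-strip i (x ∷ μ) with strip μ | degree-strip (suc i) μ
degree-strip i (zero ∷ μ)  | []    | eq = eq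
degree-strip i (suc x ∷ μ) | []    | eq = cong (λ d → suc x * i + d) eq
degree-strip i (x ∷ μ)     | _ ∷ _ | eq = cong (λ d → x * i + d) eq

strip-idempotent : ∀ μ → strip (strip μ) ≡ strip μ
strip-idempotent [] = refl
strip-idempotent (x ∷ μ) with strip μ | strip-idempotent μ
strip-idempotent (zero ∷ μ)  | []    | eq = refl
strip-idempotent (suc x ∷ μ) | []    | eq = refl
strip-idempotent (x ∷ μ)     | y ∷ ν | eq rewrite eq = refl

-- Terms are compared as raw exponent vectors, so a monomial occurring in `powL S j` has to be
-- literally an `addMon` of j unit vectors, here of total degree d.
data UnitSum : ℕ → ℕ → Mon → Set where
  none : UnitSum 0 0 []
  plus : ∀ {j d μ} k → UnitSum j d μ → UnitSum (suc j) (suc k + d) (addMon (unit k) μ)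

-- Each of the j units gains one in degree. The empty sum is exceptional: it stays `[]` and does not
-- become a zero vector of length 1.
unitSum-shift : ∀ {j d μ} → UnitSum j d μ → (j ≡ 0 × d ≡ 0 × μ ≡ []) ⊎ UnitSum j (j + d) (0 ∷ μ)
unitSum-shift none = inj₁ (refl , refl , refl)
unitSum-shift (plus {j} {d} {μ} k s) with unitSum-shift s
... | inj₁ (refl , refl , refl) = inj₂ (subst (λ μ → UnitSum 1 (suc (suc k) + 0) (0 ∷ μ)) (sym (addMon-identityʳ (unit k))) (plus (suc k) none))
... | inj₂ s′ = inj₂ (subst (λ e → UnitSum (suc j) e (0 ∷ addMon (unit k) μ)) (regroup j d k) (plus (suc k) s′))
  where
  regroup : ∀ j d k → suc (suc k) + (j + d) ≡ suc j + (suc k + d)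
  regroup = solve-∀

unitSum-raise : ∀ x {j d e μ} → UnitSum j d (e ∷ μ) → UnitSum (x + j) (x + d) (x + e ∷ μ)
unitSum-raise zero    s = s
unitSum-raise (suc x) s = plus 0 (unitSum-raise x s)

addMon-unit≢[] : ∀ k μ → ¬ addMon (unit k) μ ≡ []
addMon-unit≢[] zero    []      ()
addMon-unit≢[] zero    (_ ∷ _) ()
addMon-unit≢[] (suc k) []      ()
addMon-unit≢[] (suc k) (_ ∷ _) ()

unitSum-[] : ∀ {j d μ} → UnitSum j d μ → μ ≡ [] → j ≡ 0 × d ≡ 0
unitSum-[] none _ = refl , refl
unitSum-[] (plus {μ = μ} k s) eq = contradiction eq (addMon-unit≢[] k μ)

-- A stripped vector has no trailing zeros, which is the form that sums of unit vectors take.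
unitSum-strip : ∀ μ → UnitSum (size μ) (degree 1 μ) (strip μ)
unitSum-strip [] = none
unitSum-strip (x ∷ μ) = subst (λ d → UnitSum (x + size μ) d (strip (x ∷ μ)))
  (cong₂ _+_ (sym (ℕₚ.*-identityʳ x)) (sym (degree-suc 1 μ))) (extend x μ (unitSum-strip μ))
  where
  extend : ∀ x μ {j d} → UnitSum j d (strip μ) → UnitSum (x + j) (x + (j + d)) (strip (x ∷ μ))
  extend x μ {j} {d} s with strip μ
  ... | y ∷ ν with unitSum-shift s
  ...   | inj₂ s′ = subst (λ e → UnitSum (x + j) (x + (j + d)) (e ∷ y ∷ ν)) (ℕₚ.+-identityʳ x) (unitSum-raise x s′)
  extend zero μ s | [] with unitSum-[] s refl
  ... | refl , refl = none
  extend (suc x) μ s | [] with unitSum-[] s refl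
  ... | refl , refl rewrite ℕₚ.+-identityʳ x =
    subst (λ n → UnitSum n n (n ∷ [])) (ℕₚ.+-comm x 1) (unitSum-raise x (plus 0 none))

-- Every unit has degree at least 1, so the power needed lies in the summation range of
-- `omegaCoeff`.
unitSum-size≤degree : ∀ {j d μ} → UnitSum j d μ → j ≤ d
unitSum-size≤degree none = z≤n
unitSum-size≤degree (plus k s) = s≤s (ℕₚ.≤-trans (unitSum-size≤degree s) (ℕₚ.m≤n+m _ k))

-- Zero denominators: a formal fraction with denominator 0 absorbs whatever it is
-- added to or multiplied with. A term of degree d with such a coefficient spoils
-- exactly the monomials of degree d + n under an operator that is full of degree n,
-- so two such operators agree on the spoiled monomials.

Graded : (ℕ → ℕ → Set) → List Λ → Set
Graded H S = ∀ {j t} → t ∈ lookupL S j → ¬ Bad (proj₁ t) × H j (degree 1 (proj₂ t))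

graded-mulL : ∀ (H₁ H₂ H₃ : ℕ → ℕ → Set) → (∀ {i j d e} → H₁ i d → H₂ j e → H₃ (i + j) (d + e)) →
  ∀ S T → Graded H₁ S → Graded H₂ T → Graded H₃ (mulL S T)
graded-mulL H₁ H₂ H₃ add S T gS gT {n} t∈ with ∈-mulL⁻ S T n t∈
... | i , j , (c , μ) , (d , ν) , refl , s∈ , r∈ , refl =
  good-* {c} {d} (proj₁ (gS s∈)) (proj₁ (gT r∈)) ,
  subst (H₃ (i + j)) (sym (degree-addMon 1 μ ν)) (add (proj₂ (gS s∈)) (proj₂ (gT r∈)))

module _ (n : ℕ) (F : Λ) (ν : Mon) where
  BadSource : Set
  BadSource = ∃₂ λ d μ → (d , μ) ∈ F × Bad d × degree 1 μ + n ≡ degree 1 ν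

  -- The witness is asked for at the stripped vector: that is the form `unitSum-strip` supplies, and
  -- `coeffΛ` compares stripped vectors anyway.
  BadTarget : Λ → Set
  BadTarget G = ∀ {d μ} → (d , μ) ∈ F → Bad d → degree 1 μ + n ≡ degree 1 ν → ∃ λ c → (c , strip ν) ∈ G × Bad c

record Full (n : ℕ) (A : Op) : Set where
  field
    bad-source : ∀ F {c ν} → (c , ν) ∈ A F → Bad c → BadSource n F ν
    bad-target : ∀ F ν → BadTarget n F ν (A F)
open Full public

full-∘ : ∀ {m n A B} → Full m A → Full n B → Full (m + n) (A ∘ B)
full-∘ {m} {n} {A} {B} fA fB = record { bad-source = source ; bad-target = target }
  where
  regroup : ∀ a m n → a + n + m ≡ a + (m + n)
  regroup = solve-∀
  source : ∀ F {c ν} → (c , ν) ∈ A (B F) → Bad c → BadSource (m + n) F ν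
  source F c∈ bad-c with bad-source fA (B F) c∈ bad-c
  ... | d , μ , d∈ , bad-d , eq with bad-source fB F d∈ bad-d
  ...   | e , ρ , e∈ , bad-e , eq′ = e , ρ , e∈ , bad-e ,
    trans (sym (regroup (degree 1 ρ) m n)) (trans (cong (_+ m) eq′) eq)
  target : ∀ F ν → BadTarget (m + n) F ν (A (B F))
  -- Between the two operators any monomial of the right degree will do; a power of p_1 is taken.
  target F ν {d} {μ} d∈ bad-d eq with bad-target fB F (degree 1 μ + n ∷ []) d∈ bad-d
    (sym (trans (ℕₚ.+-identityʳ _) (ℕₚ.*-identityʳ _)))
  ... | c , c∈ , bad-c = bad-target fA (B F) ν c∈ bad-c
    (trans (cong (_+ m) (trans (degree-strip 1 (degree 1 μ + n ∷ [])) (trans (ℕₚ.+-identityʳ _) (ℕₚ.*-identityʳ _))))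
      (trans (regroup (degree 1 μ) m n) eq))

full-scale : ∀ {n A} c → ¬ Bad c → Full n A → Full n (c • A)
full-scale {n} {A} c good-c fA = record { bad-source = source ; bad-target = target }
  where
  source : ∀ F {e ν} → (e , ν) ∈ (c • A) F → Bad e → BadSource n F ν
  source F e∈ bad-e with ∈-scale⁻ c (A F) e∈
  ... | (d , ν) , d∈ , refl with bad-* c d bad-e
  ...   | inj₁ bad-c = contradiction bad-c good-c
  ...   | inj₂ bad-d = bad-source fA F d∈ bad-d
  target : ∀ F ν → BadTarget n F ν ((c • A) F)
  target F ν d∈ bad-d eq with bad-target fA F ν d∈ bad-d eq
  ... | e , e∈ , bad-e = c *F e , ∈-scale⁺ c e∈ , bad-*ʳ c e bad-e

-- Subtraction concatenates lists, so nothing cancels: both products have zero denominators only in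
-- the allowed degrees, and `A ∘ B` alone has them wherever they are required.
full-commutator : ∀ {m n A B} → ¬ Bad -1F → Full m A → Full n B → Full (m + n) ⟦ A , B ⟧
full-commutator {m} {n} {A} {B} good-neg fA fB = record { bad-source = source ; bad-target = target }
  where
  AB : Full (m + n) (A ∘ B)
  AB = full-∘ fA fB
  BA : Full (m + n) (-1F • (B ∘ A))
  BA = full-scale -1F good-neg (subst (λ k → Full k (B ∘ A)) (ℕₚ.+-comm n m) (full-∘ fB fA))
  source : ∀ F {e ν} → (e , ν) ∈ ⟦ A , B ⟧ F → Bad e → BadSource (m + n) F ν
  source F e∈ bad-e with ∈-++⁻ (A (B F)) e∈
  ... | inj₁ e∈AB = bad-source AB F e∈AB bad-e
  ... | inj₂ e∈BA = bad-source BA F e∈BA bad-e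
  target : ∀ F ν → BadTarget (m + n) F ν (⟦ A , B ⟧ F)
  target F ν d∈ bad-d eq with bad-target AB F ν d∈ bad-d eq
  ... | e , e∈ , bad-e = e , ∈-++⁺ˡ e∈ , bad-e

∈-sumΛ⁻ : ∀ N (f : ℕ → Λ) {t} → t ∈ sumΛ (applyUpTo f N) → ∃ λ j → t ∈ f j
∈-sumΛ⁻ (suc N) f t∈ with ∈-++⁻ (f 0) t∈
... | inj₁ t∈f = 0 , t∈f
... | inj₂ t∈rest with ∈-sumΛ⁻ N (f ∘ suc) t∈rest
...   | j , t∈f = suc j , t∈f

∈-sumΛ⁺ : ∀ N (f : ℕ → Λ) j {t} → j < N → t ∈ f j → t ∈ sumΛ (applyUpTo f N)
∈-sumΛ⁺ (suc N) f zero _ t∈ = ∈-++⁺ˡ t∈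
∈-sumΛ⁺ (suc N) f (suc j) (s≤s j<N) t∈ = ∈-++⁺ʳ (f 0) (∈-sumΛ⁺ N (f ∘ suc) j j<N t∈)

∈-lookup-bounded : ∀ N k (f : ℕ → Λ) {t} → t ∈ lookupL (applyUpTo f N) k → k < N
∈-lookup-bounded (suc N) zero    f _  = s≤s z≤n
∈-lookup-bounded (suc N) (suc k) f t∈ = s≤s (∈-lookup-bounded N k (f ∘ suc) t∈)

Exact : ℕ → ℕ → Set
Exact j d = d ≡ j

-- For homogeneous F, the degree in X and the exponent of 1/z add up to a constant in F[X +
-- M[u]_q/z].
Total : ℕ → ℕ → ℕ → Set
Total e j d = d + j ≡ e

total-+ : ∀ {e e′} i j d d′ → Total e i d → Total e′ j d′ → Total (e + e′) (i + j) (d + d′)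
total-+ i j d d′ refl refl = regroup d d′ i j
  where
  regroup : ∀ d d′ i j → d + d′ + (i + j) ≡ d + i + (d′ + j)
  regroup = solve-∀

-- The property of `omegaCoeff u` that spreads one zero denominator over all monomials of a degree.
record FullSequence (g : ℕ → Λ) : Set where
  field
    graded   : ∀ r {c μ} → (c , μ) ∈ g r → ¬ Bad c × degree 1 μ ≡ r
    attained : ∀ ν → ∃ λ c → (c , strip ν) ∈ g (degree 1 ν)

unitSum-power : ∀ S N → (∀ k → k < N → ∃ λ c → (c , unit k) ∈ lookupL S (suc k)) →
  ∀ {j d μ} → UnitSum j d μ → d ≤ N → ∃ λ c → (c , μ) ∈ lookupL (powL S j) d
unitSum-power S N h none _ = 1F , here refl
unitSum-power S N h (plus {j} {d} k s) k+d≤N with h k (ℕₚ.≤-trans (s≤s (ℕₚ.m≤m+n k d)) k+d≤N)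
  | unitSum-power S N h s (ℕₚ.≤-trans (ℕₚ.m≤n+m d (suc k)) k+d≤N)
... | _ , u∈ | _ , c∈ = _ , ∈-mulL⁺ S (powL S j) (suc k) d u∈ c∈

graded-power : ¬ Bad 1F → ∀ S → Graded Exact S → ∀ j → Graded Exact (powL S j)
graded-power good-1 S gS zero {zero} (here refl) = good-1 , refl
graded-power good-1 S gS (suc j) = graded-mulL Exact Exact Exact (λ { refl refl → refl }) S (powL S j) gS (graded-power good-1 S gS j)

graded-series : ∀ N (f : ℕ → Λ) → (∀ k {t} → t ∈ f k → ¬ Bad (proj₁ t) × degree 1 (proj₂ t) ≡ suc k) → Graded Exact (0Λ ∷ applyUpTo f N)
graded-series N f h {suc k} {t} t∈ = h k (subst (t ∈_) (lookup-applyUpTo f N k (∈-lookup-bounded N k f t∈)) t∈)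

sum-fullSequence : (c : ℕ → Frac) → (∀ j → ¬ Bad (c j)) → (S : ℕ → List Λ) → ¬ Bad 1F → (∀ r → Graded Exact (S r)) →
  (∀ r k → k < r → ∃ λ c → (c , unit k) ∈ lookupL (S r) (suc k)) →
  FullSequence (λ r → sumΛ (applyUpTo (λ j → scaleΛ (c j) (lookupL (powL (S r) j) r)) (suc r)))
sum-fullSequence c good-c S good-1 gS has-units = record { graded = graded ; attained = attained }
  where
  summand : ℕ → ℕ → Λ
  summand r j = scaleΛ (c j) (lookupL (powL (S r) j) r)
  graded : ∀ r {d μ} → (d , μ) ∈ sumΛ (applyUpTo (summand r) (suc r)) → ¬ Bad d × degree 1 μ ≡ r
  graded r t∈ with ∈-sumΛ⁻ (suc r) (summand r) t∈
  ... | j , t∈j with ∈-scale⁻ (c j) (lookupL (powL (S r) j) r) t∈j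
  ...   | (d , μ) , s∈ , refl = good-* {c j} {d} (good-c j) (proj₁ (graded-power good-1 (S r) (gS r) j s∈)) , proj₂ (graded-power good-1 (S r) (gS r) j s∈)
  attained : ∀ ν → ∃ λ d → (d , strip ν) ∈ sumΛ (applyUpTo (summand (degree 1 ν)) (suc (degree 1 ν)))
  attained ν with unitSum-power (S r) r (has-units r) (unitSum-strip ν) ℕₚ.≤-refl
    where
    r : ℕ
    r = degree 1 ν
  ... | d , d∈ = _ , ∈-sumΛ⁺ (suc (degree 1 ν)) (summand (degree 1 ν)) (size ν) (s≤s (unitSum-size≤degree (unitSum-strip ν))) (∈-scale⁺ (c (size ν)) d∈)

full-≡ : ∀ {n A B} → (∀ F → A F ≡ B F) → Full n A → Full n B
full-≡ A≡B fA = record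
  { bad-source = λ F c∈ → bad-source fA F (subst (_ ∈_) (sym (A≡B F)) c∈)
  ; bad-target = λ F ν d∈ bad-d eq → let c , c∈ , bad-c = bad-target fA F ν d∈ bad-d eq in c , subst (_ ∈_) (A≡B F) c∈ , bad-c }

module DFull (K : CommutativeRing 0ℓ 0ℓ) (E : Evaluation K) (u₀ : ℕ) where
  open Scalars K E
  open Evaluation E
  private
    module K = CommutativeRing K
    u : ℕ
    u = suc u₀

  good-1 : ¬ Bad 1F
  good-1 = good 1F (≈-≉0 val-1 1≉0)

  good-neg1 : ¬ Bad -1F
  good-neg1 = good -1F (≈-≉0 val-neg1 -1≉0)

  good-charge : ∀ k → ¬ Bad (Mk (suc k) *F bq (suc k) u)
  good-charge k = good-* {Mk (suc k)} {bq (suc k) u} (good (Mk (suc k)) (Mk≉0 k)) (good (bq (suc k) u) (bq≉0 k u₀))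

  good-1/ : ∀ n → ¬ val (fromℕF n) K.≈ K.0# → ¬ Bad (invF (fromℕF n))
  good-1/ n n≉0 = proj₂ (val≉0⇒good (fromℕF n) n≉0)

  graded-one : Graded (Total 0) (constΛ 1F ∷ [])
  graded-one {zero} (here refl) = good-1 , refl

  graded-substVar : ∀ i → Graded (Total (suc i)) (substVar u (suc i))
  graded-substVar i {zero} (here refl) = good-1 , trans (ℕₚ.+-identityʳ _) (degree-unit 1 i)
  graded-substVar i {suc j} t∈ with tail i j t∈
    where
    tail : ∀ i j {c t} → t ∈ lookupL (replicate i 0Λ ++ constΛ c ∷ []) j → j ≡ i × t ≡ (c , [])
    tail zero zero (here eq) = refl , eq
    tail (suc i) (suc j) t∈ with tail i j t∈
    ... | refl , eq = refl , eq
  ... | refl , refl = good-charge i , refl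

  graded-powL : ∀ X e → Graded (Total e) X → ∀ k → Graded (Total (k * e)) (powL X k)
  graded-powL X e gX zero = graded-one
  graded-powL X e gX (suc k) = graded-mulL (Total e) (Total (k * e)) (Total (suc k * e)) (λ {i} {j} {d} {d′} → total-+ i j d d′) X (powL X k) gX (graded-powL X e gX k)

  graded-substMon : ∀ i μ → Graded (Total (degree (suc i) μ)) (substMon u (suc i) μ)
  graded-substMon i [] = graded-one
  graded-substMon i (e ∷ μ) = graded-mulL (Total (e * suc i)) (Total (degree (suc (suc i)) μ)) (Total (degree (suc i) (e ∷ μ))) (λ {i} {j} {d} {d′} → total-+ i j d d′)
    (powL (substVar u (suc i)) e) (substMon u (suc (suc i)) μ) (graded-powL (substVar u (suc i)) (suc i) (graded-substVar i) e) (graded-substMon (suc i) μ)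

  constant-term : ∀ i → ∃ λ c → (c , []) ∈ lookupL (substVar u (suc i)) (suc i)
  constant-term i = _ , last i
    where
    last : ∀ i {c : Frac} → (c , []) ∈ lookupL (replicate i 0Λ ++ constΛ c ∷ []) i
    last zero = here refl
    last (suc i) = last i

  constant-term-powL : ∀ X e → ∃ (λ c → (c , []) ∈ lookupL X e) → ∀ k → ∃ λ c → (c , []) ∈ lookupL (powL X k) (k * e)
  constant-term-powL X e _ zero = 1F , here refl
  constant-term-powL X e h@(_ , c∈) (suc k) with constant-term-powL X e h k
  ... | _ , d∈ = _ , ∈-mulL⁺ X (powL X k) e (k * e) c∈ d∈

  -- Taking the summand p_i[M[u]_q] w^i from every factor p_i removes all variables and leaves the
  -- top power of w.
  constant-term-substMon : ∀ i μ → ∃ λ c → (c , []) ∈ lookupL (substMon u (suc i) μ) (degree (suc i) μ)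
  constant-term-substMon i [] = 1F , here refl
  constant-term-substMon i (e ∷ μ) with constant-term-powL (substVar u (suc i)) (suc i) (constant-term i) e | constant-term-substMon (suc i) μ
  ... | _ , c∈ | _ , d∈ = _ , ∈-mulL⁺ (powL (substVar u (suc i)) e) (substMon u (suc (suc i)) μ) (e * suc i) (degree (suc (suc i)) μ) c∈ d∈

  exponent-coefficient : ℕ → Frac
  exponent-coefficient k = divF (-F bt (suc k) u) (fromℕF (suc k))

  good-exponent : ∀ k → ¬ Bad (exponent-coefficient k *F 1F)
  good-exponent k = good-* {exponent-coefficient k} {1F}
    (good-* { -F bt (suc k) u} {invF (fromℕF (suc k))} (good-* { -1F} {bt (suc k) u} good-neg1 (good (bt (suc k) u) (bt≉0 k u₀)))
      (good-1/ (suc k) (ℕ≉0 k)))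
    good-1

  exponent-term : ℕ → Λ
  exponent-term k = scaleΛ (exponent-coefficient k) (pΛ (suc k))

  omegaSeries≡ : ∀ N → omegaSeries u N ≡ 0Λ ∷ applyUpTo exponent-term N
  omegaSeries≡ N = cong (0Λ ∷_) (Listₚ.map-upTo exponent-term N)

  omega-full : FullSequence (omegaCoeff u)
  omega-full = record { graded = λ r {c} {μ} t∈ → graded r (subst ((c , μ) ∈_) (omegaCoeff≡sum u r) t∈)
                      ; attained = λ ν → proj₁ (attained ν) , subst ((proj₁ (attained ν) , strip ν) ∈_) (sym (omegaCoeff≡sum u (degree 1 ν))) (proj₂ (attained ν)) }
    where
    good-term : ∀ k {t} → t ∈ exponent-term k → ¬ Bad (proj₁ t) × degree 1 (proj₂ t) ≡ suc k
    good-term k (here refl) = good-exponent k , degree-unit 1 k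
    open FullSequence (sum-fullSequence (λ j → invF (fromℕF (fact j))) (λ j → good-1/ (fact j) (≈-≉0 (val-ℕ (fact j)) (fact≉0 j)))
      (omegaSeries u) good-1
      (λ r → subst (Graded Exact) (sym (omegaSeries≡ r)) (graded-series r exponent-term good-term))
      (λ r k k<r → _ , subst ((exponent-coefficient k *F 1F , unit k) ∈_)
        (sym (trans (cong (λ S → lookupL S (suc k)) (omegaSeries≡ r)) (lookup-applyUpTo exponent-term r k k<r))) (here refl)))

  -- Only coefficients of F can have zero denominators, since those of the substitution and of g are
  -- good; homogeneity then fixes the degree. Conversely, the constant top term of the substitution
  -- meets every monomial of g in that degree.
  act-full : ∀ g → FullSequence g → ∀ v → Full v (λ F → act (shiftPlus u F) g v)
  act-full g full v = record { bad-source = source ; bad-target = target }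
    where
    open FullSequence full
    regroup : ∀ d j v → d + j + v ≡ d + (v + j)
    regroup = solve-∀
    source : ∀ F {c ν} → (c , ν) ∈ act (shiftPlus u F) g v → Bad c → BadSource v F ν
    source F c∈ bad-c with ∈-act⁻ (shiftPlus u F) g v c∈
    ... | j , (e , α) , (f , β) , e∈ , f∈ , refl with bad-* e f bad-c
    ...   | inj₂ bad-f = contradiction bad-f (proj₁ (graded (v + j) f∈))
    ...   | inj₁ bad-e with ∈-shiftPlus⁻ u F j e∈
    ...     | d , μ , (h , γ) , d∈ , h∈ , refl with bad-* d h bad-e
    ...       | inj₂ bad-h = contradiction bad-h (proj₁ (graded-substMon 0 μ h∈))
    ...       | inj₁ bad-d = d , μ , d∈ , bad-d , (begin
      degree 1 μ + v ≡⟨ cong (_+ v) (sym (proj₂ (graded-substMon 0 μ h∈))) ⟩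
      degree 1 γ + j + v ≡⟨ regroup (degree 1 γ) j v ⟩
      degree 1 γ + (v + j) ≡⟨ cong (λ x → degree 1 γ + x) (sym (proj₂ (graded (v + j) f∈))) ⟩
      degree 1 γ + degree 1 β ≡⟨ sym (degree-addMon 1 γ β) ⟩
      degree 1 (addMon γ β) ∎)
      where open ≡-Reasoning
    target : ∀ F ν → BadTarget v F ν (act (shiftPlus u F) g v)
    target F ν {d} {μ} d∈ bad-d eq with constant-term-substMon 0 μ | attained ν
    ... | c , c∈ | e , e∈ = (d *F c) *F e ,
      ∈-act⁺ (shiftPlus u F) g v (degree 1 μ) (∈-shiftPlus⁺ u F (degree 1 μ) d∈ c∈)
        (subst (λ r → (e , strip ν) ∈ g r) (trans (sym eq) (ℕₚ.+-comm (degree 1 μ) v)) e∈) ,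
      bad-*ˡ (d *F c) e (bad-*ˡ d c bad-d)

  D-full : ∀ v → Full v (D u v)
  D-full v = full-≡ (λ F → sym (D≡act u v F)) (act-full (omegaCoeff u) omega-full v)

-- From pairings back to formal coefficients

module Coefficients (K : CommutativeRing 0ℓ 0ℓ) (E : Evaluation K) where
  open SymmetricFunctions K E
  open Scalars K E
  open Evaluation E
  private module K = CommutativeRing K

  _≟ᴹ_ : (μ ν : Mon) → Dec (μ ≡ ν)
  _≟ᴹ_ = Listₚ.≡-dec ℕₚ._≟_

  indicator : Mon → Mon → K.Carrier
  indicator ν μ with strip μ ≟ᴹ strip ν
  ... | yes _ = K.1#
  ... | no  _ = K.0#

  coefficient-bad : ∀ F ν {t} → t ∈ F → Bad (proj₁ t) → strip (proj₂ t) ≡ strip ν → Bad (coeffΛ F ν)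
  coefficient-bad ((c , μ) ∷ F) ν t∈ bad eq with strip μ ≟ᴹ strip ν
  coefficient-bad ((c , μ) ∷ F) ν (here refl) bad eq | yes _ = bad-*ˡ c (coeffΛ F ν) bad
  coefficient-bad ((c , μ) ∷ F) ν (there t∈) bad eq    | yes _ = bad-*ʳ c (coeffΛ F ν) (coefficient-bad F ν t∈ bad eq)
  coefficient-bad ((c , μ) ∷ F) ν (here refl) bad eq | no ne = contradiction eq ne
  coefficient-bad ((c , μ) ∷ F) ν (there t∈) bad eq    | no _ = coefficient-bad F ν t∈ bad eq

  coefficient-source : ∀ F ν → Bad (coeffΛ F ν) → ∃ λ t → t ∈ F × Bad (proj₁ t) × strip (proj₂ t) ≡ strip ν
  coefficient-source [] ν bad = contradiction bad (good 1F (≈-≉0 val-1 1≉0))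
  coefficient-source ((c , μ) ∷ F) ν bad with strip μ ≟ᴹ strip ν
  ... | no _ with coefficient-source F ν bad
  ...   | t , t∈ , rest = t , there t∈ , rest
  coefficient-source ((c , μ) ∷ F) ν bad | yes eq with bad-* c (coeffΛ F ν) bad
  ... | inj₁ bad-c = (c , μ) , here refl , bad-c , eq
  ... | inj₂ bad-F with coefficient-source F ν bad-F
  ...   | t , t∈ , rest = t , there t∈ , rest

  val-coefficient : ∀ F ν → ¬ Bad (coeffΛ F ν) → val (coeffΛ F ν) K.≈ pair F (indicator ν)
  val-coefficient [] ν _ = val-0
  val-coefficient ((c , μ) ∷ F) ν good-F with strip μ ≟ᴹ strip ν
  ... | yes _ = K.trans (val-+ c (coeffΛ F ν) (good-F ∘ bad-*ˡ c (coeffΛ F ν)) good-rest)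
      (K.+-cong (K.sym (K.*-identityʳ _)) (val-coefficient F ν good-rest))
    where
    good-rest : ¬ Bad (coeffΛ F ν)
    good-rest = good-F ∘ bad-*ʳ c (coeffΛ F ν)
  ... | no _ = K.trans (val-coefficient F ν good-F) (K.sym (K.trans (K.+-congʳ (K.zeroʳ _)) (K.+-identityˡ _)))

  -- Both cross products contain a zero denominator.
  bad-≈F : ∀ x y → Bad x → Bad y → x ≈F y
  bad-≈F x y bx by = P.trans {num x *P den y} {[]} {num y *P den x}
    (P.trans {num x *P den y} {num x *P []} {[]} (P.*-congˡ {num x} {den y} {[]} by) (P.zeroʳ (num x)))
    (P.sym {num y *P den x} {[]} (P.trans {num y *P den x} {num y *P []} {[]} (P.*-congˡ {num y} {den x} {[]} bx) (P.zeroʳ (num y))))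
    where module P = CommutativeRing polyRing

  bad-transfer : ∀ {n A B} → Full n A → Full n B → ∀ F ν → Bad (coeffΛ (A F) ν) → Bad (coeffΛ (B F) ν)
  bad-transfer {n} {A} {B} fA fB F ν bad with coefficient-source (A F) ν bad
  ... | (c , ν′) , c∈ , bad-c , eq with bad-source fA F c∈ bad-c
  ...   | d , μ , d∈ , bad-d , deg with bad-target fB F ν d∈ bad-d
    (trans deg (trans (sym (degree-strip 1 ν′)) (trans (cong (degree 1) eq) (degree-strip 1 ν))))
  ...     | e , e∈ , bad-e = coefficient-bad (B F) ν e∈ bad-e (strip-idempotent ν)

  -- At each monomial the two coefficients are both good, and then their values decide, or both bad,
  -- and then `≈F` holds trivially. The mixed cases are excluded because full operators of the same
  -- degree spoil the same monomials.
  ≈Op-from-~ : ∀ {n A B} → Full n A → Full n B → (∀ F → A F ~ B F) → A ≈Op B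
  ≈Op-from-~ {n} {A} {B} fA fB A~B F ν with bad? (coeffΛ (A F) ν) | bad? (coeffΛ (B F) ν)
  ... | yes bA | yes bB = bad-≈F (coeffΛ (A F) ν) (coeffΛ (B F) ν) bA bB
  ... | yes bA | no gB  = contradiction (bad-transfer fA fB F ν bA) gB
  ... | no gA  | yes bB = contradiction (bad-transfer fB fA F ν bB) gA
  ... | no gA  | no gB  = val-reflect (coeffΛ (A F) ν) (coeffΛ (B F) ν) gA gB
    (K.trans (val-coefficient (A F) ν gA) (K.trans (pairing (A~B F) (indicator ν)) (K.sym (val-coefficient (B F) ν gB))))

-- Induction over the operators Q and comparison of scalars

module Assembly (K : CommutativeRing 0ℓ 0ℓ) (E : Evaluation K) where
  open SymmetricFunctions K E
  open Scalars K E
  open Operators K E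
  open Coefficients K E
  open Evaluation E
  private
    module K = CommutativeRing K
    module R = CommutativeRing ΛRing
  open Solver K
  open Powers K using (_^_; ^-homo-*)

  -- Free of halving and division: κ = q^e [k]/[u] with 2e = (u - 1)(v + 1) - (k - 1), where u = u₀
  -- + 1 and k = k₀ + 1. This e remains when the power of q on the left of the theorem is moved to
  -- the right.
  record Proportional (k₀ u₀ v : ℕ) (A : Op) : Set where
    field
      full     : Full v A
      κ        : K.Carrier
      e        : ℕ
      multiple : MultipleOfD A (suc u₀) v κ
      κ-val    : κ K.* [ suc u₀ ] K.≈ [ suc k₀ ] K.* q ^ e
      e-val    : e + e + k₀ ≡ u₀ * suc v
  open Proportional

  good-neg1 : ¬ Bad -1F
  good-neg1 = good -1F (≈-≉0 val-neg1 -1≉0)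

  proportional-D : ∀ v → Proportional 0 0 v (D 1 v)
  proportional-D v = record
    { full = DFull.D-full K E 0 v ; κ = K.1# ; e = 0
    ; multiple = λ F → R.sym (R.trans (R.*-congʳ {D 1 v F} η-1) (R.*-identityˡ (D 1 v F)))
    ; κ-val = K.*-comm _ _ ; e-val = refl }

  proportional-step : ∀ {A A′} k₀ u₀ v u₀′ v′ → Proportional 0 u₀ v A → Proportional 0 u₀′ v′ A′ →
    suc u₀′ * v ≡ suc u₀ * v′ + suc k₀ → Proportional k₀ (u₀ + suc u₀′) (v + v′) (invF M • ⟦ A , A′ ⟧)
  proportional-step {A} {A′} k₀ u₀ v u₀′ v′ P P′ det = record
    { full = full-scale (invF M) (proj₂ (val≉0⇒good M (Mk≉0 0))) (full-commutator good-neg1 (full P) (full P′))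
    ; κ = _
    ; e = suc (e P + e P′ + suc u₀ * v′)
    ; multiple = multiple-step {A} {A′} u₀ v u₀′ v′ (multiple P) (multiple P′)
    ; κ-val = step-val u₀ v (suc u₀′) v′ (suc k₀) {e = e P} {e′ = e P′} (unit-val P) (unit-val P′) det
    ; e-val = total }
    where
    unit-val : ∀ {u₀ v A} (P : Proportional 0 u₀ v A) → κ P K.* [ suc u₀ ] K.≈ q ^ e P
    unit-val P = K.trans (κ-val P) (K.trans (K.*-congʳ [1]≈1) (K.*-identityˡ _))
    -- With u = u₀ + 1 and u′ = u₀′ + 1, one of the two copies of u v′ becomes u′ v through the
    -- area, the other stays, and together they complete the product (u + u′ - 1)(v + v′ + 1).
    total : suc (e P + e P′ + suc u₀ * v′) + suc (e P + e P′ + suc u₀ * v′) + k₀ ≡ (u₀ + suc u₀′) * suc (v + v′)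
    total = begin
      suc (e P + e P′ + suc u₀ * v′) + suc (e P + e P′ + suc u₀ * v′) + k₀
        ≡⟨ regroup₁ (e P) (e P′) (suc u₀ * v′) k₀ ⟩
      suc ((e P + e P + 0) + (e P′ + e P′ + 0) + suc u₀ * v′ + (suc u₀ * v′ + suc k₀))
        ≡⟨ cong suc (cong₂ _+_ (cong (_+ suc u₀ * v′) (cong₂ _+_ (e-val P) (e-val P′))) (sym det)) ⟩
      suc (u₀ * suc v + u₀′ * suc v′ + suc u₀ * v′ + suc u₀′ * v)
        ≡⟨ regroup₂ u₀ u₀′ v v′ ⟩
      (u₀ + suc u₀′) * suc (v + v′) ∎
      where
      open ≡-Reasoning
      regroup₁ : ∀ e e′ x k → suc (e + e′ + x) + suc (e + e′ + x) + k ≡ suc ((e + e + 0) + (e′ + e′ + 0) + x + (x + suc k))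
      regroup₁ = solve-∀
      regroup₂ : ∀ u u′ v v′ → suc (u * suc v + u′ * suc v′ + suc u * v′ + suc u′ * v) ≡ (u + suc u′) * suc (v + v′)
      regroup₂ = solve-∀

  from-splitting : ∀ {A A′} k₀ {m n} (s : Splitting (suc k₀) m n) → let open Splitting s in
    Proportional 0 a′ b′ A → Proportional 0 a b A′ → ∀ u₀ → suc k₀ * m ≡ suc u₀ →
    Proportional k₀ u₀ (suc k₀ * n) (invF M • ⟦ A , A′ ⟧)
  from-splitting {A} {A′} k₀ s P P′ u₀ eq = subst (λ u → Proportional k₀ u _ (invF M • ⟦ A , A′ ⟧)) (ℕₚ.suc-injective (trans width eq))
    (subst (λ v → Proportional k₀ (a′ + suc a) v (invF M • ⟦ A , A′ ⟧)) height (proportional-step {A} {A′} k₀ a′ b′ a b P P′ area))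
    where open Splitting s

  -- The greatest common divisor of m and 0 is m, so a second entry 0 can occur only for m = 1.
  positive : ∀ m n → Coprime (suc (suc m)) n → 1 ≤ n
  positive m zero c = contradiction (c (∣-refl , suc (suc m) ∣0)) (λ ())
  positive m (suc n) c = s≤s z≤n

  -- Both pieces have smaller first entry, so the fuel suffices. Arbitrary sufficient fuel is
  -- allowed because `Qf` may pass on more than `Qs` would assign to the same pair.
  Qf-proportional : ∀ f u₀ v → u₀ < f → Coprime (suc u₀) v → Proportional 0 u₀ v (Qf f (suc u₀) v)
  Qf-proportional (suc f) zero v _ c = proportional-D v
  Qf-proportional (suc f) (suc u₀) v (s≤s u₀<f) c = go (splitting 1 (suc u₀) v (s≤s (s≤s z≤n)) (positive u₀ v c) c)
    where
    go : Splitting 1 (suc (suc u₀)) v → Proportional 0 (suc u₀) v (Qf (suc f) (suc (suc u₀)) v)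
    go s rewrite Splitting.chosen s = result
      where
      open Splitting s
      sum : a′ + suc a ≡ suc u₀
      sum = trans (ℕₚ.suc-injective width) (ℕₚ.+-identityʳ (suc u₀))
      a′<f : a′ < f
      a′<f = ℕₚ.<-≤-trans (subst (a′ <_) sum (ℕₚ.m<m+n a′ (s≤s z≤n))) u₀<f
      a<f : a < f
      a<f = ℕₚ.<-≤-trans (subst (a <_) sum (ℕₚ.m≤n+m (suc a) a′)) u₀<f
      left : Proportional 0 a′ b′ (Qf f (suc (suc u₀) ∸ suc a) (v ∸ b))
      left = ≡.subst₂ (λ x y → Proportional 0 a′ b′ (Qf f x y))
        (sym (trans (cong (_∸ suc a) (sym (ℕₚ.+-identityʳ (suc (suc u₀))))) complementˡ))
        (sym (trans (cong (_∸ b) (sym (ℕₚ.+-identityʳ v))) complementʳ))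
        (Qf-proportional f a′ b′ a′<f coprime′)
      result : Proportional 0 (suc u₀) v (invF M • ⟦ Qf f (suc (suc u₀) ∸ suc a) (v ∸ b) , Qf f (suc a) b ⟧)
      result = subst (λ w → Proportional 0 (suc u₀) w (invF M • ⟦ Qf f (suc (suc u₀) ∸ suc a) (v ∸ b) , Qf f (suc a) b ⟧)) (ℕₚ.+-identityʳ v)
        (from-splitting {Qf f (suc (suc u₀) ∸ suc a) (v ∸ b)} {Qf f (suc a) b} 0 s left (Qf-proportional f a b a<f coprime) (suc u₀) (ℕₚ.+-identityʳ (suc (suc u₀))))

  QsK-proportional : ∀ k₀ m₀ n → 1 ≤ n → Coprime (suc m₀) n → Proportional k₀ (m₀ + k₀ * suc m₀) (suc k₀ * n) (QsK (suc k₀) (suc m₀) n)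
  QsK-proportional zero m₀ n _ c = ≡.subst₂ (λ u v → Proportional 0 u v (Qs (suc m₀) n)) (sym (ℕₚ.+-identityʳ m₀)) (sym (ℕₚ.+-identityʳ n))
    (Qf-proportional (suc m₀) m₀ n ℕₚ.≤-refl c)
  QsK-proportional (suc k₀) m₀ n 1≤n c = go (splitting (suc (suc k₀)) m₀ n 2≤km 1≤n c)
    where
    2≤km : 2 ≤ suc (suc k₀) * suc m₀
    2≤km = ℕₚ.*-mono-≤ {2} {suc (suc k₀)} {1} {suc m₀} (s≤s (s≤s z≤n)) (s≤s z≤n)
    go : Splitting (suc (suc k₀)) (suc m₀) n → Proportional (suc k₀) (m₀ + suc k₀ * suc m₀) (suc (suc k₀) * n) (QsK (suc (suc k₀)) (suc m₀) n)
    go s rewrite Splitting.chosen s = from-splitting (suc k₀) s left (Qf-proportional (suc a) a b ℕₚ.≤-refl coprime) _ refl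
      where
      open Splitting s
      left : Proportional 0 a′ b′ (Qs (suc (suc k₀) * suc m₀ ∸ suc a) (suc (suc k₀) * n ∸ b))
      left = ≡.subst₂ (λ x y → Proportional 0 a′ b′ (Qs x y)) (sym complementˡ) (sym complementʳ)
        (Qf-proportional (suc a′) a′ b′ ℕₚ.≤-refl coprime′)

  -- The exponents on the two sides differ by exactly e, by `e-val`; the scalars are then compared
  -- after multiplication by [u], which is nonzero.
  proportional⇒≈Op : ∀ k₀ u₀ v₀ {A} → Proportional k₀ u₀ (suc v₀) A →
    (qpow ⌊ u₀ * v₀ + k₀ /2⌋ • A) ≈Op ((qpow (u₀ * suc v₀) *F divF (bq 1 (suc k₀)) (bq 1 (suc u₀))) • D (suc u₀) (suc v₀))
  proportional⇒≈Op k₀ u₀ v₀ {A} P = ≈Op-from-~ {A = qpow x • A} {B = c • D u v}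
    (full-scale (qpow x) (good (qpow x) (≈-≉0 (val-qpow x) (q^≉0 x))) (full P))
    (full-scale c (good-* {qpow y} {ratio} (good (qpow y) (≈-≉0 (val-qpow y) (q^≉0 y)))
      (good ratio (*≉0ˡ (≈-≉0 (val-divF (bq 1 (suc k₀)) (bq 1 u) (bq≉0 0 u₀)) (bq≉0 0 k₀)))))
      (DFull.D-full K E u₀ v))
    (λ F → R.trans (scale~η (qpow x) (A F)) (R.trans (R.*-congˡ {η (val (qpow x))} (multiple P F))
      (R.trans (R.sym (R.*-assoc (η (val (qpow x))) (η (κ P)) (D u v F)))
      (R.trans (R.*-congʳ {D u v F} (R.trans (R.sym (η-* (val (qpow x)) (κ P))) (η-cong scalars)))
        (R.sym (scale~η c (D u v F)))))))
    where
    u v x y : ℕ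
    u = suc u₀
    v = suc v₀
    x = ⌊ u₀ * v₀ + k₀ /2⌋
    y = u₀ * suc v₀
    ratio c : Frac
    ratio = divF (bq 1 (suc k₀)) (bq 1 u)
    c = qpow y *F ratio
    exponents : x + e P ≡ y
    exponents = ⌊half⌋ (u₀ * v₀ + k₀) (e P) y (trans (regroup₁ (u₀ * v₀) k₀ (e P)) (trans (cong (λ x → u₀ * v₀ + x) (e-val P)) (regroup₂ u₀ v₀)))
      where
      regroup₁ : ∀ a k e → a + k + (e + e) ≡ a + (e + e + k)
      regroup₁ = solve-∀
      regroup₂ : ∀ u v → u * v + u * suc (suc v) ≡ u * suc v + u * suc v
      regroup₂ = solve-∀
    scalars : val (qpow x) K.* κ P K.≈ val c
    scalars = cancelˡ _ _ (bq≉0 0 u₀) (begin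
      [ u ] K.* (val (qpow x) K.* κ P)
        ≈⟨ solve 3 (λ u a b → u :* (a :* b) := a :* (b :* u)) K.refl [ u ] (val (qpow x)) (κ P) ⟩
      val (qpow x) K.* (κ P K.* [ u ])
        ≈⟨ K.*-cong (val-qpow x) (κ-val P) ⟩
      q ^ x K.* ([ suc k₀ ] K.* q ^ e P)
        ≈⟨ solve 3 (λ a b c → a :* (b :* c) := (a :* c) :* b) K.refl (q ^ x) [ suc k₀ ] (q ^ e P) ⟩
      (q ^ x K.* q ^ e P) K.* [ suc k₀ ]
        ≈⟨ K.*-congʳ (K.trans (K.sym (^-homo-* q x (e P))) (K.reflexive (cong (q ^_) exponents))) ⟩
      q ^ y K.* [ suc k₀ ]
        ≈⟨ K.*-cong (K.sym (val-qpow y)) (K.sym (val-divF (bq 1 (suc k₀)) (bq 1 u) (bq≉0 0 u₀))) ⟩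
      val (qpow y) K.* (val ratio K.* [ u ])
        ≈⟨ solve 3 (λ a b c → a :* (b :* c) := c :* (a :* b)) K.refl (val (qpow y)) (val ratio) [ u ] ⟩
      [ u ] K.* (val (qpow y) K.* val ratio)
        ≈⟨ K.*-congˡ (K.sym (val-* (qpow y) ratio)) ⟩
      [ u ] K.* val c ∎)
      where open SetoidReasoning K.setoid

theoremI2 : (m n k : ℕ) → 1 ≤ m → 1 ≤ n → Coprime m n → 1 ≤ k →
    (qpow (expL k m n) • QsK k m n)
    ≈Op ((qpow (expR k m n) *F divF (bq 1 k) (bq 1 (k * m))) • D (k * m) (k * n))
theoremI2 (suc m) (suc n) (suc k) _ 1≤n c _ = proportional⇒≈Op k (m + k * suc m) (n + k * suc n) (QsK-proportional k m (suc n) 1≤n c)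
  where open Assembly _ RationalFunctions.fractionEvaluation
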